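{- Let $k\in\mathbb{Z}$, $\mu\in\mathbb{C}$, $s\in\mathbb{Z}_{\ge0}$, and $\lambda\in\mathbb{C}$ with $\lambda\neq1$. For every integer $n\ge0$, as polynomials in $x$, $$CP_{n}^{(k)}(x;\lambda,\mu)=\sum_{m=0}^{n}(-1)^{m}\left\{\sum_{l=0}^{n-m}\sum_{i=0}^{\min\{s,l\}}\binom{n}{l}\binom{s}{i}(l)_{i}\left(\frac{\lambda}{\lambda-1}\right)^{i}S_{1}(n-l,m)\,CP_{l-i}^{(k)}(s;\lambda,\mu)\right\}H_{m}^{(s)}(x|\lambda).$$
   Context: All generating functions are formal power series in $t$ over $\mathbb{C}$. For $k\in\mathbb{Z}$, $\mathrm{Lif}_k(t)=\sum_{n=0}^{\infty}\frac{t^{n}}{n!(n+1)^{k}}$. For $\lambda,\mu\in\mathbb{C}$, $(1+t)^{\lambda}=\sum_{j\ge0}\binom{\lambda}{j}t^j$ and $(1+(1+t)^{\lambda})^{ -\mu}=2^{ -\mu}\bigl(1+\frac12\sum_{j\ge 1}\binom{\lambda}{j}t^{j}\bigr)^{ -\mu}$ (binomial series, $2^{ -\mu}=e^{ -\mu\log 2}$). The poly-Cauchy of the first kind and Peters mixed-type polynomials $CP_n^{(k)}(x;\lambda,\mu)$ are defined by $$(1+(1+t)^{\lambda})^{ -\mu}\,\mathrm{Lif}_k(\log(1+t))\,(1+t)^{ -x}=\sum_{n=0}^{\infty}CP_n^{(k)}(x;\lambda,\mu)\frac{t^n}{n!}.$$ The falling factorial is $(x)_n=x(x-1)\cdots(x-n+1)$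 (with $(x)_0=1$), and the Stirling numbers of the first kind $S_1(n,l)$ are defined by $(x)_n=\sum_{l=0}^{n}S_1(n,l)x^{l}$, with $S_1(n,l)=0$ for $l>n$. For $\lambda\ne1$ and $s\in\mathbb{Z}_{\ge0}$, the Frobenius-Euler polynomials of order $s$ are defined by $\left(\frac{1-\lambda}{e^{t}-\lambda}\right)^{s}e^{xt}=\sum_{n\ge0}H_n^{(s)}(x|\lambda)\frac{t^n}{n!}$. The same $\lambda$ is used in $CP_n^{(k)}(x;\lambda,\mu)$ and in $H_m^{(s)}(x|\lambda)$. A zeroth power equals $1$. -}

module Defs where

open import Algebra.Bundles using (CommutativeRing; RawRing)
open import Algebra.Structures using (IsCommutativeRing)
import Algebra.Morphism.RingMonomorphism as RingMonomorphism
open import Algebra.Morphism.Structures using (module RingMorphisms)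
import Algebra.Properties.CommutativeSemigroup as CommutativeSemigroupProperties
import Algebra.Properties.Ring as RingProperties
import Algebra.Properties.Semiring.Exp as Exp
import Algebra.Properties.Monoid.Sum as Sum
import Algebra.Solver.Ring.Simple as RingSolver
import Algebra.Solver.Ring.AlmostCommutativeRing as ACR
open import Data.Fin.Base using (toℕ)
open import Data.Integer.Base as ℤ using (ℤ; +_; -[1+_])
import Data.Integer.Properties as ℤₚ
open import Data.List.Base using (List; []; _∷_; map)
open import Data.Nat.Base as ℕ using (ℕ; zero; suc; _≤_; z≤n; s≤s; _⊔_; _∸_; _!; NonZero)
import Data.Nat.Properties as ℕₚ
open import Data.Product.Base using (_×_; _,_; ∃)
open import Data.Rational.Base as ℚ using (ℚ; mkℚ; 0ℚ; 1ℚ; ½; _/_; ∣_∣)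
import Data.Rational.Properties as ℚₚ
import Data.Rational.Unnormalised.Base as ℚᵘ
import Data.Rational.Unnormalised.Properties as ℚᵘₚ
open import Data.Rational.Solver using (module +-*-Solver)
open import Data.Sum.Base using (inj₁; inj₂)
open import Function.Base using (_∘_)
open import Level using (0ℓ)
import Relation.Binary.Reasoning.Setoid as SetoidReasoning
open import Relation.Binary.PropositionalEquality
  using (_≡_; _≢_; refl; sym; trans; cong; cong₂; subst; subst₂; isEquivalence; module ≡-Reasoning)
open import Relation.Nullary using (¬_; Dec; yes; no; contradiction)

module Sums (R : CommutativeRing 0ℓ 0ℓ) where
  open CommutativeRing R renaming (refl to ≈-refl; sym to ≈-sym; trans to ≈-trans)
  open Sum +-monoid using (sum)

  ∑≤ : ℕ → (ℕ → Carrier) → Carrier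
  ∑≤ n f = sum {suc n} (f ∘ toℕ)

  ∑≤-cong : ∀ n {f g : ℕ → Carrier} → (∀ i → f i ≈ g i) → ∑≤ n f ≈ ∑≤ n g
  ∑≤-cong zero    f≈g = +-congʳ (f≈g 0)
  ∑≤-cong (suc n) f≈g = +-cong (f≈g 0) (∑≤-cong n (f≈g ∘ suc))

  ∑≤-last : ∀ n (f : ℕ → Carrier) → ∑≤ (suc n) f ≈ ∑≤ n f + f (suc n)
  ∑≤-last zero f = ≈-trans (+-congˡ (+-identityʳ _)) (+-congʳ (≈-sym (+-identityʳ _)))
  ∑≤-last (suc n) f = ≈-trans (+-congˡ (∑≤-last n (f ∘ suc))) (≈-sym (+-assoc _ _ _))

fromℕ : ℕ → ℚ
fromℕ n = + n / 1

1/[_]! : ℕ → ℚ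
1/[ n ]! = (+ 1 / (n !)) {{n ℕₚ.!≢0}}

open Exp (CommutativeRing.semiring ℚₚ.+-*-commutativeRing) using (_^_)

*-mono-≤ : ∀ {p q r s} → 0ℚ ℚ.≤ q → 0ℚ ℚ.≤ r → p ℚ.≤ q → r ℚ.≤ s → p ℚ.* r ℚ.≤ q ℚ.* s
*-mono-≤ {p} {q} {r} {s} 0≤q 0≤r p≤q r≤s = ℚₚ.≤-trans
  (ℚₚ.*-monoʳ-≤-nonNeg r {{ℚ.nonNegative 0≤r}} p≤q)
  (ℚₚ.*-monoˡ-≤-nonNeg q {{ℚ.nonNegative 0≤q}} r≤s)

0≤* : ∀ {p q} → 0ℚ ℚ.≤ p → 0ℚ ℚ.≤ q → 0ℚ ℚ.≤ p ℚ.* q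
0≤* {p} {q} 0≤p 0≤q = ℚₚ.nonNegative⁻¹ (p ℚ.* q)
  {{ℚₚ.nonNeg*nonNeg⇒nonNeg p {{ℚ.nonNegative 0≤p}} q {{ℚ.nonNegative 0≤q}}}}

0<* : ∀ {p q} → 0ℚ ℚ.< p → 0ℚ ℚ.< q → 0ℚ ℚ.< p ℚ.* q
0<* {p} {q} 0<p 0<q = ℚₚ.positive⁻¹ (p ℚ.* q)
  {{ℚₚ.pos*pos⇒pos p {{ℚ.positive 0<p}} q {{ℚ.positive 0<q}}}}

0≤∣_∣ : ∀ p → 0ℚ ℚ.≤ ∣ p ∣
0≤∣ p ∣ = ℚₚ.nonNegative⁻¹ ∣ p ∣ {{ℚₚ.∣-∣-nonNeg p}}

0≤+ : ∀ {p q} → 0ℚ ℚ.≤ p → 0ℚ ℚ.≤ q → 0ℚ ℚ.≤ p ℚ.+ q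
0≤+ = ℚₚ.+-mono-≤

0≤1 : 0ℚ ℚ.≤ 1ℚ
0≤1 = ℚₚ.nonNegative⁻¹ 1ℚ

0≤½ : 0ℚ ℚ.≤ ½
0≤½ = ℚₚ.nonNegative⁻¹ ½

rescale : (E : ℚ → Set) (C : ℚ) → 0ℚ ℚ.< C →
  (∀ ε → 0ℚ ℚ.< ε → E (C ℚ.* ε)) → ∀ ε → 0ℚ ℚ.< ε → E ε
rescale E C 0<C h ε 0<ε = subst E eq (h (1/C ℚ.* ε) (0<* 0<1/C 0<ε))
  where
  instance
    posC = ℚ.positive 0<C
    nzC  = ℚₚ.pos⇒nonZero C
  1/C = ℚ.1/ C
  0<1/C = ℚₚ.positive⁻¹ 1/C {{ℚₚ.1/pos⇒pos C}}
  eq : C ℚ.* (1/C ℚ.* ε) ≡ ε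
  eq = trans (sym (ℚₚ.*-assoc C 1/C ε)) (trans (cong (ℚ._* ε) (ℚₚ.*-inverseʳ C)) (ℚₚ.*-identityˡ ε))

fromℕ-+ : ∀ m n → fromℕ (m ℕ.+ n) ≡ fromℕ m ℚ.+ fromℕ n
fromℕ-+ m n = ℚₚ.toℚᵘ-injective (begin
  ℚ.toℚᵘ (fromℕ (m ℕ.+ n))  ≈⟨ ℚₚ.toℚᵘ-fromℚᵘ (ℚᵘ.mkℚᵘ (+ (m ℕ.+ n)) 0) ⟩
  ℚᵘ.mkℚᵘ (+ (m ℕ.+ n)) 0 ≈⟨ ℚᵘ.*≡* (cong (ℤ._* + 1) (cong₂ ℤ._+_ (sym (ℤₚ.*-identityʳ (+ m))) (sym (ℤₚ.*-identityʳ (+ n))))) ⟩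
  ℚᵘ.mkℚᵘ (+ m) 0 ℚᵘ.+ ℚᵘ.mkℚᵘ (+ n) 0 ≈⟨ ℚᵘₚ.+-cong (ℚₚ.toℚᵘ-fromℚᵘ (ℚᵘ.mkℚᵘ (+ m) 0)) (ℚₚ.toℚᵘ-fromℚᵘ (ℚᵘ.mkℚᵘ (+ n) 0)) ⟨
  ℚ.toℚᵘ (fromℕ m) ℚᵘ.+ ℚ.toℚᵘ (fromℕ n) ≈⟨ ℚₚ.toℚᵘ-homo-+ (fromℕ m) (fromℕ n) ⟨
  ℚ.toℚᵘ (fromℕ m ℚ.+ fromℕ n) ∎)
  where open ℚᵘₚ.≃-Reasoning

fromℕ-* : ∀ m n → fromℕ (m ℕ.* n) ≡ fromℕ m ℚ.* fromℕ n
fromℕ-* zero    n = sym (ℚₚ.*-zeroˡ (fromℕ n))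
fromℕ-* (suc m) n = trans (fromℕ-+ n (m ℕ.* n)) (trans
  (cong₂ ℚ._+_ (sym (ℚₚ.*-identityˡ (fromℕ n))) (fromℕ-* m n))
  (trans (sym (ℚₚ.*-distribʳ-+ (fromℕ n) 1ℚ (fromℕ m))) (cong (ℚ._* fromℕ n) (sym (fromℕ-+ 1 m)))))

fromℕ-mono-≤ : ∀ {m n} → m ≤ n → fromℕ m ℚ.≤ fromℕ n
fromℕ-mono-≤ {m} {n} m≤n = subst (fromℕ m ℚ.≤_)
  (trans (sym (fromℕ-+ m (n ∸ m))) (cong fromℕ (ℕₚ.m+[n∸m]≡n m≤n)))
  (subst (ℚ._≤ fromℕ m ℚ.+ fromℕ (n ∸ m)) (ℚₚ.+-identityʳ (fromℕ m))
    (ℚₚ.+-monoʳ-≤ (fromℕ m) (ℚₚ.nonNegative⁻¹ (fromℕ (n ∸ m)) {{ℚₚ.normalize-nonNeg (n ∸ m) 1}})))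

0≤fromℕ : ∀ n → 0ℚ ℚ.≤ fromℕ n
0≤fromℕ n = fromℕ-mono-≤ {0} {n} z≤n

1/n*n : ∀ n .{{_ : NonZero n}} → (+ 1 / n) ℚ.* fromℕ n ≡ 1ℚ
1/n*n n@(suc n-1) = ℚₚ.toℚᵘ-injective (begin
  ℚ.toℚᵘ ((+ 1 / n) ℚ.* fromℕ n) ≈⟨ ℚₚ.toℚᵘ-homo-* (+ 1 / n) (fromℕ n) ⟩
  ℚ.toℚᵘ (+ 1 / n) ℚᵘ.* ℚ.toℚᵘ (fromℕ n) ≈⟨ ℚᵘₚ.*-cong (ℚₚ.toℚᵘ-fromℚᵘ (ℚᵘ.mkℚᵘ (+ 1) n-1)) (ℚₚ.toℚᵘ-fromℚᵘ (ℚᵘ.mkℚᵘ (+ n) 0)) ⟩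
  ℚᵘ.mkℚᵘ (+ 1) n-1 ℚᵘ.* ℚᵘ.mkℚᵘ (+ n) 0 ≈⟨ ℚᵘ.*≡* (trans (ℤₚ.*-identityʳ _) (trans (ℤₚ.*-identityˡ (+ n)) (sym (trans (ℤₚ.*-identityˡ (+ (n ℕ.* 1))) (cong +_ (ℕₚ.*-identityʳ n)))))) ⟩
  ℚᵘ.1ℚᵘ ∎)
  where open ℚᵘₚ.≃-Reasoning

0≤1/ : ∀ n .{{_ : NonZero n}} → 0ℚ ℚ.≤ + 1 / n
0≤1/ n = ℚₚ.nonNegative⁻¹ (+ 1 / n) {{ℚₚ.normalize-nonNeg 1 n}}

toℚᵘ-fromℕ : ∀ n → ℚ.toℚᵘ (fromℕ n) ℚᵘ.≃ ℚᵘ.mkℚᵘ (+ n) 0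
toℚᵘ-fromℕ n = ℚₚ.toℚᵘ-fromℚᵘ (ℚᵘ.mkℚᵘ (+ n) 0)

n≤∣n∣ : ∀ n → n ℤ.≤ + ℤ.∣ n ∣
n≤∣n∣ (+ n)    = ℤₚ.≤-refl
n≤∣n∣ -[1+ n ] = ℤ.-≤+

≤fromℕ : ∀ p → ∃ λ b → 1 ≤ b × p ℚ.≤ fromℕ b
≤fromℕ p@(mkℚ n d _) = suc ℤ.∣ n ∣ , s≤s z≤n , ℚₚ.≤-trans
  (ℚₚ.toℚᵘ-cancel-≤ (ℚᵘₚ.≤-respʳ-≃ (ℚᵘₚ.≃-sym (toℚᵘ-fromℕ ℤ.∣ n ∣)) (ℚᵘ.*≤* n1≤∣n∣d)))
  (fromℕ-mono-≤ (ℕₚ.n≤1+n ℤ.∣ n ∣))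
  where
  n1≤∣n∣d : n ℤ.* + 1 ℤ.≤ + ℤ.∣ n ∣ ℤ.* + suc d
  n1≤∣n∣d = ℤₚ.≤-trans (ℤₚ.*-monoʳ-≤-nonNeg (+ 1) (n≤∣n∣ n))
    (ℤₚ.*-monoˡ-≤-nonNeg (+ ℤ.∣ n ∣) {+ 1} {+ suc d} (ℤ.+≤+ (s≤s z≤n)))

0≤^ : ∀ {p} → 0ℚ ℚ.≤ p → ∀ n → 0ℚ ℚ.≤ p ^ n
0≤^ 0≤p zero    = 0≤1
0≤^ 0≤p (suc n) = 0≤* 0≤p (0≤^ 0≤p n)

½+½ : ∀ p → ½ ℚ.* p ℚ.+ ½ ℚ.* p ≡ p
½+½ p = trans (sym (ℚₚ.*-distribʳ-+ p ½ ½)) (ℚₚ.*-identityˡ p)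

½^≤1 : ∀ n → ½ ^ n ℚ.≤ 1ℚ
½^≤1 zero    = ℚₚ.≤-refl
½^≤1 (suc n) = *-mono-≤ {½} {1ℚ} 0≤1 (0≤^ 0≤½ n) ½≤1 (½^≤1 n)
  where
  ½≤1 : ½ ℚ.≤ 1ℚ
  ½≤1 = ℚ.*≤* (ℤ.+≤+ (s≤s z≤n))

n½^n≤1 : ∀ n → fromℕ n ℚ.* ½ ^ n ℚ.≤ 1ℚ
n½^n≤1 zero    = ℚₚ.≤-trans (ℚₚ.≤-reflexive (ℚₚ.*-zeroˡ 1ℚ)) 0≤1
n½^n≤1 (suc n) = begin
  fromℕ (suc n) ℚ.* ½ ^ suc n                       ≡⟨ cong (ℚ._* ½ ^ suc n) (fromℕ-+ 1 n) ⟩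
  (1ℚ ℚ.+ fromℕ n) ℚ.* (½ ℚ.* ½ ^ n)                ≡⟨ solve 3 (λ f h p → (con 1ℚ :+ f) :* (h :* p) := h :* p :+ h :* (f :* p)) refl (fromℕ n) ½ (½ ^ n) ⟩
  ½ ℚ.* ½ ^ n ℚ.+ ½ ℚ.* (fromℕ n ℚ.* ½ ^ n)         ≤⟨ ℚₚ.+-mono-≤ (ℚₚ.*-monoˡ-≤-nonNeg ½ (½^≤1 n)) (ℚₚ.*-monoˡ-≤-nonNeg ½ (n½^n≤1 n)) ⟩
  ½ ℚ.* 1ℚ ℚ.+ ½ ℚ.* 1ℚ                             ≡⟨ ½+½ 1ℚ ⟩
  1ℚ                                                ∎
  where
  open ℚₚ.≤-Reasoning
  open +-*-Solver

-- C · 2⁻ⁿ gets below every ε > 0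
C½^n≤ε : ∀ C ε → 0ℚ ℚ.< ε → ∃ λ N → C ℚ.* ½ ^ N ℚ.≤ ε
C½^n≤ε C ε 0<ε with ≤fromℕ (C ℚ.* 1/ε)
  where
  instance nz = ℚₚ.pos⇒nonZero ε {{ℚ.positive 0<ε}}
  1/ε = ℚ.1/ ε
... | b , _ , C/ε≤b = b , (begin
  C ℚ.* ½ ^ b                   ≡⟨ C≡C/ε*ε ⟩
  (C ℚ.* 1/ε) ℚ.* (ε ℚ.* ½ ^ b) ≤⟨ *-mono-≤ (0≤fromℕ b) (0≤* (ℚₚ.<⇒≤ 0<ε) (0≤^ 0≤½ b)) C/ε≤b ℚₚ.≤-refl ⟩
  fromℕ b ℚ.* (ε ℚ.* ½ ^ b)     ≡⟨ solve 3 (λ x y z → x :* (y :* z) := y :* (x :* z)) refl (fromℕ b) ε (½ ^ b) ⟩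
  ε ℚ.* (fromℕ b ℚ.* ½ ^ b)     ≤⟨ ℚₚ.*-monoˡ-≤-nonNeg ε {{ℚ.nonNegative (ℚₚ.<⇒≤ 0<ε)}} (n½^n≤1 b) ⟩
  ε ℚ.* 1ℚ                      ≡⟨ ℚₚ.*-identityʳ ε ⟩
  ε                             ∎)
  where
  open ℚₚ.≤-Reasoning
  open +-*-Solver
  instance nz = ℚₚ.pos⇒nonZero ε {{ℚ.positive 0<ε}}
  1/ε = ℚ.1/ ε
  C≡C/ε*ε : C ℚ.* ½ ^ b ≡ (C ℚ.* 1/ε) ℚ.* (ε ℚ.* ½ ^ b)
  C≡C/ε*ε = trans (cong (ℚ._* ½ ^ b) (trans (sym (ℚₚ.*-identityʳ C)) (cong (C ℚ.*_) (sym (ℚₚ.*-inverseˡ ε)))))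
    (solve 4 (λ c i e h → (c :* (i :* e)) :* h := (c :* i) :* (e :* h)) refl C 1/ε ε (½ ^ b))

record ℚ[i] : Set where
  constructor _+_i
  field
    re im : ℚ

open ℚ[i]

infix  8 -ᵍ_
infixl 7 _*ᵍ_
infixl 6 _+ᵍ_ _-ᵍ_

-ᵍ_ : ℚ[i] → ℚ[i]
-ᵍ (a + b i) = (ℚ.- a) + (ℚ.- b) i

_+ᵍ_ _*ᵍ_ _-ᵍ_ : ℚ[i] → ℚ[i] → ℚ[i]
(a + b i) +ᵍ (c + d i) = (a ℚ.+ c) + (b ℚ.+ d) i
(a + b i) *ᵍ (c + d i) = (a ℚ.* c ℚ.- b ℚ.* d) + (a ℚ.* d ℚ.+ b ℚ.* c) i

z -ᵍ w = z +ᵍ (-ᵍ w)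

ι : ℚ → ℚ[i]
ι q = q + 0ℚ i

ℚ[i]-isCommutativeRing : IsCommutativeRing _≡_ _+ᵍ_ _*ᵍ_ -ᵍ_ (ι 0ℚ) (ι 1ℚ)
ℚ[i]-isCommutativeRing = record
  { isRing = record
    { +-isAbelianGroup = record
      { isGroup = record
        { isMonoid = record
          { isSemigroup = record
            { isMagma = record { isEquivalence = isEquivalence ; ∙-cong = cong₂ _+ᵍ_ }
            ; assoc = λ x y z → cong₂ _+_i (ℚₚ.+-assoc (re x) (re y) (re z)) (ℚₚ.+-assoc (im x) (im y) (im z))
            }
          ; identity = (λ x → cong₂ _+_i (ℚₚ.+-identityˡ (re x)) (ℚₚ.+-identityˡ (im x)))
                     , (λ x → cong₂ _+_i (ℚₚ.+-identityʳ (re x)) (ℚₚ.+-identityʳ (im x)))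
          }
        ; inverse = (λ x → cong₂ _+_i (ℚₚ.+-inverseˡ (re x)) (ℚₚ.+-inverseˡ (im x)))
                  , (λ x → cong₂ _+_i (ℚₚ.+-inverseʳ (re x)) (ℚₚ.+-inverseʳ (im x)))
        ; ⁻¹-cong = cong (λ z → -ᵍ z)
        }
      ; comm = λ x y → cong₂ _+_i (ℚₚ.+-comm (re x) (re y)) (ℚₚ.+-comm (im x) (im y))
      }
    ; *-cong = cong₂ _*ᵍ_
    ; *-assoc = λ { (a + b i) (c + d i) (e + f i) → cong₂ _+_i
        (solve 6 (λ a b c d e f → (a :* c :- b :* d) :* e :- (a :* d :+ b :* c) :* f := a :* (c :* e :- d :* f) :- b :* (c :* f :+ d :* e)) refl a b c d e f)
        (solve 6 (λ a b c d e f → (a :* c :- b :* d) :* f :+ (a :* d :+ b :* c) :* e := a :* (c :* f :+ d :* e) :+ b :* (c :* e :- d :* f)) refl a b c d e f) }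
    ; *-identity = (λ { (a + b i) → cong₂ _+_i
        (solve 2 (λ a b → con 1ℚ :* a :- con 0ℚ :* b := a) refl a b)
        (solve 2 (λ a b → con 1ℚ :* b :+ con 0ℚ :* a := b) refl a b) })
      , (λ { (a + b i) → cong₂ _+_i
        (solve 2 (λ a b → a :* con 1ℚ :- b :* con 0ℚ := a) refl a b)
        (solve 2 (λ a b → a :* con 0ℚ :+ b :* con 1ℚ := b) refl a b) })
    ; distrib = (λ { (a + b i) (c + d i) (e + f i) → cong₂ _+_i
        (solve 6 (λ a b c d e f → a :* (c :+ e) :- b :* (d :+ f) := (a :* c :- b :* d) :+ (a :* e :- b :* f)) refl a b c d e f)
        (solve 6 (λ a b c d e f → a :* (d :+ f) :+ b :* (c :+ e) := (a :* d :+ b :* c) :+ (a :* f :+ b :* e)) refl a b c d e f) })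
      , (λ { (a + b i) (c + d i) (e + f i) → cong₂ _+_i
        (solve 6 (λ a b c d e f → (c :+ e) :* a :- (d :+ f) :* b := (c :* a :- d :* b) :+ (e :* a :- f :* b)) refl a b c d e f)
        (solve 6 (λ a b c d e f → (c :+ e) :* b :+ (d :+ f) :* a := (c :* b :+ d :* a) :+ (e :* b :+ f :* a)) refl a b c d e f) })
    }
  ; *-comm = λ { (a + b i) (c + d i) → cong₂ _+_i
      (solve 4 (λ a b c d → a :* c :- b :* d := c :* a :- d :* b) refl a b c d)
      (solve 4 (λ a b c d → a :* d :+ b :* c := c :* b :+ d :* a) refl a b c d) }
  }
  where open +-*-Solver

ℚ[i]-commutativeRing : CommutativeRing 0ℓ 0ℓ
ℚ[i]-commutativeRing = record { isCommutativeRing = ℚ[i]-isCommutativeRing }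

_≟ᵍ_ : (z w : ℚ[i]) → Dec (z ≡ w)
(a + b i) ≟ᵍ (c + d i) with a ℚₚ.≟ c | b ℚₚ.≟ d
... | yes refl | yes refl = yes refl
... | no a≢c   | _        = no (a≢c ∘ cong re)
... | _        | no b≢d   = no (b≢d ∘ cong im)

private
  module 𝔾 = CommutativeRing ℚ[i]-commutativeRing
  module Solver = RingSolver (ACR.fromCommutativeRing ℚ[i]-commutativeRing) _≟ᵍ_
open Exp 𝔾.semiring using () renaming (_^_ to _^ᵍ_)

-- The ℓ¹ norm; it is equivalent to the modulus and takes rational values.

∥_∥ : ℚ[i] → ℚ
∥ a + b i ∥ = ∣ a ∣ ℚ.+ ∣ b ∣

0≤∥_∥ : ∀ z → 0ℚ ℚ.≤ ∥ z ∥
0≤∥ a + b i ∥ = 0≤+ (0≤∣ a ∣) (0≤∣ b ∣)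

∥-_∥ : ∀ z → ∥ -ᵍ z ∥ ≡ ∥ z ∥
∥- a + b i ∥ = cong₂ ℚ._+_ (ℚₚ.∣-p∣≡∣p∣ a) (ℚₚ.∣-p∣≡∣p∣ b)

∥+∥ : ∀ z w → ∥ z +ᵍ w ∥ ℚ.≤ ∥ z ∥ ℚ.+ ∥ w ∥
∥+∥ (a + b i) (c + d i) = ℚₚ.≤-trans
  (ℚₚ.+-mono-≤ (ℚₚ.∣p+q∣≤∣p∣+∣q∣ a c) (ℚₚ.∣p+q∣≤∣p∣+∣q∣ b d))
  (ℚₚ.≤-reflexive (solve 4 (λ a b c d → (a :+ c) :+ (b :+ d) := (a :+ b) :+ (c :+ d)) refl (∣ a ∣) (∣ b ∣) (∣ c ∣) (∣ d ∣)))
  where open +-*-Solver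

∥*∥ : ∀ z w → ∥ z *ᵍ w ∥ ℚ.≤ ∥ z ∥ ℚ.* ∥ w ∥
∥*∥ (a + b i) (c + d i) = begin
  ∣ a ℚ.* c ℚ.- b ℚ.* d ∣ ℚ.+ ∣ a ℚ.* d ℚ.+ b ℚ.* c ∣
    ≤⟨ ℚₚ.+-mono-≤ (ℚₚ.∣p-q∣≤∣p∣+∣q∣ (a ℚ.* c) (b ℚ.* d)) (ℚₚ.∣p+q∣≤∣p∣+∣q∣ (a ℚ.* d) (b ℚ.* c)) ⟩
  (∣ a ℚ.* c ∣ ℚ.+ ∣ b ℚ.* d ∣) ℚ.+ (∣ a ℚ.* d ∣ ℚ.+ ∣ b ℚ.* c ∣)
    ≡⟨ cong₂ ℚ._+_ (cong₂ ℚ._+_ (ℚₚ.∣p*q∣≡∣p∣*∣q∣ a c) (ℚₚ.∣p*q∣≡∣p∣*∣q∣ b d)) (cong₂ ℚ._+_ (ℚₚ.∣p*q∣≡∣p∣*∣q∣ a d) (ℚₚ.∣p*q∣≡∣p∣*∣q∣ b c)) ⟩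
  (∣ a ∣ ℚ.* ∣ c ∣ ℚ.+ ∣ b ∣ ℚ.* ∣ d ∣) ℚ.+ (∣ a ∣ ℚ.* ∣ d ∣ ℚ.+ ∣ b ∣ ℚ.* ∣ c ∣)
    ≡⟨ solve 4 (λ a b c d → (a :* c :+ b :* d) :+ (a :* d :+ b :* c) := (a :+ b) :* (c :+ d)) refl (∣ a ∣) (∣ b ∣) (∣ c ∣) (∣ d ∣) ⟩
  (∣ a ∣ ℚ.+ ∣ b ∣) ℚ.* (∣ c ∣ ℚ.+ ∣ d ∣) ∎
  where
  open ℚₚ.≤-Reasoning
  open +-*-Solver

∥-∥ : ∀ z w → ∥ z -ᵍ w ∥ ℚ.≤ ∥ z ∥ ℚ.+ ∥ w ∥
∥-∥ z w = subst (λ t → ∥ z -ᵍ w ∥ ℚ.≤ ∥ z ∥ ℚ.+ t) (∥- w ∥) (∥+∥ z (-ᵍ w))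

∥z-w∥≡∥w-z∥ : ∀ z w → ∥ z -ᵍ w ∥ ≡ ∥ w -ᵍ z ∥
∥z-w∥≡∥w-z∥ z w = trans (cong ∥_∥ (solve 2 (λ z w → z :- w := :- (w :- z)) refl z w)) ∥- w -ᵍ z ∥
  where open Solver

∥-∥-triangle : ∀ u v w → ∥ u -ᵍ w ∥ ℚ.≤ ∥ u -ᵍ v ∥ ℚ.+ ∥ v -ᵍ w ∥
∥-∥-triangle u v w = subst (ℚ._≤ ∥ u -ᵍ v ∥ ℚ.+ ∥ v -ᵍ w ∥)
  (cong ∥_∥ (solve 3 (λ u v w → (u :- v) :+ (v :- w) := u :- w) refl u v w))
  (∥+∥ (u -ᵍ v) (v -ᵍ w))
  where open Solver

∥ι∥ : ∀ {q} → 0ℚ ℚ.≤ q → ∥ ι q ∥ ≡ q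
∥ι∥ {q} 0≤q = trans (ℚₚ.+-identityʳ ∣ q ∣) (ℚₚ.0≤p⇒∣p∣≡p 0≤q)

-- The inverse in ℚ[i], totalised by 0⁻¹ = 0

recip : ℚ → ℚ
recip q with q ℚₚ.≟ 0ℚ
... | yes _  = 0ℚ
... | no q≢0 = (ℚ.1/ q) {{ℚ.≢-nonZero q≢0}}

recip-inverse : ∀ q → q ≢ 0ℚ → q ℚ.* recip q ≡ 1ℚ
recip-inverse q q≢0 with q ℚₚ.≟ 0ℚ
... | yes q≡0 = contradiction q≡0 q≢0
... | no _    = ℚₚ.*-inverseʳ q {{ℚ.≢-nonZero q≢0}}

_⁻¹ᵍ : ℚ[i] → ℚ[i]
(a + b i) ⁻¹ᵍ = (a ℚ.* r) + (ℚ.- (b ℚ.* r)) i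
  where r = recip (a ℚ.* a ℚ.+ b ℚ.* b)

∥z∥²≤2∣z∣² : ∀ a b → ∥ a + b i ∥ ℚ.* ∥ a + b i ∥ ℚ.≤ (a ℚ.* a ℚ.+ b ℚ.* b) ℚ.+ (a ℚ.* a ℚ.+ b ℚ.* b)
∥z∥²≤2∣z∣² a b = begin
  (x ℚ.+ y) ℚ.* (x ℚ.+ y)
    ≡⟨ ℚₚ.+-identityʳ _ ⟨
  (x ℚ.+ y) ℚ.* (x ℚ.+ y) ℚ.+ 0ℚ
    ≤⟨ ℚₚ.+-monoʳ-≤ ((x ℚ.+ y) ℚ.* (x ℚ.+ y)) (0≤p² (x ℚ.- y)) ⟩
  (x ℚ.+ y) ℚ.* (x ℚ.+ y) ℚ.+ (x ℚ.- y) ℚ.* (x ℚ.- y)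
    ≡⟨ solve 2 (λ x y → (x :+ y) :* (x :+ y) :+ (x :- y) :* (x :- y) := (x :* x :+ y :* y) :+ (x :* x :+ y :* y)) refl x y ⟩
  (x ℚ.* x ℚ.+ y ℚ.* y) ℚ.+ (x ℚ.* x ℚ.+ y ℚ.* y)
    ≡⟨ cong (λ t → t ℚ.+ t) (cong₂ ℚ._+_ (∣p∣² a) (∣p∣² b)) ⟩
  (a ℚ.* a ℚ.+ b ℚ.* b) ℚ.+ (a ℚ.* a ℚ.+ b ℚ.* b) ∎
  where
  open ℚₚ.≤-Reasoning
  open +-*-Solver
  x = ∣ a ∣
  y = ∣ b ∣
  ∣p∣² : ∀ p → ∣ p ∣ ℚ.* ∣ p ∣ ≡ p ℚ.* p
  ∣p∣² p with ℚₚ.∣p∣≡p∨∣p∣≡-p p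
  ... | inj₁ eq = cong₂ ℚ._*_ eq eq
  ... | inj₂ eq = trans (cong₂ ℚ._*_ eq eq) (solve 1 (λ p → (:- p) :* (:- p) := p :* p) refl p)
  0≤p² : ∀ p → 0ℚ ℚ.≤ p ℚ.* p
  0≤p² p = subst (0ℚ ℚ.≤_) (∣p∣² p) (0≤* (0≤∣ p ∣) (0≤∣ p ∣))

module _ {δ : ℚ} (0<δ : 0ℚ ℚ.< δ) where

  open ℚₚ.≤-Reasoning

  private
    N≢0 : ∀ a b → δ ℚ.≤ ∥ a + b i ∥ → a ℚ.* a ℚ.+ b ℚ.* b ≢ 0ℚ
    N≢0 a b δ≤z N≡0 = ℚₚ.<-irrefl refl (begin-strict
      0ℚ                              <⟨ 0<* 0<δ 0<δ ⟩
      δ ℚ.* δ                         ≤⟨ *-mono-≤ (0≤∥ a + b i ∥) (ℚₚ.<⇒≤ 0<δ) δ≤z δ≤z ⟩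
      ∥ a + b i ∥ ℚ.* ∥ a + b i ∥     ≤⟨ ∥z∥²≤2∣z∣² a b ⟩
      (a ℚ.* a ℚ.+ b ℚ.* b) ℚ.+ (a ℚ.* a ℚ.+ b ℚ.* b) ≡⟨ cong (λ t → t ℚ.+ t) N≡0 ⟩
      0ℚ                              ∎)

  *ᵍ-inverseʳ : ∀ z → δ ℚ.≤ ∥ z ∥ → z *ᵍ (z ⁻¹ᵍ) ≡ ι 1ℚ
  *ᵍ-inverseʳ (a + b i) δ≤z = cong₂ _+_i
    (trans (solve 3 (λ a b r → a :* (a :* r) :- b :* (:- (b :* r)) := (a :* a :+ b :* b) :* r) refl a b r)
           (recip-inverse (a ℚ.* a ℚ.+ b ℚ.* b) (N≢0 a b δ≤z)))
    (solve 3 (λ a b r → a :* (:- (b :* r)) :+ b :* (a :* r) := con 0ℚ) refl a b r)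
    where
    open +-*-Solver
    r = recip (a ℚ.* a ℚ.+ b ℚ.* b)

  δ∥z⁻¹∥≤2 : ∀ z → δ ℚ.≤ ∥ z ∥ → δ ℚ.* ∥ z ⁻¹ᵍ ∥ ℚ.≤ 1ℚ ℚ.+ 1ℚ
  δ∥z⁻¹∥≤2 z@(a + b i) δ≤z = begin
    δ ℚ.* (∣ a ℚ.* r ∣ ℚ.+ ∣ ℚ.- (b ℚ.* r) ∣)
      ≡⟨ cong (δ ℚ.*_) (cong₂ ℚ._+_ (abs a) (trans (ℚₚ.∣-p∣≡∣p∣ (b ℚ.* r)) (abs b))) ⟩
    δ ℚ.* (∣ a ∣ ℚ.* r ℚ.+ ∣ b ∣ ℚ.* r)
      ≡⟨ solve 4 (λ d x y r → d :* (x :* r :+ y :* r) := d :* ((x :+ y) :* r)) refl δ (∣ a ∣) (∣ b ∣) r ⟩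
    δ ℚ.* (∥ z ∥ ℚ.* r)
      ≤⟨ ℚₚ.*-monoʳ-≤-nonNeg (∥ z ∥ ℚ.* r) {{ℚ.nonNegative (0≤* (0≤∥ z ∥) 0≤r)}} δ≤z ⟩
    ∥ z ∥ ℚ.* (∥ z ∥ ℚ.* r)
      ≡⟨ ℚₚ.*-assoc (∥ z ∥) (∥ z ∥) r ⟨
    (∥ z ∥ ℚ.* ∥ z ∥) ℚ.* r
      ≤⟨ ℚₚ.*-monoʳ-≤-nonNeg r {{ℚ.nonNegative 0≤r}} (∥z∥²≤2∣z∣² a b) ⟩
    (N ℚ.+ N) ℚ.* r
      ≡⟨ ℚₚ.*-distribʳ-+ r N N ⟩
    N ℚ.* r ℚ.+ N ℚ.* r
      ≡⟨ cong (λ t → t ℚ.+ t) Nr≡1 ⟩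
    1ℚ ℚ.+ 1ℚ ∎
    where
    open +-*-Solver
    N = a ℚ.* a ℚ.+ b ℚ.* b
    r = recip N
    Nr≡1 : N ℚ.* r ≡ 1ℚ
    Nr≡1 = recip-inverse N (N≢0 a b δ≤z)
    0≤N+N : 0ℚ ℚ.≤ N ℚ.+ N
    0≤N+N = ℚₚ.≤-trans (0≤* (0≤∥ z ∥) (0≤∥ z ∥)) (∥z∥²≤2∣z∣² a b)
    0≤r : 0ℚ ℚ.≤ r
    0≤r with ℚₚ.≤-total 0ℚ r
    ... | inj₁ 0≤r = 0≤r
    ... | inj₂ r≤0 = contradiction (ℚₚ.<-≤-trans 0<2 (ℚₚ.≤-trans 2≤0 ℚₚ.≤-refl)) (ℚₚ.<-irrefl refl)
      where
      0<2 : 0ℚ ℚ.< 1ℚ ℚ.+ 1ℚ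
      0<2 = ℚₚ.positive⁻¹ (1ℚ ℚ.+ 1ℚ)
      2≤0 : 1ℚ ℚ.+ 1ℚ ℚ.≤ 0ℚ
      2≤0 = begin
        1ℚ ℚ.+ 1ℚ            ≡⟨ cong (λ t → t ℚ.+ t) Nr≡1 ⟨
        N ℚ.* r ℚ.+ N ℚ.* r  ≡⟨ ℚₚ.*-distribʳ-+ r N N ⟨
        (N ℚ.+ N) ℚ.* r      ≤⟨ ℚₚ.*-monoˡ-≤-nonNeg (N ℚ.+ N) {{ℚ.nonNegative 0≤N+N}} r≤0 ⟩
        (N ℚ.+ N) ℚ.* 0ℚ     ≡⟨ ℚₚ.*-zeroʳ (N ℚ.+ N) ⟩
        0ℚ                   ∎
    abs : ∀ p → ∣ p ℚ.* r ∣ ≡ ∣ p ∣ ℚ.* r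
    abs p = trans (ℚₚ.∣p*q∣≡∣p∣*∣q∣ p r) (cong (∣ p ∣ ℚ.*_) (ℚₚ.0≤p⇒∣p∣≡p 0≤r))

private
  infixl 1 _>>=_
  _>>=_ : {A B : Set} → ¬ ¬ A → (A → ¬ ¬ B) → ¬ ¬ B
  (m >>= f) k = m λ a → f a k

  return : {A : Set} → A → ¬ ¬ A
  return a k = k a

-- Complex numbers: Cauchy sequences of Gaussian rationals modulo null
-- sequences. The existential "from some index on" is read classically
-- (¬¬∃), so that, as over the classical ℂ, every z with ¬ (z ≈ 0) has an
-- inverse; no apartness relation is needed.

record IsCauchy (z : ℕ → ℚ[i]) : Set where
  constructor mkCauchy
  field
    close : ∀ ε → 0ℚ ℚ.< ε →
      ¬ ¬ ∃ λ N → ∀ m n → N ≤ m → N ≤ n → ∥ z m -ᵍ z n ∥ ℚ.≤ ε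

record IsNull (z : ℕ → ℚ[i]) : Set where
  constructor mkNull
  field
    small : ∀ ε → 0ℚ ℚ.< ε → ¬ ¬ ∃ λ N → ∀ n → N ≤ n → ∥ z n ∥ ℚ.≤ ε

open IsCauchy
open IsNull

record ℂ : Set where
  constructor mkℂ
  field
    seq    : ℕ → ℚ[i]
    cauchy : IsCauchy seq

open ℂ

infix 4 _≈_ _≉_

record _≈_ (z w : ℂ) : Set where
  constructor mk≈
  field
    null : IsNull (λ n → seq z n -ᵍ seq w n)

open _≈_

_≉_ : ℂ → ℂ → Set
z ≉ w = ¬ (z ≈ w)

private
  2ℚ : ℚ
  2ℚ = 1ℚ ℚ.+ 1ℚ

  0<2 : 0ℚ ℚ.< 2ℚ
  0<2 = ℚₚ.positive⁻¹ 2ℚ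

  ε+ε : ∀ ε → ε ℚ.+ ε ≡ 2ℚ ℚ.* ε
  ε+ε ε = solve 1 (λ e → e :+ e := (con 1ℚ :+ con 1ℚ) :* e) refl ε
    where open +-*-Solver

  0<1 : 0ℚ ℚ.< 1ℚ
  0<1 = ℚₚ.positive⁻¹ 1ℚ

  ⊔ˡ : ∀ {M N n} → M ⊔ N ≤ n → M ≤ n
  ⊔ˡ {M} {N} = ℕₚ.≤-trans (ℕₚ.m≤m⊔n M N)

  ⊔ʳ : ∀ {M N n} → M ⊔ N ≤ n → N ≤ n
  ⊔ʳ {M} {N} = ℕₚ.≤-trans (ℕₚ.m≤n⊔m M N)

  ≤-resp : ∀ {p q r s} → p ≡ q → r ≡ s → q ℚ.≤ s → p ℚ.≤ r
  ≤-resp refl refl q≤s = q≤s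

  cong-∥∥ : ∀ {z w} → z ≡ w → ∥ w ∥ ℚ.≤ ∥ z ∥
  cong-∥∥ refl = ℚₚ.≤-refl

bounded : ∀ {z} → IsCauchy z → ¬ ¬ ∃ λ b → 1 ≤ b × ∃ λ N → ∀ n → N ≤ n → ∥ z n ∥ ℚ.≤ fromℕ b
bounded {z} cz = do
  N , h ← close cz 1ℚ 0<1
  let b , 1≤b , p≤b = ≤fromℕ (1ℚ ℚ.+ ∥ z N ∥)
  return (b , 1≤b , N , λ n N≤n → ℚₚ.≤-trans
    (subst (λ t → ∥ t ∥ ℚ.≤ ∥ z n -ᵍ z N ∥ ℚ.+ ∥ z N ∥)
      (solve 2 (λ x y → (x :- y) :+ y := x) refl (z n) (z N)) (∥+∥ (z n -ᵍ z N) (z N)))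
    (ℚₚ.≤-trans (ℚₚ.+-monoˡ-≤ ∥ z N ∥ (h n N N≤n ℕₚ.≤-refl)) p≤b))
  where open Solver

0<b : ∀ {b} → 1 ≤ b → 0ℚ ℚ.< fromℕ b
0<b 1≤b = ℚₚ.<-≤-trans 0<1 (fromℕ-mono-≤ 1≤b)

null-+ : ∀ {z w} → IsNull z → IsNull w → IsNull (λ n → z n +ᵍ w n)
null-+ {z} {w} nz nw = mkNull (rescale E 2ℚ 0<2 λ ε 0<ε → do
  M , f ← small nz ε 0<ε
  N , g ← small nw ε 0<ε
  return (M ⊔ N , λ n ≤n → ℚₚ.≤-trans (∥+∥ (z n) (w n))
    (ℚₚ.≤-trans (ℚₚ.+-mono-≤ (f n (⊔ˡ {M} {N} ≤n)) (g n (⊔ʳ {M} {N} ≤n))) (ℚₚ.≤-reflexive (ε+ε ε)))))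
  where
  E : ℚ → Set
  E ε = ¬ ¬ ∃ λ N → ∀ n → N ≤ n → ∥ z n +ᵍ w n ∥ ℚ.≤ ε

null-neg : ∀ {z} → IsNull z → IsNull (λ n → -ᵍ z n)
null-neg {z} nz = mkNull λ ε 0<ε → do
  N , f ← small nz ε 0<ε
  return (N , λ n N≤n → subst (ℚ._≤ ε) (sym ∥- z n ∥) (f n N≤n))

null-* : ∀ {z w} → IsNull z → IsCauchy w → IsNull (λ n → z n *ᵍ w n)
null-* {z} {w} nz cw = mkNull λ ε 0<ε → do
  b , 1≤b , M , f ← bounded cw
  rescale (λ ε → ¬ ¬ ∃ λ N → ∀ n → N ≤ n → ∥ z n *ᵍ w n ∥ ℚ.≤ ε) (fromℕ b) (0<b 1≤b)
    (λ ε 0<ε → do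
      N , g ← small nz ε 0<ε
      return (M ⊔ N , λ n ≤n → ℚₚ.≤-trans (∥*∥ (z n) (w n)) (ℚₚ.≤-trans
        (*-mono-≤ (ℚₚ.<⇒≤ 0<ε) (0≤∥ w n ∥) (g n (⊔ʳ {M} {N} ≤n)) (f n (⊔ˡ {M} {N} ≤n)))
        (ℚₚ.≤-reflexive (ℚₚ.*-comm ε (fromℕ b))))))
    ε 0<ε

null-resp : ∀ {z w} → (∀ n → z n ≡ w n) → IsNull z → IsNull w
null-resp eq nz = mkNull λ ε 0<ε → do
  N , f ← small nz ε 0<ε
  return (N , λ n N≤n → subst (λ t → ∥ t ∥ ℚ.≤ ε) (eq n) (f n N≤n))

null-0 : IsNull (λ _ → ι 0ℚ)
null-0 = mkNull λ ε 0<ε → return (0 , λ _ _ → ℚₚ.<⇒≤ 0<ε)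

cauchy-const : ∀ z → IsCauchy (λ _ → z)
cauchy-const z = mkCauchy λ ε 0<ε → return (0 , λ _ _ _ _ →
  subst (λ t → ∥ t ∥ ℚ.≤ ε) (sym (𝔾.-‿inverseʳ z)) (ℚₚ.<⇒≤ 0<ε))

cauchy-+ : ∀ {z w} → IsCauchy z → IsCauchy w → IsCauchy (λ n → z n +ᵍ w n)
cauchy-+ {z} {w} cz cw = mkCauchy (rescale E 2ℚ 0<2 λ ε 0<ε → do
  M , f ← close cz ε 0<ε
  N , g ← close cw ε 0<ε
  return (M ⊔ N , λ m n ≤m ≤n → ℚₚ.≤-trans
    (cong-∥∥ (solve 4 (λ a b c d → (a :- b) :+ (c :- d) := (a :+ c) :- (b :+ d)) refl (z m) (z n) (w m) (w n)))
    (ℚₚ.≤-trans (∥+∥ (z m -ᵍ z n) (w m -ᵍ w n))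
    (ℚₚ.≤-trans (ℚₚ.+-mono-≤ (f m n (⊔ˡ {M} {N} ≤m) (⊔ˡ {M} {N} ≤n)) (g m n (⊔ʳ {M} {N} ≤m) (⊔ʳ {M} {N} ≤n)))
      (ℚₚ.≤-reflexive (ε+ε ε))))))
  where
  open Solver
  E : ℚ → Set
  E ε = ¬ ¬ ∃ λ N → ∀ m n → N ≤ m → N ≤ n → ∥ (z m +ᵍ w m) -ᵍ (z n +ᵍ w n) ∥ ℚ.≤ ε

cauchy-neg : ∀ {z} → IsCauchy z → IsCauchy (λ n → -ᵍ z n)
cauchy-neg {z} cz = mkCauchy λ ε 0<ε → do
  N , f ← close cz ε 0<ε
  return (N , λ m n ≤m ≤n → ℚₚ.≤-trans
    (cong-∥∥ (solve 2 (λ x y → y :- x := (:- x) :- (:- y)) refl (z m) (z n))) (f n m ≤n ≤m))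
  where open Solver

cauchy-* : ∀ {z w} → IsCauchy z → IsCauchy w → IsCauchy (λ n → z n *ᵍ w n)
cauchy-* {z} {w} cz cw = mkCauchy λ ε 0<ε → do
  b , 1≤b , K , f ← bounded cz
  c , _   , L , g ← bounded cw
  rescale E (fromℕ b ℚ.+ fromℕ c)
    (ℚₚ.<-≤-trans (0<b 1≤b) (ℚₚ.≤-trans (ℚₚ.≤-reflexive (sym (ℚₚ.+-identityʳ (fromℕ b)))) (ℚₚ.+-monoʳ-≤ (fromℕ b) (0≤fromℕ c))))
    (λ ε 0<ε → do
      M , h ← close cz ε 0<ε
      N , k ← close cw ε 0<ε
      return ((K ⊔ L) ⊔ (M ⊔ N) , λ m n ≤m ≤n → begin
        ∥ (z m *ᵍ w m) -ᵍ (z n *ᵍ w n) ∥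
          ≡⟨ cong ∥_∥ (solve 4 (λ a b c d → (a :* c) :- (b :* d) := a :* (c :- d) :+ (a :- b) :* d) refl (z m) (z n) (w m) (w n)) ⟩
        ∥ (z m *ᵍ (w m -ᵍ w n)) +ᵍ ((z m -ᵍ z n) *ᵍ w n) ∥
          ≤⟨ ∥+∥ (z m *ᵍ (w m -ᵍ w n)) ((z m -ᵍ z n) *ᵍ w n) ⟩
        ∥ z m *ᵍ (w m -ᵍ w n) ∥ ℚ.+ ∥ (z m -ᵍ z n) *ᵍ w n ∥
          ≤⟨ ℚₚ.+-mono-≤ (∥*∥ (z m) (w m -ᵍ w n)) (∥*∥ (z m -ᵍ z n) (w n)) ⟩
        ∥ z m ∥ ℚ.* ∥ w m -ᵍ w n ∥ ℚ.+ ∥ z m -ᵍ z n ∥ ℚ.* ∥ w n ∥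
          ≤⟨ ℚₚ.+-mono-≤
               (*-mono-≤ (0≤fromℕ b) (0≤∥ w m -ᵍ w n ∥) (f m (⊔ˡ {K} {L} (⊔ˡ {K ⊔ L} {M ⊔ N} ≤m)))
                  (k m n (⊔ʳ {M} {N} (⊔ʳ {K ⊔ L} {M ⊔ N} ≤m)) (⊔ʳ {M} {N} (⊔ʳ {K ⊔ L} {M ⊔ N} ≤n))))
               (*-mono-≤ (ℚₚ.<⇒≤ 0<ε) (0≤∥ w n ∥)
                  (h m n (⊔ˡ {M} {N} (⊔ʳ {K ⊔ L} {M ⊔ N} ≤m)) (⊔ˡ {M} {N} (⊔ʳ {K ⊔ L} {M ⊔ N} ≤n)))
                  (g n (⊔ʳ {K} {L} (⊔ˡ {K ⊔ L} {M ⊔ N} ≤n)))) ⟩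
        fromℕ b ℚ.* ε ℚ.+ ε ℚ.* fromℕ c
          ≡⟨ ℚSolver.solve 3 (λ b c e → b ℚSolver.:* e ℚSolver.:+ e ℚSolver.:* c ℚSolver.:= (b ℚSolver.:+ c) ℚSolver.:* e) refl (fromℕ b) (fromℕ c) ε ⟩
        (fromℕ b ℚ.+ fromℕ c) ℚ.* ε ∎))
    ε 0<ε
  where
  open Solver
  open ℚₚ.≤-Reasoning
  module ℚSolver = +-*-Solver
  E : ℚ → Set
  E ε = ¬ ¬ ∃ λ N → ∀ m n → N ≤ m → N ≤ n → ∥ (z m *ᵍ w m) -ᵍ (z n *ᵍ w n) ∥ ℚ.≤ ε

infix  8 -ᶜ_
infixl 7 _*ᶜ_
infixl 6 _+ᶜ_

_+ᶜ_ : ℂ → ℂ → ℂ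
z +ᶜ w = mkℂ (λ n → seq z n +ᵍ seq w n) (cauchy-+ (cauchy z) (cauchy w))

_*ᶜ_ : ℂ → ℂ → ℂ
z *ᶜ w = mkℂ (λ n → seq z n *ᵍ seq w n) (cauchy-* (cauchy z) (cauchy w))

-ᶜ_ : ℂ → ℂ
-ᶜ z = mkℂ (λ n → -ᵍ seq z n) (cauchy-neg (cauchy z))

fromℚ : ℚ → ℂ
fromℚ q = mkℂ (λ _ → ι q) (cauchy-const (ι q))

0ℂ 1ℂ : ℂ
0ℂ = fromℚ 0ℚ
1ℂ = fromℚ 1ℚ

pointwise : ∀ {z w} → (∀ n → seq z n ≡ seq w n) → z ≈ w
pointwise {z} {w} eq = mk≈ (null-resp
  (λ n → trans (sym (𝔾.-‿inverseʳ (seq w n))) (cong (_-ᵍ seq w n) (sym (eq n)))) null-0)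

ℂ-isCommutativeRing : IsCommutativeRing _≈_ _+ᶜ_ _*ᶜ_ -ᶜ_ 0ℂ 1ℂ
ℂ-isCommutativeRing = record
  { isRing = record
    { +-isAbelianGroup = record
      { isGroup = record
        { isMonoid = record
          { isSemigroup = record
            { isMagma = record
              { isEquivalence = record
                { refl  = pointwise (λ _ → refl)
                ; sym   = λ {z} {w} z≈w → mk≈ (null-resp
                    (λ n → solve 2 (λ x y → :- (x :- y) := y :- x) refl (seq z n) (seq w n))
                    (null-neg (null z≈w)))
                ; trans = λ {u} {v} {w} u≈v v≈w → mk≈ (null-resp
                    (λ n → solve 3 (λ x y z → (x :- y) :+ (y :- z) := x :- z) refl (seq u n) (seq v n) (seq w n))
                    (null-+ (null u≈v) (null v≈w)))
                }
              ; ∙-cong = λ {z} {z′} {w} {w′} z≈ w≈ → mk≈ (null-resp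
                  (λ n → solve 4 (λ a b c d → (a :- b) :+ (c :- d) := (a :+ c) :- (b :+ d)) refl
                    (seq z n) (seq z′ n) (seq w n) (seq w′ n))
                  (null-+ (null z≈) (null w≈)))
              }
            ; assoc = λ x y z → pointwise λ n → 𝔾.+-assoc (seq x n) (seq y n) (seq z n)
            }
          ; identity = (λ x → pointwise λ n → 𝔾.+-identityˡ (seq x n))
                     , (λ x → pointwise λ n → 𝔾.+-identityʳ (seq x n))
          }
        ; inverse = (λ x → pointwise λ n → 𝔾.-‿inverseˡ (seq x n))
                  , (λ x → pointwise λ n → 𝔾.-‿inverseʳ (seq x n))
        ; ⁻¹-cong = λ {z} {w} z≈w → mk≈ (null-resp
            (λ n → solve 2 (λ x y → :- (x :- y) := (:- x) :- (:- y)) refl (seq z n) (seq w n))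
            (null-neg (null z≈w)))
        }
      ; comm = λ x y → pointwise λ n → 𝔾.+-comm (seq x n) (seq y n)
      }
    ; *-cong = λ {z} {z′} {w} {w′} z≈ w≈ → mk≈ (null-resp
        (λ n → solve 4 (λ a b c d → (a :- b) :* c :+ (c :- d) :* b := (a :* c) :- (b :* d)) refl
          (seq z n) (seq z′ n) (seq w n) (seq w′ n))
        (null-+ (null-* (null z≈) (cauchy w)) (null-* (null w≈) (cauchy z′))))
    ; *-assoc = λ x y z → pointwise λ n → 𝔾.*-assoc (seq x n) (seq y n) (seq z n)
    ; *-identity = (λ x → pointwise λ n → 𝔾.*-identityˡ (seq x n))
                 , (λ x → pointwise λ n → 𝔾.*-identityʳ (seq x n))
    ; distrib = (λ x y z → pointwise λ n → 𝔾.distribˡ (seq x n) (seq y n) (seq z n))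
              , (λ x y z → pointwise λ n → 𝔾.distribʳ (seq x n) (seq y n) (seq z n))
    }
  ; *-comm = λ x y → pointwise λ n → 𝔾.*-comm (seq x n) (seq y n)
  }
  where open Solver

ℂ-commutativeRing : CommutativeRing 0ℓ 0ℓ
ℂ-commutativeRing = record { isCommutativeRing = ℂ-isCommutativeRing }

0ᶜ-apart : ∀ {z} → IsCauchy z → ¬ IsNull z →
  ¬ ¬ ∃ λ δ → 0ℚ ℚ.< δ × ∃ λ N → ∀ n → N ≤ n → δ ℚ.≤ ∥ z n ∥
0ᶜ-apart {z} cz z≉0 ¬apart = z≉0 (mkNull (rescale E 3ℚ 0<3 λ ε 0<ε → do
  N , f ← close cz ε 0<ε
  small? ε 0<ε N f (2ℚ ℚ.* ε ℚₚ.≤? ∥ z N ∥)))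
  where
  open ℚₚ.≤-Reasoning
  open Solver
  module ℚS = +-*-Solver
  3ℚ = 1ℚ ℚ.+ 2ℚ
  0<3 : 0ℚ ℚ.< 3ℚ
  0<3 = ℚₚ.positive⁻¹ 3ℚ
  E : ℚ → Set
  E ε = ¬ ¬ ∃ λ N → ∀ n → N ≤ n → ∥ z n ∥ ℚ.≤ ε
  tri : ∀ m n → ∥ z m ∥ ℚ.≤ ∥ z m -ᵍ z n ∥ ℚ.+ ∥ z n ∥
  tri m n = subst (λ t → ∥ t ∥ ℚ.≤ ∥ z m -ᵍ z n ∥ ℚ.+ ∥ z n ∥)
      (solve 2 (λ x y → (x :- y) :+ y := x) refl (z m) (z n)) (∥+∥ (z m -ᵍ z n) (z n))
  small? : ∀ ε → 0ℚ ℚ.< ε → ∀ N → (∀ m n → N ≤ m → N ≤ n → ∥ z m -ᵍ z n ∥ ℚ.≤ ε) →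
    Dec (2ℚ ℚ.* ε ℚ.≤ ∥ z N ∥) → E (3ℚ ℚ.* ε)
  small? ε 0<ε N f (yes big) _ = ¬apart (ε , 0<ε , N , λ n N≤n → begin
    ε
      ≡⟨ ℚS.solve 1 (λ e → e ℚS.:= ((ℚS.con 1ℚ ℚS.:+ ℚS.con 1ℚ) ℚS.:* e) ℚS.:+ (ℚS.:- e)) refl ε ⟩
    2ℚ ℚ.* ε ℚ.- ε
      ≤⟨ ℚₚ.+-monoˡ-≤ (ℚ.- ε) big ⟩
    ∥ z N ∥ ℚ.- ε
      ≤⟨ ℚₚ.+-monoˡ-≤ (ℚ.- ε) (tri N n) ⟩
    (∥ z N -ᵍ z n ∥ ℚ.+ ∥ z n ∥) ℚ.- ε
      ≤⟨ ℚₚ.+-monoˡ-≤ (ℚ.- ε) (ℚₚ.+-monoˡ-≤ ∥ z n ∥ (f N n ℕₚ.≤-refl N≤n)) ⟩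
    (ε ℚ.+ ∥ z n ∥) ℚ.- ε
      ≡⟨ ℚS.solve 2 (λ e x → (e ℚS.:+ x) ℚS.:+ (ℚS.:- e) ℚS.:= x) refl ε ∥ z n ∥ ⟩
    ∥ z n ∥ ∎)
  small? ε 0<ε N f (no ¬big) = return (N , λ n N≤n → begin
    ∥ z n ∥                       ≤⟨ tri n N ⟩
    ∥ z n -ᵍ z N ∥ ℚ.+ ∥ z N ∥    ≤⟨ ℚₚ.+-mono-≤ (f n N N≤n ℕₚ.≤-refl) (ℚₚ.<⇒≤ (ℚₚ.≰⇒> ¬big)) ⟩
    ε ℚ.+ 2ℚ ℚ.* ε                ≡⟨ ℚS.solve 1 (λ e → e ℚS.:+ (ℚS.con 1ℚ ℚS.:+ ℚS.con 1ℚ) ℚS.:* e ℚS.:= (ℚS.con 1ℚ ℚS.:+ (ℚS.con 1ℚ ℚS.:+ ℚS.con 1ℚ)) ℚS.:* e) refl ε ⟩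
    3ℚ ℚ.* ε                      ∎)

inverse-cauchy : ∀ {z} → IsCauchy z → ¬ IsNull z → IsCauchy (λ n → z n ⁻¹ᵍ)
inverse-cauchy {z} cz z≉0 = mkCauchy λ ε 0<ε → do
  δ , 0<δ , M , apart ← 0ᶜ-apart cz z≉0
  let instance nz = ℚₚ.pos⇒nonZero δ {{ℚ.positive 0<δ}}
      K = 2ℚ ℚ.* (ℚ.1/ δ)
      0<K : 0ℚ ℚ.< K
      0<K = 0<* 0<2 (ℚₚ.positive⁻¹ (ℚ.1/ δ) {{ℚₚ.1/pos⇒pos δ {{ℚ.positive 0<δ}}}})
      ∥z⁻¹∥≤K : ∀ n → M ≤ n → ∥ z n ⁻¹ᵍ ∥ ℚ.≤ K
      ∥z⁻¹∥≤K n M≤n = bound δ 0<δ (z n) (apart n M≤n)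
  rescale (λ ε → ¬ ¬ ∃ λ N → ∀ m n → N ≤ m → N ≤ n → ∥ (z m ⁻¹ᵍ) -ᵍ (z n ⁻¹ᵍ) ∥ ℚ.≤ ε)
    (K ℚ.* K) (0<* 0<K 0<K)
    (λ ε 0<ε → do
      N , f ← close cz ε 0<ε
      return (M ⊔ N , λ m n ≤m ≤n → begin
        ∥ (z m ⁻¹ᵍ) -ᵍ (z n ⁻¹ᵍ) ∥
          ≡⟨ cong ∥_∥ (difference (z m) (z n) (z m ⁻¹ᵍ) (z n ⁻¹ᵍ)
               (*ᵍ-inverseʳ 0<δ (z m) (apart m (⊔ˡ {M} {N} ≤m))) (*ᵍ-inverseʳ 0<δ (z n) (apart n (⊔ˡ {M} {N} ≤n)))) ⟩
        ∥ ((z m ⁻¹ᵍ) *ᵍ (z n ⁻¹ᵍ)) *ᵍ (z n -ᵍ z m) ∥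
          ≤⟨ ∥*∥ ((z m ⁻¹ᵍ) *ᵍ (z n ⁻¹ᵍ)) (z n -ᵍ z m) ⟩
        ∥ (z m ⁻¹ᵍ) *ᵍ (z n ⁻¹ᵍ) ∥ ℚ.* ∥ z n -ᵍ z m ∥
          ≤⟨ *-mono-≤ (ℚₚ.<⇒≤ (0<* 0<K 0<K)) (0≤∥ z n -ᵍ z m ∥)
               (ℚₚ.≤-trans (∥*∥ (z m ⁻¹ᵍ) (z n ⁻¹ᵍ))
                 (*-mono-≤ (ℚₚ.<⇒≤ 0<K) (0≤∥ z n ⁻¹ᵍ ∥) (∥z⁻¹∥≤K m (⊔ˡ {M} {N} ≤m)) (∥z⁻¹∥≤K n (⊔ˡ {M} {N} ≤n))))
               (f n m (⊔ʳ {M} {N} ≤n) (⊔ʳ {M} {N} ≤m)) ⟩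
        (K ℚ.* K) ℚ.* ε ∎))
    ε 0<ε
  where
  open ℚₚ.≤-Reasoning
  open Solver
  difference : ∀ z w u v → z *ᵍ u ≡ ι 1ℚ → w *ᵍ v ≡ ι 1ℚ → u -ᵍ v ≡ (u *ᵍ v) *ᵍ (w -ᵍ z)
  difference z w u v zu≡1 wv≡1 = trans
    (cong₂ _-ᵍ_ (trans (sym (𝔾.*-identityʳ u)) (cong (u *ᵍ_) (sym wv≡1))) (trans (sym (𝔾.*-identityʳ v)) (cong (v *ᵍ_) (sym zu≡1))))
    (solve 4 (λ z w u v → u :* (w :* v) :- v :* (z :* u) := (u :* v) :* (w :- z)) refl z w u v)
  bound : ∀ δ (0<δ : 0ℚ ℚ.< δ) w → δ ℚ.≤ ∥ w ∥ →
    ∥ w ⁻¹ᵍ ∥ ℚ.≤ 2ℚ ℚ.* (ℚ.1/ δ) {{ℚₚ.pos⇒nonZero δ {{ℚ.positive 0<δ}}}}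
  bound δ 0<δ w δ≤w = begin
    x                       ≡⟨ ℚₚ.*-identityˡ x ⟨
    1ℚ ℚ.* x                ≡⟨ cong (ℚ._* x) (ℚₚ.*-inverseˡ δ) ⟨
    (ℚ.1/ δ ℚ.* δ) ℚ.* x    ≡⟨ ℚₚ.*-assoc (ℚ.1/ δ) δ x ⟩
    ℚ.1/ δ ℚ.* (δ ℚ.* x)    ≤⟨ ℚₚ.*-monoˡ-≤-nonNeg (ℚ.1/ δ) (δ∥z⁻¹∥≤2 0<δ w δ≤w) ⟩
    ℚ.1/ δ ℚ.* 2ℚ           ≡⟨ ℚₚ.*-comm (ℚ.1/ δ) 2ℚ ⟩
    2ℚ ℚ.* ℚ.1/ δ           ∎
    where
    x = ∥ w ⁻¹ᵍ ∥
    instance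
      posδ = ℚ.positive 0<δ
      nzδ  = ℚₚ.pos⇒nonZero δ
      nn1/δ = ℚₚ.pos⇒nonNeg (ℚ.1/ δ) {{ℚₚ.1/pos⇒pos δ}}

≉0⇒¬null : ∀ {z} → z ≉ 0ℂ → ¬ IsNull (seq z)
≉0⇒¬null {z} z≉0 nz = z≉0 (mk≈ (null-resp (λ n → sym (solve 1 (λ x → x :- con (ι 0ℚ) := x) refl (seq z n))) nz))
  where open Solver

infix 9 _⁻¹[_]

_⁻¹[_] : (z : ℂ) → z ≉ 0ℂ → ℂ
z ⁻¹[ z≉0 ] = mkℂ (λ n → seq z n ⁻¹ᵍ) (inverse-cauchy (cauchy z) (≉0⇒¬null z≉0))

*-inverseʳ : ∀ z (z≉0 : z ≉ 0ℂ) → z *ᶜ z ⁻¹[ z≉0 ] ≈ 1ℂ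
*-inverseʳ z z≉0 = mk≈ (mkNull λ ε 0<ε → do
  δ , 0<δ , N , apart ← 0ᶜ-apart (cauchy z) (≉0⇒¬null z≉0)
  return (N , λ n N≤n → subst (λ t → ∥ t ∥ ℚ.≤ ε)
    (sym (trans (cong (_-ᵍ ι 1ℚ) (*ᵍ-inverseʳ 0<δ (seq z n) (apart n N≤n))) (𝔾.-‿inverseʳ (ι 1ℚ))))
    (ℚₚ.<⇒≤ 0<ε)))

open Sums ℚ[i]-commutativeRing using () renaming (∑≤ to ∑≤ᵍ; ∑≤-last to ∑≤ᵍ-last)

module _ (f : ℕ → ℚ[i]) (C : ℚ) (f≤ : ∀ j → ∥ f j ∥ ℚ.≤ C ℚ.* ½ ^ j) where
  open ℚₚ.≤-Reasoning

  private
    S : ℕ → ℚ[i]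
    S n = ∑≤ᵍ n f

    add-tail : ∀ x y n → x ℚ.≤ y ℚ.+ C ℚ.* ½ ^ suc n → x ℚ.+ C ℚ.* ½ ^ suc n ℚ.≤ y ℚ.+ C ℚ.* ½ ^ n
    add-tail x y n x≤ = begin
      x ℚ.+ t           ≤⟨ ℚₚ.+-monoˡ-≤ t x≤ ⟩
      (y ℚ.+ t) ℚ.+ t   ≡⟨ solve 4 (λ y c h p → (y :+ c :* (h :* p)) :+ c :* (h :* p) := y :+ c :* (h :* p :+ h :* p)) refl y C ½ (½ ^ n) ⟩
      y ℚ.+ C ℚ.* (½ ℚ.* ½ ^ n ℚ.+ ½ ℚ.* ½ ^ n) ≡⟨ cong (λ u → y ℚ.+ C ℚ.* u) (½+½ (½ ^ n)) ⟩
      y ℚ.+ C ℚ.* ½ ^ n ∎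
      where
      open +-*-Solver
      t = C ℚ.* ½ ^ suc n

    0≤C : 0ℚ ℚ.≤ C
    0≤C = ℚₚ.≤-trans (0≤∥ f 0 ∥) (ℚₚ.≤-trans (f≤ 0) (ℚₚ.≤-reflexive (ℚₚ.*-identityʳ C)))

    0≤C½^ : ∀ n → 0ℚ ℚ.≤ C ℚ.* ½ ^ n
    0≤C½^ n = 0≤* 0≤C (0≤^ 0≤½ n)

    drop-tail : ∀ x y n → x ℚ.+ C ℚ.* ½ ^ n ℚ.≤ y → x ℚ.≤ y
    drop-tail x y n x+t≤y = ℚₚ.≤-trans (ℚₚ.≤-trans (ℚₚ.≤-reflexive (sym (ℚₚ.+-identityʳ x)))
      (ℚₚ.+-monoʳ-≤ x (0≤C½^ n))) x+t≤y

    partial : ∀ n → ∥ S n ∥ ℚ.+ C ℚ.* ½ ^ n ℚ.≤ 2ℚ ℚ.* C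
    partial zero = begin
      ∥ f 0 +ᵍ ι 0ℚ ∥ ℚ.+ C ℚ.* 1ℚ   ≡⟨ cong (λ u → ∥ u ∥ ℚ.+ C ℚ.* 1ℚ) (𝔾.+-identityʳ (f 0)) ⟩
      ∥ f 0 ∥ ℚ.+ C ℚ.* 1ℚ           ≤⟨ ℚₚ.+-monoˡ-≤ (C ℚ.* 1ℚ) (f≤ 0) ⟩
      C ℚ.* 1ℚ ℚ.+ C ℚ.* 1ℚ          ≡⟨ cong (λ u → u ℚ.+ u) (ℚₚ.*-identityʳ C) ⟩
      C ℚ.+ C                        ≡⟨ ε+ε C ⟩
      2ℚ ℚ.* C                       ∎
    partial (suc n) = ℚₚ.≤-trans (add-tail _ ∥ S n ∥ n (ℚₚ.≤-trans
      (subst (λ u → ∥ u ∥ ℚ.≤ ∥ S n ∥ ℚ.+ ∥ f (suc n) ∥) (sym (∑≤ᵍ-last n f)) (∥+∥ (S n) (f (suc n))))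
      (ℚₚ.+-monoʳ-≤ ∥ S n ∥ (f≤ (suc n))))) (partial n)

    tail : ∀ n d → ∥ S (d ℕ.+ n) -ᵍ S n ∥ ℚ.+ C ℚ.* ½ ^ (d ℕ.+ n) ℚ.≤ C ℚ.* ½ ^ n
    tail n zero = ℚₚ.≤-reflexive (trans
      (cong (λ u → ∥ u ∥ ℚ.+ C ℚ.* ½ ^ n) (𝔾.-‿inverseʳ (S n))) (ℚₚ.+-identityˡ _))
    tail n (suc d) = ℚₚ.≤-trans (add-tail _ (∥ S (d ℕ.+ n) -ᵍ S n ∥) (d ℕ.+ n) (ℚₚ.≤-trans
      (subst (λ u → ∥ u ∥ ℚ.≤ ∥ S (d ℕ.+ n) -ᵍ S n ∥ ℚ.+ ∥ f (suc d ℕ.+ n) ∥)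
        (trans (solve 3 (λ s t a → (s :- t) :+ a := (s :+ a) :- t) refl (S (d ℕ.+ n)) (S n) (f (suc d ℕ.+ n)))
          (cong (_-ᵍ S n) (sym (∑≤ᵍ-last (d ℕ.+ n) f))))
        (∥+∥ (S (d ℕ.+ n) -ᵍ S n) (f (suc d ℕ.+ n))))
      (ℚₚ.+-monoʳ-≤ ∥ S (d ℕ.+ n) -ᵍ S n ∥ (f≤ (suc d ℕ.+ n))))) (tail n d)
      where open Solver

  ∥∑∥≤2C : ∀ n → ∥ ∑≤ᵍ n f ∥ ℚ.≤ 2ℚ ℚ.* C
  ∥∑∥≤2C n = drop-tail ∥ S n ∥ (2ℚ ℚ.* C) n (partial n)

  ∥∑-∑∥≤ : ∀ N m n → N ≤ m → N ≤ n → ∥ ∑≤ᵍ m f -ᵍ ∑≤ᵍ n f ∥ ℚ.≤ (2ℚ ℚ.* C) ℚ.* ½ ^ N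
  ∥∑-∑∥≤ N m n N≤m N≤n = begin
    ∥ S m -ᵍ S n ∥                       ≤⟨ ∥-∥-triangle (S m) (S N) (S n) ⟩
    ∥ S m -ᵍ S N ∥ ℚ.+ ∥ S N -ᵍ S n ∥    ≡⟨ cong (∥ S m -ᵍ S N ∥ ℚ.+_) (∥z-w∥≡∥w-z∥ (S N) (S n)) ⟩
    ∥ S m -ᵍ S N ∥ ℚ.+ ∥ S n -ᵍ S N ∥    ≤⟨ ℚₚ.+-mono-≤ (from N m N≤m) (from N n N≤n) ⟩
    C ℚ.* ½ ^ N ℚ.+ C ℚ.* ½ ^ N          ≡⟨ ε+ε (C ℚ.* ½ ^ N) ⟩
    2ℚ ℚ.* (C ℚ.* ½ ^ N)                 ≡⟨ ℚₚ.*-assoc 2ℚ C (½ ^ N) ⟨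
    (2ℚ ℚ.* C) ℚ.* ½ ^ N                 ∎
    where
    from : ∀ N m → N ≤ m → ∥ S m -ᵍ S N ∥ ℚ.≤ C ℚ.* ½ ^ N
    from N m N≤m = subst (λ k → ∥ S k -ᵍ S N ∥ ℚ.≤ C ℚ.* ½ ^ N) (ℕₚ.m∸n+n≡m N≤m)
      (drop-tail ∥ S (m ∸ N ℕ.+ N) -ᵍ S N ∥ (C ℚ.* ½ ^ N) (m ∸ N ℕ.+ N) (tail N (m ∸ N)))

-- log 2 = - log (1 - ½) = Σ_{j ≥ 1} 1 / (j 2ʲ)

private
  log-term : ℕ → ℚ[i]
  log-term j = ι ((+ 1 / suc j) ℚ.* ½ ^ suc j)

  1/n≤1 : ∀ n .{{_ : NonZero n}} → + 1 / n ℚ.≤ 1ℚ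
  1/n≤1 n@(suc n-1) = begin
    + 1 / n                ≡⟨ ℚₚ.*-identityʳ (+ 1 / n) ⟨
    (+ 1 / n) ℚ.* 1ℚ       ≤⟨ ℚₚ.*-monoˡ-≤-nonNeg (+ 1 / n) {{ℚ.nonNegative (0≤1/ n)}} (fromℕ-mono-≤ {1} {n} (s≤s z≤n)) ⟩
    (+ 1 / n) ℚ.* fromℕ n  ≡⟨ 1/n*n n ⟩
    1ℚ                     ∎
    where open ℚₚ.≤-Reasoning

  log-term≤ : ∀ j → ∥ log-term j ∥ ℚ.≤ 1ℚ ℚ.* ½ ^ j
  log-term≤ j = subst (ℚ._≤ 1ℚ ℚ.* ½ ^ j) (sym (∥ι∥ (0≤* (0≤1/ (suc j)) (0≤^ 0≤½ (suc j)))))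
    (*-mono-≤ 0≤1 (0≤^ 0≤½ (suc j)) (1/n≤1 (suc j))
      (ℚₚ.≤-trans (ℚₚ.*-monoʳ-≤-nonNeg (½ ^ j) {{ℚ.nonNegative (0≤^ 0≤½ j)}} ½≤1) (ℚₚ.≤-reflexive (ℚₚ.*-identityˡ (½ ^ j)))))
    where
    ½≤1 : ½ ℚ.≤ 1ℚ
    ½≤1 = ℚ.*≤* (ℤ.+≤+ (s≤s z≤n))

log2 : ℂ
log2 = mkℂ (λ n → ∑≤ᵍ n log-term) (mkCauchy λ ε 0<ε →
  let N , 2½^N≤ε = C½^n≤ε (2ℚ ℚ.* 1ℚ) ε 0<ε
  in return (N , λ m n N≤m N≤n → ℚₚ.≤-trans (∥∑-∑∥≤ log-term 1ℚ log-term≤ N m n N≤m N≤n) 2½^N≤ε))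

-- exp z = Σ_j zʲ / j!, along the diagonal of partial sums and approximations

exp-term : ℚ[i] → ℕ → ℚ[i]
exp-term z j = (z ^ᵍ j) *ᵍ ι 1/[ j ]!

private
  -- Aʲ ≤ Aᴬ j!
  power≤factorial : ∀ A → 1 ≤ A → ∀ j → A ℕ.^ j ≤ A ℕ.^ A ℕ.* j !
  power≤factorial A 1≤A j with ℕₚ.≤-total j A
  ... | inj₁ j≤A = ℕₚ.≤-trans (ℕₚ.^-monoʳ-≤ A {{ℕ.>-nonZero 1≤A}} j≤A) (ℕₚ.m≤m*n (A ℕ.^ A) (j !) {{j ℕₚ.!≢0}})
  power≤factorial A 1≤A zero    | inj₂ _   = ℕₚ.≤-trans (ℕₚ.m^n>0 A {{ℕ.>-nonZero 1≤A}} A) (ℕₚ.≤-reflexive (sym (ℕₚ.*-identityʳ _)))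
  power≤factorial A 1≤A (suc j) | inj₂ A≤j = ℕₚ.≤-trans
    (ℕₚ.*-mono-≤ A≤j (power≤factorial A 1≤A j))
    (ℕₚ.≤-reflexive (begin
      suc j ℕ.* (A ℕ.^ A ℕ.* j !) ≡⟨ ℕₚ.*-assoc (suc j) (A ℕ.^ A) (j !) ⟨
      suc j ℕ.* A ℕ.^ A ℕ.* j !   ≡⟨ cong (ℕ._* j !) (ℕₚ.*-comm (suc j) (A ℕ.^ A)) ⟩
      A ℕ.^ A ℕ.* suc j ℕ.* j !   ≡⟨ ℕₚ.*-assoc (A ℕ.^ A) (suc j) (j !) ⟩
      A ℕ.^ A ℕ.* (suc j) !       ∎))
    where open ≡-Reasoning

  fromℕ-^ : ∀ m n → fromℕ (m ℕ.^ n) ≡ fromℕ m ^ n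
  fromℕ-^ m zero    = refl
  fromℕ-^ m (suc n) = trans (fromℕ-* m (m ℕ.^ n)) (cong (fromℕ m ℚ.*_) (fromℕ-^ m n))

  ^-distrib-* : ∀ p q n → (p ℚ.* q) ^ n ≡ p ^ n ℚ.* q ^ n
  ^-distrib-* p q zero    = refl
  ^-distrib-* p q (suc n) = trans (cong (p ℚ.* q ℚ.*_) (^-distrib-* p q n))
    (solve 4 (λ p q x y → (p :* q) :* (x :* y) := (p :* x) :* (q :* y)) refl p q (p ^ n) (q ^ n))
    where open +-*-Solver

  module Bounds (b : ℕ) (1≤b : 1 ≤ b) where
    open ℚₚ.≤-Reasoning
    B 2B C : ℚ
    B = fromℕ b
    2B = 2ℚ ℚ.* B
    A = 4 ℕ.* b
    C = fromℕ (A ℕ.^ A)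

    0≤B : 0ℚ ℚ.≤ B
    0≤B = 0≤fromℕ b
    1≤B : 1ℚ ℚ.≤ B
    1≤B = fromℕ-mono-≤ 1≤b
    0≤2B : 0ℚ ℚ.≤ 2B
    0≤2B = 0≤* (ℚₚ.<⇒≤ 0<2) 0≤B
    B≤2B : B ℚ.≤ 2B
    B≤2B = ℚₚ.≤-trans (ℚₚ.≤-reflexive (sym (ℚₚ.*-identityˡ B))) (ℚₚ.*-monoʳ-≤-nonNeg B {{ℚ.nonNegative 0≤B}}
      (fromℕ-mono-≤ {1} {2} (s≤s z≤n)))
    0≤1/j! : ∀ j → 0ℚ ℚ.≤ 1/[ j ]!
    0≤1/j! j = 0≤1/ (j !) {{j ℕₚ.!≢0}}

    2B≡½A : 2B ≡ ½ ℚ.* fromℕ A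
    2B≡½A = sym (trans (cong (½ ℚ.*_) (fromℕ-* 4 b)) (sym (ℚₚ.*-assoc ½ (fromℕ 4) B)))

    2B^/j!≤ : ∀ j → 2B ^ j ℚ.* 1/[ j ]! ℚ.≤ C ℚ.* ½ ^ j
    2B^/j!≤ j = begin
      2B ^ j ℚ.* f                            ≡⟨ cong (λ u → u ^ j ℚ.* f) 2B≡½A ⟩
      (½ ℚ.* fromℕ A) ^ j ℚ.* f               ≡⟨ cong (ℚ._* f) (^-distrib-* ½ (fromℕ A) j) ⟩
      (½ ^ j ℚ.* fromℕ A ^ j) ℚ.* f           ≡⟨ cong (λ u → (½ ^ j ℚ.* u) ℚ.* f) (fromℕ-^ A j) ⟨
      (½ ^ j ℚ.* fromℕ (A ℕ.^ j)) ℚ.* f       ≤⟨ ℚₚ.*-monoʳ-≤-nonNeg f {{ℚ.nonNegative (0≤1/j! j)}}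
                                                  (ℚₚ.*-monoˡ-≤-nonNeg (½ ^ j) {{ℚ.nonNegative (0≤^ 0≤½ j)}}
                                                  (fromℕ-mono-≤ (power≤factorial A (ℕₚ.≤-trans 1≤b (ℕₚ.m≤n*m b 4)) j))) ⟩
      (½ ^ j ℚ.* fromℕ (A ℕ.^ A ℕ.* j !)) ℚ.* f  ≡⟨ cong (λ u → (½ ^ j ℚ.* u) ℚ.* f) (fromℕ-* (A ℕ.^ A) (j !)) ⟩
      (½ ^ j ℚ.* (C ℚ.* fromℕ (j !))) ℚ.* f   ≡⟨ solve 4 (λ h c n f → (h :* (c :* n)) :* f := (c :* h) :* (f :* n)) refl (½ ^ j) C (fromℕ (j !)) f ⟩
      (C ℚ.* ½ ^ j) ℚ.* (f ℚ.* fromℕ (j !))   ≡⟨ cong ((C ℚ.* ½ ^ j) ℚ.*_) (1/n*n (j !) {{j ℕₚ.!≢0}}) ⟩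
      (C ℚ.* ½ ^ j) ℚ.* 1ℚ                    ≡⟨ ℚₚ.*-identityʳ (C ℚ.* ½ ^ j) ⟩
      C ℚ.* ½ ^ j                             ∎
      where
      open +-*-Solver
      f = 1/[ j ]!

    power≤ : ∀ z → ∥ z ∥ ℚ.≤ B → ∀ j → ∥ z ^ᵍ j ∥ ℚ.≤ 2B ^ j
    power≤ z z≤ zero    = ℚₚ.≤-refl
    power≤ z z≤ (suc j) = ℚₚ.≤-trans (∥*∥ z (z ^ᵍ j))
      (*-mono-≤ 0≤2B (0≤∥ z ^ᵍ j ∥) (ℚₚ.≤-trans z≤ B≤2B) (power≤ z z≤ j))

    scaled : ∀ z j → ∥ z *ᵍ ι 1/[ j ]! ∥ ℚ.≤ ∥ z ∥ ℚ.* 1/[ j ]!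
    scaled z j = subst (λ u → ∥ z *ᵍ ι 1/[ j ]! ∥ ℚ.≤ ∥ z ∥ ℚ.* u) (∥ι∥ (0≤1/j! j)) (∥*∥ z (ι 1/[ j ]!))

    exp-term≤ : ∀ z → ∥ z ∥ ℚ.≤ B → ∀ j → ∥ exp-term z j ∥ ℚ.≤ C ℚ.* ½ ^ j
    exp-term≤ z z≤ j = ℚₚ.≤-trans (scaled (z ^ᵍ j) j) (ℚₚ.≤-trans
      (ℚₚ.*-monoʳ-≤-nonNeg 1/[ j ]! {{ℚ.nonNegative (0≤1/j! j)}} (power≤ z z≤ j)) (2B^/j!≤ j))

    power-difference≤ : ∀ z w → ∥ z ∥ ℚ.≤ B → ∥ w ∥ ℚ.≤ B → ∀ j →
      ∥ (z ^ᵍ j) -ᵍ (w ^ᵍ j) ∥ ℚ.≤ ∥ z -ᵍ w ∥ ℚ.* 2B ^ j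
    power-difference≤ z w z≤ w≤ zero = ℚₚ.≤-trans (0≤∥ z -ᵍ w ∥) (ℚₚ.≤-reflexive (sym (ℚₚ.*-identityʳ ∥ z -ᵍ w ∥)))
    power-difference≤ z w z≤ w≤ (suc j) = begin
      ∥ (z *ᵍ x) -ᵍ (w *ᵍ y) ∥
        ≡⟨ cong ∥_∥ (Solver.solve 4 (λ z w x y → z Solver.:* x Solver.:- w Solver.:* y Solver.:= z Solver.:* (x Solver.:- y) Solver.:+ (z Solver.:- w) Solver.:* y) refl z w x y) ⟩
      ∥ (z *ᵍ (x -ᵍ y)) +ᵍ ((z -ᵍ w) *ᵍ y) ∥
        ≤⟨ ∥+∥ (z *ᵍ (x -ᵍ y)) ((z -ᵍ w) *ᵍ y) ⟩
      ∥ z *ᵍ (x -ᵍ y) ∥ ℚ.+ ∥ (z -ᵍ w) *ᵍ y ∥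
        ≤⟨ ℚₚ.+-mono-≤ (∥*∥ z (x -ᵍ y)) (∥*∥ (z -ᵍ w) y) ⟩
      ∥ z ∥ ℚ.* ∥ x -ᵍ y ∥ ℚ.+ d ℚ.* ∥ y ∥
        ≤⟨ ℚₚ.+-mono-≤ (*-mono-≤ 0≤B (0≤∥ x -ᵍ y ∥) z≤ (power-difference≤ z w z≤ w≤ j))
             (ℚₚ.*-monoˡ-≤-nonNeg d {{ℚ.nonNegative (0≤∥ z -ᵍ w ∥)}} y≤) ⟩
      B ℚ.* (d ℚ.* 2B ^ j) ℚ.+ d ℚ.* (B ℚ.* 2B ^ j)
        ≡⟨ solve 3 (λ b d p → b :* (d :* p) :+ d :* (b :* p) := d :* (((con 1ℚ :+ con 1ℚ) :* b) :* p)) refl B d (2B ^ j) ⟩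
      d ℚ.* (2B ℚ.* 2B ^ j) ∎
      where
      open +-*-Solver
      d = ∥ z -ᵍ w ∥
      x = z ^ᵍ j
      y = w ^ᵍ j
      y≤ : ∥ y ∥ ℚ.≤ B ℚ.* 2B ^ j
      y≤ = ℚₚ.≤-trans (power≤ w w≤ j) (ℚₚ.≤-trans (ℚₚ.≤-reflexive (sym (ℚₚ.*-identityˡ (2B ^ j))))
        (ℚₚ.*-monoʳ-≤-nonNeg (2B ^ j) {{ℚ.nonNegative (0≤^ 0≤2B j)}} 1≤B))

    ∑-difference : ∀ n (f g : ℕ → ℚ[i]) → ∑≤ᵍ n (λ j → f j -ᵍ g j) ≡ ∑≤ᵍ n f -ᵍ ∑≤ᵍ n g
    ∑-difference zero f g = Solver.solve 2 (λ x y → (x Solver.:- y) Solver.:+ Solver.con (ι 0ℚ) Solver.:= (x Solver.:+ Solver.con (ι 0ℚ)) Solver.:- (y Solver.:+ Solver.con (ι 0ℚ))) refl (f 0) (g 0)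
    ∑-difference (suc n) f g = trans (cong ((f 0 -ᵍ g 0) +ᵍ_) (∑-difference n (f ∘ suc) (g ∘ suc)))
      (Solver.solve 4 (λ x y s t → (x Solver.:- y) Solver.:+ (s Solver.:- t) Solver.:= (x Solver.:+ s) Solver.:- (y Solver.:+ t)) refl (f 0) (g 0) (∑≤ᵍ n (f ∘ suc)) (∑≤ᵍ n (g ∘ suc)))

    exp-lipschitz : ∀ n z w → ∥ z ∥ ℚ.≤ B → ∥ w ∥ ℚ.≤ B →
      ∥ ∑≤ᵍ n (exp-term z) -ᵍ ∑≤ᵍ n (exp-term w) ∥ ℚ.≤ 2ℚ ℚ.* (∥ z -ᵍ w ∥ ℚ.* C)
    exp-lipschitz n z w z≤ w≤ = subst (λ u → ∥ u ∥ ℚ.≤ 2ℚ ℚ.* (∥ z -ᵍ w ∥ ℚ.* C))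
      (∑-difference n (exp-term z) (exp-term w))
      (∥∑∥≤2C (λ j → exp-term z j -ᵍ exp-term w j) (∥ z -ᵍ w ∥ ℚ.* C) term≤ n)
      where
      term≤ : ∀ j → ∥ exp-term z j -ᵍ exp-term w j ∥ ℚ.≤ (∥ z -ᵍ w ∥ ℚ.* C) ℚ.* ½ ^ j
      term≤ j = begin
        ∥ exp-term z j -ᵍ exp-term w j ∥
          ≡⟨ cong ∥_∥ (Solver.solve 3 (λ x y f → x Solver.:* f Solver.:- y Solver.:* f Solver.:= (x Solver.:- y) Solver.:* f) refl (z ^ᵍ j) (w ^ᵍ j) (ι 1/[ j ]!)) ⟩
        ∥ ((z ^ᵍ j) -ᵍ (w ^ᵍ j)) *ᵍ ι 1/[ j ]! ∥
          ≤⟨ scaled ((z ^ᵍ j) -ᵍ (w ^ᵍ j)) j ⟩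
        ∥ (z ^ᵍ j) -ᵍ (w ^ᵍ j) ∥ ℚ.* 1/[ j ]!
          ≤⟨ ℚₚ.*-monoʳ-≤-nonNeg 1/[ j ]! {{ℚ.nonNegative (0≤1/j! j)}} (power-difference≤ z w z≤ w≤ j) ⟩
        (∥ z -ᵍ w ∥ ℚ.* 2B ^ j) ℚ.* 1/[ j ]!
          ≡⟨ ℚₚ.*-assoc ∥ z -ᵍ w ∥ (2B ^ j) 1/[ j ]! ⟩
        ∥ z -ᵍ w ∥ ℚ.* (2B ^ j ℚ.* 1/[ j ]!)
          ≤⟨ ℚₚ.*-monoˡ-≤-nonNeg ∥ z -ᵍ w ∥ {{ℚ.nonNegative (0≤∥ z -ᵍ w ∥)}} (2B^/j!≤ j) ⟩
        ∥ z -ᵍ w ∥ ℚ.* (C ℚ.* ½ ^ j)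
          ≡⟨ ℚₚ.*-assoc ∥ z -ᵍ w ∥ C (½ ^ j) ⟨
        (∥ z -ᵍ w ∥ ℚ.* C) ℚ.* ½ ^ j ∎

exp-cauchy : ∀ {z} → IsCauchy z → IsCauchy (λ n → ∑≤ᵍ n (exp-term (z n)))
exp-cauchy {z} cz = mkCauchy λ ε 0<ε → do
  b , 1≤b , K , z≤ ← bounded cz
  exp-close ε 0<ε b 1≤b K z≤
  where
  exp-close : ∀ ε → 0ℚ ℚ.< ε → ∀ b → 1 ≤ b → ∀ K → (∀ n → K ≤ n → ∥ z n ∥ ℚ.≤ fromℕ b) →
    ¬ ¬ ∃ λ N → ∀ m n → N ≤ m → N ≤ n → ∥ ∑≤ᵍ m (exp-term (z m)) -ᵍ ∑≤ᵍ n (exp-term (z n)) ∥ ℚ.≤ ε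
  exp-close ε 0<ε b 1≤b K z≤ = rescale
    (λ ε → ¬ ¬ ∃ λ N → ∀ m n → N ≤ m → N ≤ n → ∥ ∑≤ᵍ m (exp-term (z m)) -ᵍ ∑≤ᵍ n (exp-term (z n)) ∥ ℚ.≤ ε)
    (2ℚ ℚ.* C ℚ.+ 1ℚ) 0<2C+1
    (λ ε 0<ε → do
      M , near ← close cz ε 0<ε
      let N , C½^N≤ε = C½^n≤ε (2ℚ ℚ.* C) ε 0<ε
      return (K ⊔ (M ⊔ N) , λ m n ≤m ≤n → begin
        ∥ E m (z m) -ᵍ E n (z n) ∥
          ≤⟨ ∥-∥-triangle (E m (z m)) (E m (z n)) (E n (z n)) ⟩
        ∥ E m (z m) -ᵍ E m (z n) ∥ ℚ.+ ∥ E m (z n) -ᵍ E n (z n) ∥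
          ≤⟨ ℚₚ.+-mono-≤
               (exp-lipschitz m (z m) (z n) (z≤ m (⊔ˡ {K} {M ⊔ N} ≤m)) (z≤ n (⊔ˡ {K} {M ⊔ N} ≤n)))
               (∥∑-∑∥≤ (exp-term (z n)) C (exp-term≤ (z n) (z≤ n (⊔ˡ {K} {M ⊔ N} ≤n))) N m n
                 (⊔ʳ {M} {N} (⊔ʳ {K} {M ⊔ N} ≤m)) (⊔ʳ {M} {N} (⊔ʳ {K} {M ⊔ N} ≤n))) ⟩
        2ℚ ℚ.* (∥ z m -ᵍ z n ∥ ℚ.* C) ℚ.+ (2ℚ ℚ.* C) ℚ.* ½ ^ N
          ≤⟨ ℚₚ.+-mono-≤
               (ℚₚ.*-monoˡ-≤-nonNeg 2ℚ (ℚₚ.*-monoʳ-≤-nonNeg C {{ℚ.nonNegative 0≤C}}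
                 (near m n (⊔ˡ {M} {N} (⊔ʳ {K} {M ⊔ N} ≤m)) (⊔ˡ {M} {N} (⊔ʳ {K} {M ⊔ N} ≤n)))))
               C½^N≤ε ⟩
        2ℚ ℚ.* (ε ℚ.* C) ℚ.+ ε
          ≡⟨ solve 3 (λ t e c → t :* (e :* c) :+ e := (t :* c :+ con 1ℚ) :* e) refl 2ℚ ε C ⟩
        (2ℚ ℚ.* C ℚ.+ 1ℚ) ℚ.* ε ∎))
    ε 0<ε
    where
    open ℚₚ.≤-Reasoning
    open +-*-Solver using (solve; _:*_; _:+_; _:=_; con)
    open Bounds b 1≤b
    E : ℕ → ℚ[i] → ℚ[i]
    E n w = ∑≤ᵍ n (exp-term w)
    0≤C : 0ℚ ℚ.≤ C
    0≤C = 0≤fromℕ (A ℕ.^ A)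
    0<2C+1 : 0ℚ ℚ.< 2ℚ ℚ.* C ℚ.+ 1ℚ
    0<2C+1 = ℚₚ.<-≤-trans 0<1 (ℚₚ.≤-trans (ℚₚ.≤-reflexive (sym (ℚₚ.+-identityˡ 1ℚ)))
      (ℚₚ.+-monoˡ-≤ 1ℚ (0≤* (ℚₚ.<⇒≤ 0<2) 0≤C)))

exp : ℂ → ℂ
exp z = mkℂ (λ n → ∑≤ᵍ n (exp-term (seq z n))) (exp-cauchy (cauchy z))

module Series (R : CommutativeRing 0ℓ 0ℓ) where
  private
    open module R = CommutativeRing R hiding (_≈_; _+_; _*_; -_; 0#; 1#; refl; sym; trans; isCommutativeRing)
  open Sums R using (∑≤; ∑≤-cong)
  open SetoidReasoning R.setoid

  Ser : Set
  Ser = ℕ → R.Carrier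

  infix  4 _≋_
  infix  8 ⊖_
  infixl 7 _⊛_
  infixl 6 _⊕_

  _≋_ : Ser → Ser → Set
  f ≋ g = ∀ n → f n R.≈ g n

  _⊕_ _⊛_ : Ser → Ser → Ser
  (f ⊕ g) n = f n R.+ g n
  (f ⊛ g) n = ∑≤ n λ i → f i R.* g (n ∸ i)

  ⊖_ : Ser → Ser
  (⊖ f) n = R.- f n

  constant : R.Carrier → Ser
  constant c zero    = c
  constant c (suc n) = R.0#

  0ˢ 1ˢ : Ser
  0ˢ _ = R.0#
  1ˢ = constant R.1#

  private
    tail : Ser → Ser
    tail f = f ∘ suc

  ⊛-cong : ∀ {f f′ g g′} → f ≋ f′ → g ≋ g′ → f ⊛ g ≋ f′ ⊛ g′
  ⊛-cong f≋ g≋ n = ∑≤-cong n λ i → *-cong (f≋ i) (g≋ (n ∸ i))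

  ⊛-zeroˡ : ∀ g → 0ˢ ⊛ g ≋ 0ˢ
  ⊛-zeroˡ g zero    = R.trans (+-identityʳ _) (zeroˡ (g 0))
  ⊛-zeroˡ g (suc n) = R.trans (+-cong (zeroˡ (g (suc n))) (⊛-zeroˡ g n)) (+-identityʳ R.0#)

  constant-⊛ : ∀ c g n → (constant c ⊛ g) n R.≈ c R.* g n
  constant-⊛ c g zero    = +-identityʳ _
  constant-⊛ c g (suc n) = R.trans (+-congˡ (⊛-zeroˡ g n)) (+-identityʳ _)

  -- (f g)ₙ₊₁ = (f · tail g)ₙ + fₙ₊₁ g₀
  ⊛-last : ∀ f g n → (f ⊛ g) (suc n) R.≈ (f ⊛ tail g) n R.+ f (suc n) R.* g 0
  ⊛-last f g zero    = R.trans (+-congˡ (+-identityʳ _)) (+-congʳ (R.sym (+-identityʳ _)))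
  ⊛-last f g (suc n) = R.trans (+-congˡ (⊛-last (tail f) g n)) (R.sym (+-assoc _ _ _))

  ⊛-comm : ∀ f g → f ⊛ g ≋ g ⊛ f
  ⊛-comm f g zero    = +-congʳ (*-comm (f 0) (g 0))
  ⊛-comm f g (suc n) = begin
    f 0 R.* g (suc n) R.+ (tail f ⊛ g) n ≈⟨ +-cong (*-comm (f 0) (g (suc n))) (⊛-comm (tail f) g n) ⟩
    g (suc n) R.* f 0 R.+ (g ⊛ tail f) n ≈⟨ +-comm _ _ ⟩
    (g ⊛ tail f) n R.+ g (suc n) R.* f 0 ≈⟨ ⊛-last g f n ⟨
    (g ⊛ f) (suc n)                      ∎

  ⊛-distribʳ : ∀ f g h → (g ⊕ h) ⊛ f ≋ (g ⊛ f) ⊕ (h ⊛ f)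
  ⊛-distribʳ f g h zero = begin
    (g 0 R.+ h 0) R.* f 0 R.+ R.0#                    ≈⟨ +-identityʳ _ ⟩
    (g 0 R.+ h 0) R.* f 0                             ≈⟨ distribʳ (f 0) (g 0) (h 0) ⟩
    g 0 R.* f 0 R.+ h 0 R.* f 0                       ≈⟨ +-cong (+-identityʳ _) (+-identityʳ _) ⟨
    (g ⊛ f) 0 R.+ (h ⊛ f) 0                           ∎
  ⊛-distribʳ f g h (suc n) = begin
    (g 0 R.+ h 0) R.* f (suc n) R.+ ((tail g ⊕ tail h) ⊛ f) n
      ≈⟨ +-cong (distribʳ (f (suc n)) (g 0) (h 0)) (⊛-distribʳ f (tail g) (tail h) n) ⟩
    (g 0 R.* f (suc n) R.+ h 0 R.* f (suc n)) R.+ ((tail g ⊛ f) n R.+ (tail h ⊛ f) n)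
      ≈⟨ interchange _ _ _ _ ⟩
    (g ⊛ f) (suc n) R.+ (h ⊛ f) (suc n) ∎
    where open CommutativeSemigroupProperties R.+-commutativeSemigroup using (interchange)

  scale-⊛ : ∀ c f g n → ((λ i → c R.* f i) ⊛ g) n R.≈ c R.* (f ⊛ g) n
  scale-⊛ c f g zero = R.trans (+-identityʳ _)
    (R.trans (*-assoc c (f 0) (g 0)) (*-congˡ (R.sym (+-identityʳ _))))
  scale-⊛ c f g (suc n) = R.trans (+-cong (*-assoc c (f 0) (g (suc n))) (scale-⊛ c (tail f) g n))
    (R.sym (distribˡ c _ _))

  ⊛-assoc : ∀ f g h → (f ⊛ g) ⊛ h ≋ f ⊛ (g ⊛ h)
  ⊛-assoc f g h zero = +-congʳ (begin
    (f 0 R.* g 0 R.+ R.0#) R.* h 0   ≈⟨ *-congʳ (+-identityʳ _) ⟩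
    f 0 R.* g 0 R.* h 0              ≈⟨ *-assoc _ _ _ ⟩
    f 0 R.* (g 0 R.* h 0)            ≈⟨ *-congˡ (+-identityʳ _) ⟨
    f 0 R.* (g 0 R.* h 0 R.+ R.0#)   ∎)
  ⊛-assoc f g h (suc n) = begin
    (f ⊛ g) 0 R.* h (suc n) R.+ (((λ i → f 0 R.* tail g i) ⊕ (tail f ⊛ g)) ⊛ h) n
      ≈⟨ +-cong (R.trans (*-congʳ (+-identityʳ _)) (*-assoc _ _ _))
           (⊛-distribʳ h (λ i → f 0 R.* tail g i) (tail f ⊛ g) n) ⟩
    f 0 R.* (g 0 R.* h (suc n)) R.+ (((λ i → f 0 R.* tail g i) ⊛ h) n R.+ ((tail f ⊛ g) ⊛ h) n)
      ≈⟨ +-congˡ (+-cong (scale-⊛ (f 0) (tail g) h n) (⊛-assoc (tail f) g h n)) ⟩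
    f 0 R.* (g 0 R.* h (suc n)) R.+ (f 0 R.* (tail g ⊛ h) n R.+ (tail f ⊛ (g ⊛ h)) n)
      ≈⟨ +-assoc _ _ _ ⟨
    (f 0 R.* (g 0 R.* h (suc n)) R.+ f 0 R.* (tail g ⊛ h) n) R.+ (tail f ⊛ (g ⊛ h)) n
      ≈⟨ +-congʳ (distribˡ _ _ _) ⟨
    f 0 R.* (g ⊛ h) (suc n) R.+ (tail f ⊛ (g ⊛ h)) n ∎

  ⊛-identityˡ : ∀ f → 1ˢ ⊛ f ≋ f
  ⊛-identityˡ f n = R.trans (constant-⊛ R.1# f n) (*-identityˡ (f n))

  isCommutativeRing : IsCommutativeRing _≋_ _⊕_ _⊛_ ⊖_ 0ˢ 1ˢ
  isCommutativeRing = record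
    { isRing = record
      { +-isAbelianGroup = record
        { isGroup = record
          { isMonoid = record
            { isSemigroup = record
              { isMagma = record
                { isEquivalence = record
                  { refl  = λ _ → R.refl
                  ; sym   = λ f≋g n → R.sym (f≋g n)
                  ; trans = λ f≋g g≋h n → R.trans (f≋g n) (g≋h n)
                  }
                ; ∙-cong = λ f≋ g≋ n → +-cong (f≋ n) (g≋ n)
                }
              ; assoc = λ f g h n → +-assoc (f n) (g n) (h n)
              }
            ; identity = (λ f n → +-identityˡ (f n)) , (λ f n → +-identityʳ (f n))
            }
          ; inverse = (λ f n → -‿inverseˡ (f n)) , (λ f n → -‿inverseʳ (f n))
          ; ⁻¹-cong = λ f≋g n → -‿cong (f≋g n)
          }
        ; comm = λ f g n → +-comm (f n) (g n)
        }
      ; *-cong = ⊛-cong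
      ; *-assoc = ⊛-assoc
      ; *-identity = ⊛-identityˡ , λ f n → R.trans (⊛-comm f 1ˢ n) (⊛-identityˡ f n)
      ; distrib = (λ f g h n → R.trans (⊛-comm f (g ⊕ h) n) (R.trans (⊛-distribʳ f g h n)
                    (+-cong (⊛-comm g f n) (⊛-comm h f n))))
                , ⊛-distribʳ
      }
    ; *-comm = ⊛-comm
    }

  commutativeRing : CommutativeRing 0ℓ 0ℓ
  commutativeRing = record { isCommutativeRing = isCommutativeRing }

  open Exp (CommutativeRing.semiring commutativeRing) public using () renaming (_^_ to _^ˢ_)

  -- f(g(t)); as the sum is cut at j = n, this is the composition only
  -- for g with zero constant term
  infixr 9 _∘ˢ_
  _∘ˢ_ : Ser → Ser → Ser
  (f ∘ˢ g) n = ∑≤ n λ j → f j R.* (g ^ˢ j) n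

  -- 1/f, given u = 1/f₀: with h = 1 - u f it is u (1 + h + h² + …)
  reciprocal : (f : Ser) (u : R.Carrier) → Ser
  reciprocal f u = constant u ⊛ ((λ _ → R.1#) ∘ˢ (1ˢ ⊕ ⊖ (constant u ⊛ f)))

module Polynomials (K : CommutativeRing 0ℓ 0ℓ) where
  private
    open module K = CommutativeRing K using (Carrier)
    module S = Series K
    module KP = RingProperties K.ring

  Poly : Set
  Poly = List Carrier

  coeff : Poly → ℕ → Carrier
  coeff []      _       = K.0#
  coeff (a ∷ p) zero    = a
  coeff (a ∷ p) (suc n) = coeff p n

  infix 4 _≈ₚ_

  -- trailing zeros are immaterial
  record _≈ₚ_ (p q : Poly) : Set where
    constructor mk≈ₚ
    field
      coeff≈ : ∀ n → coeff p n K.≈ coeff q n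

  open _≈ₚ_ public

  infix  8 -ₚ_
  infixl 7 _*ₚ_ _•_
  infixl 6 _+ₚ_

  _•_ : Carrier → Poly → Poly
  c • p = map (c K.*_) p

  _+ₚ_ _*ₚ_ : Poly → Poly → Poly
  []      +ₚ q       = q
  (a ∷ p) +ₚ []      = a ∷ p
  (a ∷ p) +ₚ (b ∷ q) = (a K.+ b) ∷ (p +ₚ q)

  []      *ₚ q = []
  (a ∷ p) *ₚ q = a • q +ₚ (K.0# ∷ p *ₚ q)

  -ₚ_ : Poly → Poly
  -ₚ p = map K.-_ p

  const : Carrier → Poly
  const c = c ∷ []

  X : Poly
  X = K.0# ∷ K.1# ∷ []

  eval : Poly → Carrier → Carrier
  eval []      a = K.0#
  eval (c ∷ p) a = c K.+ a K.* eval p a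

  coeff-+ : ∀ p q n → coeff (p +ₚ q) n K.≈ coeff p n K.+ coeff q n
  coeff-+ []      q       n       = K.sym (K.+-identityˡ _)
  coeff-+ (a ∷ p) []      n       = K.sym (K.+-identityʳ _)
  coeff-+ (a ∷ p) (b ∷ q) zero    = K.refl
  coeff-+ (a ∷ p) (b ∷ q) (suc n) = coeff-+ p q n

  coeff-• : ∀ c p n → coeff (c • p) n K.≈ c K.* coeff p n
  coeff-• c []      n       = K.sym (K.zeroʳ c)
  coeff-• c (a ∷ p) zero    = K.refl
  coeff-• c (a ∷ p) (suc n) = coeff-• c p n

  coeff-neg : ∀ p n → coeff (-ₚ p) n K.≈ K.- coeff p n
  coeff-neg []      n       = K.sym KP.-0#≈0#
  coeff-neg (a ∷ p) zero    = K.refl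
  coeff-neg (a ∷ p) (suc n) = coeff-neg p n

  coeff-const : ∀ c n → coeff (const c) n K.≈ S.constant c n
  coeff-const c zero    = K.refl
  coeff-const c (suc n) = K.refl

  coeff-* : ∀ p q n → coeff (p *ₚ q) n K.≈ (coeff p S.⊛ coeff q) n
  coeff-* []      q n       = K.sym (S.⊛-zeroˡ (coeff q) n)
  coeff-* (a ∷ p) q zero    = K.trans (coeff-+ (a • q) (K.0# ∷ p *ₚ q) 0) (K.+-congʳ (coeff-• a q 0))
  coeff-* (a ∷ p) q (suc n) = K.trans (coeff-+ (a • q) (K.0# ∷ p *ₚ q) (suc n))
    (K.+-cong (coeff-• a q (suc n)) (coeff-* p q n))

  rawRing : RawRing 0ℓ 0ℓ
  rawRing = record
    { _≈_ = _≈ₚ_ ; _+_ = _+ₚ_ ; _*_ = _*ₚ_ ; -_ = -ₚ_ ; 0# = [] ; 1# = const K.1# }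

  private
    open RingMorphisms rawRing (CommutativeRing.rawRing S.commutativeRing)

    coeff-isRingMonomorphism : IsRingMonomorphism coeff
    coeff-isRingMonomorphism = record
      { isRingHomomorphism = record
        { isSemiringHomomorphism = record
          { isNearSemiringHomomorphism = record
            { +-isMonoidHomomorphism = record
              { isMagmaHomomorphism = record
                { isRelHomomorphism = record { cong = coeff≈ }
                ; homo = coeff-+
                }
              ; ε-homo = λ _ → K.refl
              }
            ; *-homo = coeff-*
            }
          ; 1#-homo = coeff-const K.1#
          }
        ; -‿homo = coeff-neg
        }
      ; injective = mk≈ₚ
      }

  commutativeRing : CommutativeRing 0ℓ 0ℓ
  commutativeRing = record
    { isCommutativeRing = RingMonomorphism.isCommutativeRing coeff-isRingMonomorphism S.isCommutativeRing }

module SpecialSeries (R : CommutativeRing 0ℓ 0ℓ) (ofℚ : ℚ → CommutativeRing.Carrier R) where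
  private
    open module R = CommutativeRing R using (Carrier)
    open Exp R.semiring using () renaming (_^_ to _^ᴿ_)
  open Series R using (Ser)

  falling : Carrier → ℕ → Carrier
  falling a zero    = R.1#
  falling a (suc n) = falling a n R.* (a R.- ofℚ (fromℕ n))

  binomial : Carrier → ℕ → Carrier
  binomial a j = falling a j R.* ofℚ 1/[ j ]!

  [1+t]^_ : Carrier → Ser
  [1+t]^ a = binomial a

  e^[_t] : Carrier → Ser
  e^[ a t] n = a ^ᴿ n R.* ofℚ 1/[ n ]!

  log[1+t] : Ser
  log[1+t] zero    = R.0#
  log[1+t] (suc n) = ofℚ ((ℚ.- 1ℚ) ^ n ℚ.* (+ 1 / suc n))

  Lif : ℤ → Ser
  Lif (+ k)    n = ofℚ (1/[ n ]! ℚ.* (+ 1 / suc n) ^ k)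
  Lif -[1+ k ] n = ofℚ (1/[ n ]! ℚ.* fromℕ (suc n) ^ suc k)

module ℂ-Ring = CommutativeRing ℂ-commutativeRing
module ℂ[x] = Polynomials ℂ-commutativeRing

open ℂ[x] public using (Poly; X; const; coeff; eval; _•_; _≈ₚ_)

open Exp ℂ-Ring.semiring public using () renaming (_^_ to _^ᶜ_)
open Sums ℂ-commutativeRing public using () renaming (∑≤ to ∑ᶜ≤)
open Sums ℂ[x].commutativeRing public using () renaming (∑≤ to ∑ₚ≤)

infixl 6 _-ᶜ_

_-ᶜ_ : ℂ → ℂ → ℂ
z -ᶜ w = z +ᶜ (-ᶜ w)

ofℕ : ℕ → ℂ
ofℕ n = fromℚ (fromℕ n)

x≉y⇒x-y≉0 : ∀ {z w} → z ≉ w → z -ᶜ w ≉ 0ℂ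
x≉y⇒x-y≉0 {z} {w} z≉w z-w≈0 = z≉w (RingProperties.x∙y⁻¹≈ε⇒x≈y ℂ-Ring.ring z w z-w≈0)

open SpecialSeries ℂ-commutativeRing fromℚ public using () renaming (falling to fallingᶜ)

-- Generating functions live in ℂ[x]⟦t⟧, with x the indeterminate and ℂ embedded
-- in ℂ[x] by const; equality of polynomials is equality of coefficients.
open SpecialSeries ℂ[x].commutativeRing (const ∘ fromℚ)
open Series ℂ[x].commutativeRing

-- The principal branch: 2^(-μ) = e^(-μ log 2) with log 2 real.
2^-_ : ℂ → ℂ
2^- μ = exp (-ᶜ (μ *ᶜ log2))

-- (1 + (1+t)^λ)^(-μ) = 2^(-μ) (1 + w)^(-μ), where w = ½ Σ_{j ≥ 1} (λ choose j) tʲ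
peters : ℂ → ℂ → Ser
peters lam μ = constant (const (2^- μ)) ⊛ ([1+t]^ (const (-ᶜ μ)) ∘ˢ w)
  where
  w : Ser
  w zero    = []
  w (suc j) = fromℚ ½ • binomial (const lam) (suc j)

CP : ℕ → ℤ → ℂ → ℂ → Poly
CP n k lam μ = ofℕ (n !) • (peters lam μ ⊛ (Lif k ∘ˢ log[1+t]) ⊛ [1+t]^ (ℂ[x].-ₚ X)) n

S₁ : ℕ → ℕ → ℂ
S₁ n l = coeff (falling X n) l

H : ℕ → ℕ → (lam : ℂ) → lam ≉ 1ℂ → Poly
H n s lam lam≉1 = ofℕ (n !) • ((1-λ/e^t-λ ^ˢ s) ⊛ e^[ X t]) n
  where
  1-λ≉0 : 1ℂ -ᶜ lam ≉ 0ℂ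
  1-λ≉0 = x≉y⇒x-y≉0 (lam≉1 ∘ ℂ-Ring.sym)
  1-λ/e^t-λ : Ser
  1-λ/e^t-λ = constant (const (1ℂ -ᶜ lam)) ⊛
    reciprocal (e^[ const 1ℂ t] ⊕ ⊖ constant (const lam)) (const ((1ℂ -ᶜ lam) ⁻¹[ 1-λ≉0 ]))

{-# OPTIONS --safe #-}
module Submission where

-- Let Λ f = f(- log (1+t)). It is multiplicative and sends e^(au) to (1+t)^(-a), since both sides
-- satisfy the same first order equation for (1+t) d/dt. With F = (1-λ)/(e^u-λ), the series
-- F^s e^(xu) generates H_m^{(s)}(x|λ), and Λ(1/F) = (1+t)^(-1) (1 + λ/(λ-1) t), so applying Λ to
-- e^(xu) = F^(-s) · F^s e^(xu) gives
--   (1+t)^(-x) = (1 + λ/(λ-1) t)^s (1+t)^(-s) Σ_m H_m^{(s)}(x|λ) (- log (1+t))^m / m!.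
-- Multiply by the factors of the generating function of CP_n(x) that are free of x; together
-- with (1+t)^(-s) they generate CP_n(s). Then compare coefficients of tⁿ, where
-- (log (1+t))^m / m! = Σ_n S₁(n,m) tⁿ / n!.

-- `Λ` is not built with `∘ˢ`, whose truncated sums would need a chain rule of their own. It is
-- defined by recursion so that `E (Λ f)` equals the negative of `Λ (D f)` by construction, `E`
-- being (1+t) d/dt; its properties come from comparing images under `E`, and division by n + 1
-- passes to the next coefficient. This is why all rings are algebras over ℚ. What is carried
-- through `Λ` explicitly is 1/F = (e^u-λ)/(1-λ), whose image is ((1+t)^(-1)-λ)/(1-λ); the
-- reciprocal inside F is never transformed. The powers of -log (1+t) are identified by a recurrence
-- alone, the one of the Stirling numbers. The braces of the theorem contain only scalars, among
-- them values CP_j(s) of polynomials in x, while the series have coefficients in ℂ[x]. Hence two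
-- rings `K` and `R` with a map `ι`, and the condition that the remaining factor G of the generating
-- function is unchanged by evaluating at s and embedding again: it makes G (1+t)^(-s) the
-- generating function of these values.

open import Defs using (module Sums; module Series; module SpecialSeries; module Polynomials; fromℕ; fromℕ-+; fromℕ-*; 1/[_]!; 1/n*n)
open import Algebra.Bundles using (CommutativeRing)
import Algebra.Morphism.Construct.Composition as Composition
open import Algebra.Morphism.Structures using (module RingMorphisms)
import Algebra.Properties.CommutativeMonoid.Sum as CommutativeMonoidSum
import Algebra.Properties.CommutativeSemigroup as CommutativeSemigroupProperties
import Algebra.Properties.CommutativeSemiring.Exp as CommutativeExp
import Algebra.Properties.Ring as RingProperties
import Algebra.Properties.Semiring.Exp as Exp
import Algebra.Properties.Semiring.Sum as SemiringSum
import Algebra.Solver.Ring as RingSolver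
import Algebra.Solver.Ring.AlmostCommutativeRing as ACR
open import Data.Fin.Base using (toℕ)
open import Data.Integer.Base using (ℤ; +_; -[1+_])
open import Data.List.Base using ([]; _∷_)
open import Data.Maybe.Base as Maybe using (Maybe)
open import Data.Nat.Base as ℕ using (ℕ; zero; suc; _≤_; _<_; _∸_; _⊓_; _!; NonZero; z≤n; s≤s)
open import Data.Nat.Combinatorics
  using (_C_; nCk≡n!/k![n-k]!; nCk+nC[k+1]≡[n+1]C[k+1]; k>n⇒nCk≡0; k![n∸k]!∣n!)
open import Data.Nat.DivMod using (m/n*n≡m)
import Data.Nat.Properties as ℕₚ
open import Data.Product.Base using (Σ; _,_; _×_)
open import Data.Rational.Base using (ℚ; 0ℚ; 1ℚ; ½; _/_)
import Data.Rational.Properties as ℚₚ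
open import Data.Rational.Solver using (module +-*-Solver)
open import Data.Sum.Base using (inj₁; inj₂)
open import Function.Base using (_∘_)
open import Level using (0ℓ)
import Relation.Binary.Reasoning.Setoid as SetoidReasoning
open import Relation.Binary.PropositionalEquality as ≡ using (_≡_)
open import Relation.Nullary using (contradiction)
open import Relation.Nullary.Decidable using (dec⇒maybe)

-- Finite sums.

module SumProperties (R : CommutativeRing 0ℓ 0ℓ) where
  open CommutativeRing R
  open Sums R
  private
    module CS = CommutativeMonoidSum +-commutativeMonoid
    module SS = SemiringSum semiring

  ∑≤-cong-≤ : ∀ n {f g : ℕ → Carrier} → (∀ i → i ≤ n → f i ≈ g i) → ∑≤ n f ≈ ∑≤ n g
  ∑≤-cong-≤ zero    f≈g = +-congʳ (f≈g 0 z≤n)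
  ∑≤-cong-≤ (suc n) f≈g = +-cong (f≈g 0 z≤n) (∑≤-cong-≤ n λ i i≤n → f≈g (suc i) (s≤s i≤n))

  ∑≤-zero : ∀ n {f : ℕ → Carrier} → (∀ i → i ≤ n → f i ≈ 0#) → ∑≤ n f ≈ 0#
  ∑≤-zero n f≈0 = trans (∑≤-cong-≤ n f≈0) (CS.sum-replicate-zero (suc n))

  ∑≤-extend : ∀ {m n} {f : ℕ → Carrier} → m ≤ n →
    (∀ i → m < i → i ≤ n → f i ≈ 0#) → ∑≤ m f ≈ ∑≤ n f
  ∑≤-extend {n = zero}  z≤n       f≈0 = refl
  ∑≤-extend {n = suc n} z≤n       f≈0 =
    +-congˡ (sym (∑≤-zero n λ i i≤n → f≈0 (suc i) (s≤s z≤n) (s≤s i≤n)))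
  ∑≤-extend             (s≤s m≤n) f≈0 =
    +-congˡ (∑≤-extend m≤n λ i m<i i≤n → f≈0 (suc i) (s≤s m<i) (s≤s i≤n))

  ∑≤-comm : ∀ m n (f : ℕ → ℕ → Carrier) →
    (∑≤ m λ i → ∑≤ n (f i)) ≈ (∑≤ n λ j → ∑≤ m λ i → f i j)
  ∑≤-comm m n f = CS.∑-comm {suc m} {suc n} λ i j → f (toℕ i) (toℕ j)

  ∑≤-distrib-+ : ∀ n (f g : ℕ → Carrier) → (∑≤ n λ i → f i + g i) ≈ ∑≤ n f + ∑≤ n g
  ∑≤-distrib-+ n f g = CS.∑-distrib-+ {suc n} (f ∘ toℕ) (g ∘ toℕ)

  *-distribˡ-∑≤ : ∀ n x (f : ℕ → Carrier) → x * ∑≤ n f ≈ ∑≤ n λ i → x * f i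
  *-distribˡ-∑≤ n x f = SS.*-distribˡ-sum {suc n} x (f ∘ toℕ)

  *-distribʳ-∑≤ : ∀ n x (f : ℕ → Carrier) → ∑≤ n f * x ≈ ∑≤ n λ i → f i * x
  *-distribʳ-∑≤ n x f = SS.*-distribʳ-sum {suc n} x (f ∘ toℕ)

-- Reciprocals of power series.

module SeriesProperties (R : CommutativeRing 0ℓ 0ℓ) where
  open CommutativeRing R
  open Sums R using (∑≤; ∑≤-cong)
  open SumProperties R
  open Series R hiding (isCommutativeRing; commutativeRing)

  module S = CommutativeRing (Series.commutativeRing R)

  ⊛-congˡ-≤ : ∀ n f {g g′} → (∀ i → i ≤ n → g i ≈ g′ i) → (f ⊛ g) n ≈ (f ⊛ g′) n
  ⊛-congˡ-≤ n f g≈ = ∑≤-cong-≤ n λ i _ → *-congˡ {f i} (g≈ (n ∸ i) (ℕₚ.m∸n≤m n i))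

  private
    ∑≤-pointwise : ∀ m (F : ℕ → Ser) n → Sums.∑≤ (Series.commutativeRing R) m F n ≈ ∑≤ m λ j → F j n
    ∑≤-pointwise zero    F n = refl
    ∑≤-pointwise (suc m) F n = +-congˡ (∑≤-pointwise m (F ∘ suc) n)

  -- Each factor h contributes at least one power of t. Thus the cut at j = n in `∘ˢ` loses nothing
  -- and may be moved to any later index.
  ^ˢ-order : ∀ h → h 0 ≈ 0# → ∀ {n j} → n < j → (h ^ˢ j) n ≈ 0#
  ^ˢ-order h h₀≈0 {zero}  {suc j} _         = trans (+-identityʳ _) (trans (*-congʳ h₀≈0) (zeroˡ _))
  ^ˢ-order h h₀≈0 {suc n} {suc j} (s≤s n<j) = begin
    h 0 * (h ^ˢ j) (suc n) + ((h ∘ suc) ⊛ (h ^ˢ j)) n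
      ≈⟨ +-cong (trans (*-congʳ h₀≈0) (zeroˡ _))
           (⊛-congˡ-≤ n (h ∘ suc) λ i i≤n → ^ˢ-order h h₀≈0 (ℕₚ.≤-<-trans i≤n n<j)) ⟩
    0# + ((h ∘ suc) ⊛ 0ˢ) n  ≈⟨ +-identityˡ _ ⟩
    ((h ∘ suc) ⊛ 0ˢ) n       ≈⟨ S.zeroʳ (h ∘ suc) n ⟩
    0#                       ∎
    where open SetoidReasoning setoid

  geometric : Ser → Ser
  geometric h = (λ _ → 1#) ∘ˢ h

  -- All coefficients up to n can be read off one common partial sum of powers of h, and from that
  -- finite sum a factor h can be taken out.
  geometric-unfold : ∀ h → h 0 ≈ 0# → geometric h ≋ 1ˢ ⊕ (h ⊛ geometric h)
  geometric-unfold h h₀≈0 n = begin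
    -- The cut at n + 1 instead of n leaves exactly the powers h ⊛ h^j with j ≤ n after the leading
    -- 1 is split off.
    geometric h n                            ≈⟨ partial n (suc n) (ℕₚ.n≤1+n n) ⟩
    1ˢ n + ∑ˢ n (λ j → h ⊛ (h ^ˢ j)) n       ≈⟨ +-congˡ (SumProperties.*-distribˡ-∑≤ (Series.commutativeRing R) n h (h ^ˢ_) n) ⟨
    1ˢ n + (h ⊛ ∑ˢ n (h ^ˢ_)) n              ≈⟨ +-congˡ (⊛-congˡ-≤ n h λ i i≤n → sym (partial i n i≤n)) ⟩
    1ˢ n + (h ⊛ geometric h) n               ∎
    where
    open SetoidReasoning setoid
    ∑ˢ = Sums.∑≤ (Series.commutativeRing R)
    partial : ∀ n m → n ≤ m → geometric h n ≈ ∑ˢ m (h ^ˢ_) n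
    partial n m n≤m = begin
      geometric h n             ≈⟨ ∑≤-cong n {g = λ j → (h ^ˢ j) n} (λ j → *-identityˡ _) ⟩
      ∑≤ n (λ j → (h ^ˢ j) n)   ≈⟨ ∑≤-extend n≤m (λ j n<j _ → ^ˢ-order h h₀≈0 n<j) ⟩
      ∑≤ m (λ j → (h ^ˢ j) n)   ≈⟨ ∑≤-pointwise m (h ^ˢ_) n ⟨
      ∑ˢ m (h ^ˢ_) n            ∎

  -- With g = u f and q = 1 + h + h² + ... for h = 1 - g, unfolding gives q = 1 + q - g q;
  -- cancelling q leaves g q = 1.
  reciprocal-inverse : ∀ f u → u * f 0 ≈ 1# → f ⊛ reciprocal f u ≋ 1ˢ
  reciprocal-inverse f u uf₀≈1 = begin
    f ⊛ (constant u ⊛ q)  ≈⟨ S.*-assoc f (constant u) q ⟨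
    f ⊛ constant u ⊛ q    ≈⟨ S.*-congʳ {q} (S.*-comm f (constant u)) ⟩
    g ⊛ q                 ≈⟨ S.*-congʳ {q} (λ n → GP.-‿involutive (g n)) ⟨
    ⊖ (⊖ g) ⊛ q           ≈⟨ SP.-‿distribˡ-* (⊖ g) q ⟨
    ⊖ (⊖ g ⊛ q)           ≈⟨ S.+-identityʳ _ ⟨
    ⊖ (⊖ g ⊛ q) ⊕ 0ˢ      ≈⟨ S.+-congˡ {⊖ (⊖ g ⊛ q)} cancel ⟩
    ⊖ (⊖ g ⊛ q) ⊕ (1ˢ ⊕ ⊖ g ⊛ q) ≈⟨ S.+-congˡ {⊖ (⊖ g ⊛ q)} (S.+-comm 1ˢ (⊖ g ⊛ q)) ⟩
    ⊖ (⊖ g ⊛ q) ⊕ (⊖ g ⊛ q ⊕ 1ˢ) ≈⟨ S.+-assoc (⊖ (⊖ g ⊛ q)) (⊖ g ⊛ q) 1ˢ ⟨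
    ⊖ (⊖ g ⊛ q) ⊕ ⊖ g ⊛ q ⊕ 1ˢ   ≈⟨ S.+-congʳ {1ˢ} (S.-‿inverseˡ (⊖ g ⊛ q)) ⟩
    0ˢ ⊕ 1ˢ               ≈⟨ S.+-identityˡ 1ˢ ⟩
    1ˢ                    ∎
    where
    open SetoidReasoning S.setoid
    module GP = RingProperties ring
    module SP = RingProperties S.ring
    g = constant u ⊛ f
    h = 1ˢ ⊕ ⊖ g
    q = geometric h
    h₀≈0 : h 0 ≈ 0#
    h₀≈0 = trans (+-congˡ (-‿cong (trans (+-identityʳ _) uf₀≈1))) (-‿inverseʳ 1#)
    cancel : 0ˢ ≋ 1ˢ ⊕ ⊖ g ⊛ q
    cancel n = GP.+-cancelˡ (q n) 0# _ (trans (+-identityʳ _) (trans (geometric-unfold h h₀≈0 n) (trans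
      (+-congˡ (trans (S.distribʳ q 1ˢ (⊖ g) n) (+-congʳ (S.*-identityˡ q n))))
      (trans (sym (+-assoc _ _ _)) (trans (+-congʳ (+-comm _ _)) (+-assoc _ _ _))))))

-- Ring homomorphisms acting on sums and series.

IsRingHom : (R R′ : CommutativeRing 0ℓ 0ℓ) →
  (CommutativeRing.Carrier R → CommutativeRing.Carrier R′) → Set
IsRingHom R R′ = IsRingHomomorphism
  where open RingMorphisms (CommutativeRing.rawRing R) (CommutativeRing.rawRing R′)

module RingHomProperties (K R : CommutativeRing 0ℓ 0ℓ)
  (ι : CommutativeRing.Carrier K → CommutativeRing.Carrier R) (ι-hom : IsRingHom K R ι) where
  private
    module K = CommutativeRing K
    module KΣ = Sums K
    module RΣ = Sums R
    module K^ = Exp K.semiring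
  open CommutativeRing R hiding (zero)
  open Exp semiring using (_^_)
  open RingMorphisms.IsRingHomomorphism ι-hom public
    using () renaming (⟦⟧-cong to ι-cong; +-homo to ι-+; *-homo to ι-*; -‿homo to ι-neg; 0#-homo to ι-0; 1#-homo to ι-1)

  ι-∑≤ : ∀ n f → ι (KΣ.∑≤ n f) ≈ RΣ.∑≤ n (ι ∘ f)
  ι-∑≤ zero    f = trans (ι-+ _ _) (+-congˡ ι-0)
  ι-∑≤ (suc n) f = trans (ι-+ _ _) (+-congˡ (ι-∑≤ n (f ∘ suc)))

  ι-^ : ∀ c n → ι (c K^.^ n) ≈ ι c ^ n
  ι-^ c zero    = ι-1
  ι-^ c (suc n) = trans (ι-* _ _) (*-congˡ (ι-^ c n))

module FixedSeries (R : CommutativeRing 0ℓ 0ℓ)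
  (φ : CommutativeRing.Carrier R → CommutativeRing.Carrier R) (φ-hom : IsRingHom R R φ) where
  open CommutativeRing R
  open Sums R using (∑≤; ∑≤-cong)
  open Series R hiding (isCommutativeRing; commutativeRing)
  open RingHomProperties R R φ φ-hom

  φ-⊛ : ∀ f g → φ ∘ (f ⊛ g) ≋ (φ ∘ f) ⊛ (φ ∘ g)
  φ-⊛ f g n = trans (ι-∑≤ n λ i → f i * g (n ∸ i)) (∑≤-cong n λ i → ι-* (f i) (g (n ∸ i)))

  -- For φ = "evaluate, then embed as a constant" this says that a polynomial is free of x; in this
  -- form the property passes through products and compositions of series.
  Fixed : Carrier → Set
  Fixed x = φ x ≈ x

  Fixedˢ : Ser → Set
  Fixedˢ f = ∀ n → Fixed (f n)

  fixed-* : ∀ {x y} → Fixed x → Fixed y → Fixed (x * y)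
  fixed-* φx φy = trans (ι-* _ _) (*-cong φx φy)

  fixed-∑≤ : ∀ n {f} → Fixedˢ f → Fixed (∑≤ n f)
  fixed-∑≤ n {f} φf = trans (ι-∑≤ n f) (∑≤-cong n φf)

  fixed-constant : ∀ {x} → Fixed x → Fixedˢ (constant x)
  fixed-constant φx zero    = φx
  fixed-constant φx (suc n) = ι-0

  fixed-⊛ : ∀ {f g} → Fixedˢ f → Fixedˢ g → Fixedˢ (f ⊛ g)
  fixed-⊛ φf φg n = fixed-∑≤ n λ i → fixed-* (φf i) (φg (n ∸ i))

  fixed-^ˢ : ∀ {f} → Fixedˢ f → ∀ j → Fixedˢ (f ^ˢ j)
  fixed-^ˢ φf zero    = fixed-constant ι-1
  fixed-^ˢ φf (suc j) = fixed-⊛ φf (fixed-^ˢ φf j)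

  fixed-∘ˢ : ∀ {f g} → Fixedˢ f → Fixedˢ g → Fixedˢ (f ∘ˢ g)
  fixed-∘ˢ φf φg n = fixed-∑≤ n λ j → fixed-* (φf j) (fixed-^ˢ φg j n)

-- Factorials and binomial coefficients in an algebra over ℚ.

module RationalAlgebra (R : CommutativeRing 0ℓ 0ℓ)
  (ofℚ : ℚ → CommutativeRing.Carrier R) (ofℚ-hom : IsRingHom ℚₚ.+-*-commutativeRing R ofℚ) where
  open CommutativeRing R
  open SetoidReasoning setoid
  private
    module ofℚ = RingMorphisms.IsRingHomomorphism ofℚ-hom

    weaklyEqual : ∀ p q → Maybe (ofℚ p ≈ ofℚ q)
    weaklyEqual p q = Maybe.map (λ p≡q → reflexive (≡.cong ofℚ p≡q)) (dec⇒maybe (p ℚₚ.≟ q))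

    -- Rational coefficients for the solver: `con q` stands for `ofℚ q`. As `ofℚ 1ℚ` and `1#` agree
    -- only up to `≈`, later calls pass `1#` as a variable.
    ofℚ-morphism : CommutativeRing.rawRing ℚₚ.+-*-commutativeRing
      ACR.-Raw-AlmostCommutative⟶ ACR.fromCommutativeRing R
    ofℚ-morphism = record
      { ⟦_⟧ = ofℚ ; +-homo = ofℚ.+-homo ; *-homo = ofℚ.*-homo ; -‿homo = ofℚ.-‿homo
      ; 0-homo = ofℚ.0#-homo ; 1-homo = ofℚ.1#-homo }

  open RingSolver (CommutativeRing.rawRing ℚₚ.+-*-commutativeRing)
    (ACR.fromCommutativeRing R) ofℚ-morphism weaklyEqual
    public using (solve; _:=_; _:+_; _:*_; _:-_; :-_; con)

  N : ℕ → Carrier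
  N n = ofℚ (fromℕ n)

  1/N! : ℕ → Carrier
  1/N! n = ofℚ 1/[ n ]!

  N-+ : ∀ m n → N (m ℕ.+ n) ≈ N m + N n
  N-+ m n = trans (reflexive (≡.cong ofℚ (fromℕ-+ m n))) (ofℚ.+-homo _ _)

  N-* : ∀ m n → N (m ℕ.* n) ≈ N m * N n
  N-* m n = trans (reflexive (≡.cong ofℚ (fromℕ-* m n))) (ofℚ.*-homo _ _)

  N-0 : N 0 ≈ 0#
  N-0 = ofℚ.0#-homo

  N-1 : N 1 ≈ 1#
  N-1 = ofℚ.1#-homo

  N-suc : ∀ n → N (suc n) ≈ 1# + N n
  N-suc n = trans (N-+ 1 n) (+-congʳ N-1)

  N-∸ : ∀ {m n} → m ≤ n → N (n ∸ m) ≈ N n - N m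
  N-∸ {m} {n} m≤n = begin
    N (n ∸ m)                  ≈⟨ solve 2 (λ x y → x := (x :+ y) :- y) refl (N (n ∸ m)) (N m) ⟩
    (N (n ∸ m) + N m) - N m    ≈⟨ +-congʳ (N-+ (n ∸ m) m) ⟨
    N (n ∸ m ℕ.+ m) - N m      ≡⟨ ≡.cong (λ k → N k - N m) (ℕₚ.m∸n+n≡m m≤n) ⟩
    N n - N m                  ∎

  1/n*N : ∀ n .{{_ : NonZero n}} → ofℚ (+ 1 / n) * N n ≈ 1#
  1/n*N n = trans (sym (ofℚ.*-homo _ _)) (trans (reflexive (≡.cong ofℚ (1/n*n n))) ofℚ.1#-homo)

  1/N!*N : ∀ n → 1/N! n * N (n !) ≈ 1#
  1/N!*N n = 1/n*N (n !) {{n ℕₚ.!≢0}}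

  N-cancel : ∀ n .{{_ : NonZero n}} {x y} → N n * x ≈ N n * y → x ≈ y
  N-cancel n {x} {y} eq = trans (sym (undo x)) (trans (*-congˡ eq) (undo y))
    where
    undo : ∀ z → ofℚ (+ 1 / n) * (N n * z) ≈ z
    undo z = trans (sym (*-assoc _ _ z)) (trans (*-congʳ (1/n*N n)) (*-identityˡ z))

  N!-cancel : ∀ n {x y} → N (n !) * x ≈ N (n !) * y → x ≈ y
  N!-cancel n = N-cancel (n !) {{n ℕₚ.!≢0}}

  1/N!-suc : ∀ n → N (suc n) * 1/N! (suc n) ≈ 1/N! n
  1/N!-suc n = N!-cancel n (begin
    N (n !) * (N (suc n) * 1/N! (suc n))  ≈⟨ solve 3 (λ x y z → x :* (y :* z) := z :* (y :* x)) refl _ _ _ ⟩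
    1/N! (suc n) * (N (suc n) * N (n !))  ≈⟨ *-congˡ (N-* (suc n) (n !)) ⟨
    1/N! (suc n) * N (suc n !)            ≈⟨ 1/N!*N (suc n) ⟩
    1#                                    ≈⟨ 1/N!*N n ⟨
    1/N! n * N (n !)                      ≈⟨ *-comm _ _ ⟩
    N (n !) * 1/N! n                      ∎)

  open SpecialSeries R ofℚ using (falling)

  falling-cong : ∀ {a b} → a ≈ b → ∀ n → falling a n ≈ falling b n
  falling-cong a≈b zero    = refl
  falling-cong a≈b (suc n) = *-cong (falling-cong a≈b n) (+-congʳ a≈b)

  falling-factorial : ∀ {i l} → i ≤ l → falling (N l) i * N ((l ∸ i) !) ≈ N (l !)
  falling-factorial {zero}  {l} _   = *-identityˡ _
  falling-factorial {suc i} {l} i<l = begin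
    falling (N l) i * (N l - N i) * N ((l ∸ suc i) !)
      ≈⟨ *-congʳ (*-congˡ (N-∸ (ℕₚ.<⇒≤ i<l))) ⟨
    falling (N l) i * N (l ∸ i) * N ((l ∸ suc i) !)
      ≈⟨ *-assoc _ _ _ ⟩
    falling (N l) i * (N (l ∸ i) * N ((l ∸ suc i) !))
      ≈⟨ *-congˡ (N-* (l ∸ i) ((l ∸ suc i) !)) ⟨
    falling (N l) i * N ((l ∸ i) ℕ.* (l ∸ suc i) !)
      ≡⟨ ≡.cong (λ k → falling (N l) i * N k) (step i l i<l) ⟩
    falling (N l) i * N ((l ∸ i) !)
      ≈⟨ falling-factorial (ℕₚ.<⇒≤ i<l) ⟩
    N (l !) ∎
    where
    step : ∀ i l → i < l → (l ∸ i) ℕ.* (l ∸ suc i) ! ≡ (l ∸ i) !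
    step zero    (suc l) _         = ≡.refl
    step (suc i) (suc l) (s≤s i<l) = step i l i<l

  nCk*k!*[n∸k]! : ∀ {n k} → k ≤ n → N (n C k) * (N (k !) * N ((n ∸ k) !)) ≈ N (n !)
  nCk*k!*[n∸k]! {n} {k} k≤n = begin
    N (n C k) * (N (k !) * N ((n ∸ k) !))  ≈⟨ *-congˡ (N-* (k !) ((n ∸ k) !)) ⟨
    N (n C k) * N (k ! ℕ.* (n ∸ k) !)      ≈⟨ N-* (n C k) _ ⟨
    N ((n C k) ℕ.* (k ! ℕ.* (n ∸ k) !))      ≡⟨ ≡.cong (λ c → N (c ℕ.* (k ! ℕ.* (n ∸ k) !))) (nCk≡n!/k![n-k]! k≤n) ⟩
    N (n ! ℕ./ (k ! ℕ.* (n ∸ k) !) ℕ.* (k ! ℕ.* (n ∸ k) !)) ≡⟨ ≡.cong N (m/n*n≡m (k![n∸k]!∣n! k≤n)) ⟩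
    N (n !)                                ∎
    where
    instance _ = k ℕₚ.!* (n ∸ k) !≢0

-- The substitution u = - log (1+t).

module LogSubstitution (R : CommutativeRing 0ℓ 0ℓ)
  (ofℚ : ℚ → CommutativeRing.Carrier R) (ofℚ-hom : IsRingHom ℚₚ.+-*-commutativeRing R ofℚ) where
  open CommutativeRing R hiding (zero)
  open Sums R using (∑≤; ∑≤-cong)
  open SumProperties R
  open Series R hiding (isCommutativeRing; commutativeRing)
  open SeriesProperties R
  open RationalAlgebra R ofℚ ofℚ-hom
  open SpecialSeries R ofℚ
  open Exp semiring using (_^_)
  open SetoidReasoning setoid

  D : Ser → Ser
  D f n = N (suc n) * f (suc n)

  θ : Ser → Ser
  θ f n = N n * f n

  -- (1 + t) d/dt
  E : Ser → Ser
  E f = D f ⊕ θ f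

  -- Leibniz rule for t d/dt, by induction along the tail f′ of f: the weight n + 1 splits into 1
  -- and n, the induction hypothesis handles n, and f′ + `θ f′` is `D f`.
  θ-⊛ : ∀ f g → θ (f ⊛ g) ≋ θ f ⊛ g ⊕ f ⊛ θ g
  θ-⊛ f g zero = begin
    N 0 * (f 0 * g 0 + 0#)                        ≈⟨ *-congˡ (+-identityʳ _) ⟩
    N 0 * (f 0 * g 0)                             ≈⟨ solve 2 (λ x y → con 0ℚ :* (x :* y) := con 0ℚ :* x :* y :+ x :* (con 0ℚ :* y)) refl (f 0) (g 0) ⟩
    N 0 * f 0 * g 0 + f 0 * (N 0 * g 0)           ≈⟨ +-cong (+-identityʳ _) (+-identityʳ _) ⟨
    (θ f ⊛ g) 0 + (f ⊛ θ g) 0                     ∎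
  θ-⊛ f g (suc n) = begin
    N (suc n) * (f 0 * g (suc n) + (f′ ⊛ g) n)
      ≈⟨ distribˡ _ _ _ ⟩
    N (suc n) * (f 0 * g (suc n)) + N (suc n) * (f′ ⊛ g) n
      ≈⟨ +-congˡ (*-congʳ (N-suc n)) ⟩
    N (suc n) * (f 0 * g (suc n)) + (1# + N n) * (f′ ⊛ g) n
      ≈⟨ +-congˡ (trans (distribʳ _ _ _) (+-cong (*-identityˡ _) (θ-⊛ f′ g n))) ⟩
    N (suc n) * (f 0 * g (suc n)) + ((f′ ⊛ g) n + ((θ f′ ⊛ g) n + (f′ ⊛ θ g) n))
      ≈⟨ +-cong (solve 3 (λ n x y → n :* (x :* y) := con 0ℚ :* x :* y :+ x :* (n :* y)) refl (N (suc n)) (f 0) (g (suc n))) (sym (+-assoc _ _ _)) ⟩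
    (N 0 * f 0 * g (suc n) + f 0 * θ g (suc n)) + (((f′ ⊛ g) n + (θ f′ ⊛ g) n) + (f′ ⊛ θ g) n)
      ≈⟨ +-congˡ (+-congʳ (sym (⊛-distribʳ g f′ (θ f′) n))) ⟩
    (N 0 * f 0 * g (suc n) + f 0 * θ g (suc n)) + (((f′ ⊕ θ f′) ⊛ g) n + (f′ ⊛ θ g) n)
      ≈⟨ +-congˡ (+-congʳ (S.*-congʳ {g} {f′ ⊕ θ f′} {D f} (λ i → sym (trans (*-congʳ (N-suc i)) (trans (distribʳ _ _ _) (+-congʳ (*-identityˡ _))))) n)) ⟩
    (N 0 * f 0 * g (suc n) + f 0 * θ g (suc n)) + ((D f ⊛ g) n + (f′ ⊛ θ g) n)
      ≈⟨ solve 4 (λ a b c d → (a :+ b) :+ (c :+ d) := (a :+ c) :+ (b :+ d)) refl _ _ _ _ ⟩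
    (θ f ⊛ g) (suc n) + (f ⊛ θ g) (suc n) ∎
    where f′ = f ∘ suc

  -- `D` is `θ` read one index higher, so the rule for `θ` carries over; both boundary terms contain
  -- `N 0`.
  D-⊛ : ∀ f g → D (f ⊛ g) ≋ D f ⊛ g ⊕ f ⊛ D g
  D-⊛ f g n = begin
    θ (f ⊛ g) (suc n)
      ≈⟨ θ-⊛ f g (suc n) ⟩
    (N 0 * f 0 * g (suc n) + (D f ⊛ g) n) + (f ⊛ θ g) (suc n)
      ≈⟨ +-congˡ (⊛-last f (θ g) n) ⟩
    (N 0 * f 0 * g (suc n) + (D f ⊛ g) n) + ((f ⊛ D g) n + f (suc n) * (N 0 * g 0))
      ≈⟨ solve 6 (λ a b c d e f → (con 0ℚ :* a :* b :+ c) :+ (d :+ e :* (con 0ℚ :* f)) := c :+ d) refl _ _ _ _ _ _ ⟩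
    (D f ⊛ g) n + (f ⊛ D g) n ∎

  E-⊛ : ∀ f g → E (f ⊛ g) ≋ E f ⊛ g ⊕ f ⊛ E g
  E-⊛ f g n = begin
    D (f ⊛ g) n + θ (f ⊛ g) n
      ≈⟨ +-cong (D-⊛ f g n) (θ-⊛ f g n) ⟩
    ((D f ⊛ g) n + (f ⊛ D g) n) + ((θ f ⊛ g) n + (f ⊛ θ g) n)
      ≈⟨ solve 4 (λ a b c d → (a :+ b) :+ (c :+ d) := (a :+ c) :+ (b :+ d)) refl _ _ _ _ ⟩
    ((D f ⊛ g) n + (θ f ⊛ g) n) + ((f ⊛ D g) n + (f ⊛ θ g) n)
      ≈⟨ +-cong (⊛-distribʳ g (D f) (θ f) n) (S.distribˡ f (D g) (θ g) n) ⟨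
    (E f ⊛ g) n + (f ⊛ E g) n ∎

  -- The n-th coefficient of `E f` is (n+1) f_{n+1} + n f_n, so it determines f_{n+1} from f_n. This
  -- is the inductive step of nearly all identities below.
  E-step : ∀ f g n → E f n ≈ E g n → f n ≈ g n → f (suc n) ≈ g (suc n)
  E-step f g n Ef≈Eg f≈g = N-cancel (suc n)
    (RingProperties.+-cancelʳ ring (N n * g n) _ _ (trans (+-congˡ (*-congˡ (sym f≈g))) Ef≈Eg))

  -- The equation (1+t) y′ = a y has the solutions y(0) (1+t)^a; the lemma serves to recognise
  -- powers of 1+t.
  ode-unique : ∀ a f g → E f ≋ constant a ⊛ f → E g ≋ constant a ⊛ g → f 0 ≈ g 0 → f ≋ g
  ode-unique a f g Ef Eg f₀≈g₀ zero    = f₀≈g₀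
  ode-unique a f g Ef Eg f₀≈g₀ (suc n) = E-step f g n (begin
    E f n                ≈⟨ Ef n ⟩
    (constant a ⊛ f) n   ≈⟨ constant-⊛ a f n ⟩
    a * f n              ≈⟨ *-congˡ fₙ≈gₙ ⟩
    a * g n              ≈⟨ constant-⊛ a g n ⟨
    (constant a ⊛ g) n   ≈⟨ Eg n ⟨
    E g n                ∎) fₙ≈gₙ
    where fₙ≈gₙ = ode-unique a f g Ef Eg f₀≈g₀ n

  E-[1+t]^ : ∀ a → E ([1+t]^ a) ≋ constant a ⊛ [1+t]^ a
  E-[1+t]^ a n = begin
    N (suc n) * (p * (a - N n) * 1/N! (suc n)) + N n * (p * 1/N! n)
      ≈⟨ solve 6 (λ n+1 n a p q q′ → n+1 :* (p :* (a :- n) :* q′) :+ n :* (p :* q) := p :* (a :- n) :* (n+1 :* q′) :+ n :* (p :* q)) refl _ _ a _ _ _ ⟩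
    p * (a - N n) * (N (suc n) * 1/N! (suc n)) + N n * (p * 1/N! n)
      ≈⟨ +-congʳ (*-congˡ (1/N!-suc n)) ⟩
    p * (a - N n) * 1/N! n + N n * (p * 1/N! n)
      ≈⟨ solve 4 (λ n a p q → p :* (a :- n) :* q :+ n :* (p :* q) := a :* (p :* q)) refl _ _ _ _ ⟩
    a * (p * 1/N! n)
      ≈⟨ constant-⊛ a ([1+t]^ a) n ⟨
    (constant a ⊛ [1+t]^ a) n ∎
    where p = falling a n

  [1+t]^-0 : ∀ a → ([1+t]^ a) 0 ≈ 1#
  [1+t]^-0 a = trans (*-identityˡ _) (RingMorphisms.IsRingHomomorphism.1#-homo ofℚ-hom)

  [1+t]^-cong : ∀ {a b} → a ≈ b → [1+t]^ a ≋ [1+t]^ b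
  [1+t]^-cong a≈b n = *-congʳ (falling-cong a≈b n)

  -- This is Vandermonde's identity, obtained without binomial sums: by the Leibniz rule the product
  -- solves the equation with parameter a + b.
  [1+t]^-+ : ∀ a b → [1+t]^ a ⊛ [1+t]^ b ≋ [1+t]^ (a + b)
  [1+t]^-+ a b = ode-unique (a + b) (f ⊛ g) ([1+t]^ (a + b)) (λ n → begin
    E (f ⊛ g) n                                         ≈⟨ E-⊛ f g n ⟩
    (E f ⊛ g) n + (f ⊛ E g) n                           ≈⟨ +-cong (S.*-congʳ {g} (E-[1+t]^ a) n) (S.*-congˡ {f} (E-[1+t]^ b) n) ⟩
    (constant a ⊛ f ⊛ g) n + (f ⊛ (constant b ⊛ g)) n   ≈⟨ +-cong (S.*-assoc (constant a) f g n) (x∙yz≈y∙xz f (constant b) g n) ⟩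
    (constant a ⊛ (f ⊛ g)) n + (constant b ⊛ (f ⊛ g)) n ≈⟨ +-cong (constant-⊛ a (f ⊛ g) n) (constant-⊛ b (f ⊛ g) n) ⟩
    a * (f ⊛ g) n + b * (f ⊛ g) n                       ≈⟨ distribʳ _ _ _ ⟨
    (a + b) * (f ⊛ g) n                                 ≈⟨ constant-⊛ (a + b) (f ⊛ g) n ⟨
    (constant (a + b) ⊛ (f ⊛ g)) n                      ∎)
    (E-[1+t]^ (a + b))
    (begin
      f 0 * g 0 + 0#         ≈⟨ +-identityʳ _ ⟩
      f 0 * g 0              ≈⟨ *-cong ([1+t]^-0 a) ([1+t]^-0 b) ⟩
      1# * 1#                ≈⟨ *-identityˡ _ ⟩
      1#                     ≈⟨ [1+t]^-0 (a + b) ⟨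
      ([1+t]^ (a + b)) 0     ∎)
    where
    open CommutativeSemigroupProperties S.*-commutativeSemigroup using (x∙yz≈y∙xz)
    f = [1+t]^ a
    g = [1+t]^ b

  E-constant : ∀ c → E (constant c) ≋ 0ˢ
  E-constant c zero    = trans (+-cong (zeroʳ _) (trans (*-congʳ N-0) (zeroˡ c))) (+-identityˡ _)
  E-constant c (suc n) = trans (+-cong (zeroʳ _) (zeroʳ _)) (+-identityˡ _)

  [1+t]^-1-^ : ∀ s → ([1+t]^ (- 1#)) ^ˢ s ≋ [1+t]^ (- N s)
  [1+t]^-1-^ zero = ode-unique (- N 0) 1ˢ ([1+t]^ (- N 0))
    (λ n → trans (E-constant 1# n) (sym (trans (constant-⊛ (- N 0) 1ˢ n) (trans (*-congʳ -0≈0) (zeroˡ _)))))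
    (E-[1+t]^ (- N 0)) (sym ([1+t]^-0 (- N 0)))
    where
    -0≈0 : - N 0 ≈ 0#
    -0≈0 = trans (-‿cong N-0) (RingProperties.-0#≈0# ring)
  [1+t]^-1-^ (suc s) = S.trans (S.*-congˡ {[1+t]^ (- 1#)} ([1+t]^-1-^ s)) (S.trans ([1+t]^-+ (- 1#) (- N s))
    ([1+t]^-cong (trans (RingProperties.-‿+-comm ring 1# (N s)) (-‿cong (sym (N-suc s))))))

  [1+t]^-1-suc : ∀ n → ([1+t]^ (- 1#)) (suc n) ≈ - ([1+t]^ (- 1#)) n
  [1+t]^-1-suc n = N-cancel (suc n) (begin
    N (suc n) * P (suc n)                         ≈⟨ solve 2 (λ x y → x := (x :+ y) :- y) refl _ (N n * P n) ⟩
    E P n - N n * P n                             ≈⟨ +-congʳ (trans (E-[1+t]^ (- 1#) n) (constant-⊛ (- 1#) P n)) ⟩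
    - 1# * P n - N n * P n                        ≈⟨ solve 3 (λ o n p → (:- o) :* p :- n :* p := (o :+ n) :* (:- p)) refl 1# (N n) (P n) ⟩
    (1# + N n) * - P n                            ≈⟨ *-congʳ (N-suc n) ⟨
    N (suc n) * - P n                             ∎)
    where P = [1+t]^ (- 1#)

  1+_t : Carrier → Ser
  1+ c t = λ { 0 → 1# ; 1 → c ; (suc (suc _)) → 0# }

  1+ct-⊛-suc : ∀ c g n → ((1+ c t) ⊛ g) (suc n) ≈ g (suc n) + c * g n
  1+ct-⊛-suc c g n = +-cong (*-identityˡ _)
    (trans (S.*-congʳ {g} {(1+ c t) ∘ suc} {constant c} (λ { zero → refl ; (suc _) → refl }) n) (constant-⊛ c g n))

  1+ct-^ : ∀ c s i → ((1+ c t) ^ˢ s) i ≈ N (s C i) * c ^ i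
  1+ct-^ c zero    zero    = sym (trans (*-identityʳ _) N-1)
  1+ct-^ c zero    (suc i) = sym (trans (*-congʳ (trans (reflexive (≡.cong N (k>n⇒nCk≡0 {0} {suc i} (s≤s z≤n)))) N-0)) (zeroˡ _))
  1+ct-^ c (suc s) zero    = trans (+-identityʳ _) (trans (*-identityˡ _) (1+ct-^ c s zero))
  1+ct-^ c (suc s) (suc i) = begin
    ((1+ c t) ⊛ ((1+ c t) ^ˢ s)) (suc i)
      ≈⟨ 1+ct-⊛-suc c ((1+ c t) ^ˢ s) i ⟩
    ((1+ c t) ^ˢ s) (suc i) + c * ((1+ c t) ^ˢ s) i
      ≈⟨ +-cong (1+ct-^ c s (suc i)) (*-congˡ (1+ct-^ c s i)) ⟩
    N (s C suc i) * (c * c ^ i) + c * (N (s C i) * c ^ i)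
      ≈⟨ solve 4 (λ m n c p → m :* (c :* p) :+ c :* (n :* p) := (n :+ m) :* (c :* p)) refl _ _ c (c ^ i) ⟩
    (N (s C i) + N (s C suc i)) * c ^ suc i
      ≈⟨ *-congʳ (N-+ (s C i) (s C suc i)) ⟨
    N ((s C i) ℕ.+ (s C suc i)) * c ^ suc i
      ≡⟨ ≡.cong (λ k → N k * c ^ suc i) (nCk+nC[k+1]≡[n+1]C[k+1] s i) ⟩
    N (suc s C suc i) * c ^ suc i ∎

  -- f(- log (1+t)), as the solution g of (1+t) g′ = - f′(- log (1+t)) with g(0) = f(0)
  Λ : Ser → Ser
  Λ f zero    = f 0
  Λ f (suc n) = ofℚ (+ 1 / suc n) * (- Λ (D f) n - N n * Λ f n)

  E-Λ : ∀ f → E (Λ f) ≋ ⊖ Λ (D f)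
  E-Λ f n = begin
    N (suc n) * (ofℚ (+ 1 / suc n) * x) + y    ≈⟨ +-congʳ (trans (sym (*-assoc _ _ _)) (*-congʳ (trans (*-comm _ _) (1/n*N (suc n))))) ⟩
    1# * x + y                                 ≈⟨ +-congʳ (*-identityˡ _) ⟩
    (- Λ (D f) n - y) + y                      ≈⟨ solve 2 (λ x y → (x :- y) :+ y := x) refl _ y ⟩
    - Λ (D f) n                                ∎
    where
    x = - Λ (D f) n - N n * Λ f n
    y = N n * Λ f n

  Λ-cong : ∀ {f g} → f ≋ g → Λ f ≋ Λ g
  Λ-cong f≋g zero    = f≋g 0
  Λ-cong f≋g (suc n) = *-congˡ (+-cong (-‿cong (Λ-cong (λ i → *-congˡ (f≋g (suc i))) n))
    (-‿cong (*-congˡ (Λ-cong f≋g n))))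

  E-⊕ : ∀ f g → E (f ⊕ g) ≋ E f ⊕ E g
  E-⊕ f g n = solve 6 (λ m n a b c d → m :* (a :+ b) :+ n :* (c :+ d) := (m :* a :+ n :* c) :+ (m :* b :+ n :* d)) refl _ _ _ _ _ _

  Λ-⊕ : ∀ f g → Λ (f ⊕ g) ≋ Λ f ⊕ Λ g
  Λ-⊕ f g zero    = refl
  Λ-⊕ f g (suc n) = E-step (Λ (f ⊕ g)) (Λ f ⊕ Λ g) n (begin
    E (Λ (f ⊕ g)) n                ≈⟨ E-Λ (f ⊕ g) n ⟩
    - Λ (D (f ⊕ g)) n              ≈⟨ -‿cong (Λ-cong (λ i → distribˡ _ _ _) n) ⟩
    - Λ (D f ⊕ D g) n              ≈⟨ -‿cong (Λ-⊕ (D f) (D g) n) ⟩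
    - (Λ (D f) n + Λ (D g) n)      ≈⟨ RingProperties.-‿+-comm ring _ _ ⟨
    - Λ (D f) n - Λ (D g) n        ≈⟨ +-cong (E-Λ f n) (E-Λ g n) ⟨
    E (Λ f) n + E (Λ g) n          ≈⟨ E-⊕ (Λ f) (Λ g) n ⟨
    E (Λ f ⊕ Λ g) n                ∎)
    (Λ-⊕ f g n)

  -- `E` and `D` both obey the Leibniz rule, so the two sides satisfy the same equation. The
  -- induction on the coefficient runs over all f and g at once, because `D f` or `D g` replaces one
  -- of them.
  Λ-⊛ : ∀ f g → Λ (f ⊛ g) ≋ Λ f ⊛ Λ g
  Λ-⊛ f g n = Λ-⊛-≤ n f g n ℕₚ.≤-refl
    where
    Λ-⊛-≤ : ∀ m f g n → n ≤ m → Λ (f ⊛ g) n ≈ (Λ f ⊛ Λ g) n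
    Λ-⊛-≤ m       f g zero    _         = refl
    Λ-⊛-≤ (suc m) f g (suc n) (s≤s n≤m) = E-step (Λ (f ⊛ g)) (Λ f ⊛ Λ g) n (begin
      E (Λ (f ⊛ g)) n                              ≈⟨ E-Λ (f ⊛ g) n ⟩
      - Λ (D (f ⊛ g)) n                            ≈⟨ -‿cong (Λ-cong (D-⊛ f g) n) ⟩
      - Λ (D f ⊛ g ⊕ f ⊛ D g) n                    ≈⟨ -‿cong (Λ-⊕ (D f ⊛ g) (f ⊛ D g) n) ⟩
      - (Λ (D f ⊛ g) n + Λ (f ⊛ D g) n)            ≈⟨ -‿cong (+-cong (Λ-⊛-≤ m (D f) g n n≤m) (Λ-⊛-≤ m f (D g) n n≤m)) ⟩
      - ((Λ (D f) ⊛ Λ g) n + (Λ f ⊛ Λ (D g)) n)    ≈⟨ RingProperties.-‿+-comm ring _ _ ⟨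
      - (Λ (D f) ⊛ Λ g) n - (Λ f ⊛ Λ (D g)) n      ≈⟨ +-cong (SP.-‿distribˡ-* (Λ (D f)) (Λ g) n) (SP.-‿distribʳ-* (Λ f) (Λ (D g)) n) ⟩
      (⊖ Λ (D f) ⊛ Λ g) n + (Λ f ⊛ ⊖ Λ (D g)) n    ≈⟨ +-cong (S.*-congʳ {Λ g} (E-Λ f) n) (S.*-congˡ {Λ f} (E-Λ g) n) ⟨
      (E (Λ f) ⊛ Λ g) n + (Λ f ⊛ E (Λ g)) n        ≈⟨ E-⊛ (Λ f) (Λ g) n ⟨
      E (Λ f ⊛ Λ g) n                              ∎)
      (Λ-⊛-≤ m f g n n≤m)
      where module SP = RingProperties S.ring

  Λ-0 : Λ 0ˢ ≋ 0ˢ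
  Λ-0 zero    = refl
  Λ-0 (suc n) = E-step (Λ 0ˢ) 0ˢ n (begin
    E (Λ 0ˢ) n       ≈⟨ E-Λ 0ˢ n ⟩
    - Λ (D 0ˢ) n     ≈⟨ -‿cong (trans (Λ-cong {D 0ˢ} {0ˢ} (λ _ → zeroʳ _) n) (Λ-0 n)) ⟩
    - 0#             ≈⟨ RingProperties.-0#≈0# ring ⟩
    0#               ≈⟨ trans (+-cong (zeroʳ _) (zeroʳ _)) (+-identityˡ _) ⟨
    E 0ˢ n           ∎)
    (Λ-0 n)

  Λ-constant : ∀ c → Λ (constant c) ≋ constant c
  Λ-constant c zero    = refl
  Λ-constant c (suc n) = E-step (Λ (constant c)) (constant c) n (begin
    E (Λ (constant c)) n   ≈⟨ E-Λ (constant c) n ⟩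
    - Λ (D (constant c)) n ≈⟨ -‿cong (trans (Λ-cong {D (constant c)} {0ˢ} (λ _ → zeroʳ _) n) (Λ-0 n)) ⟩
    - 0#                   ≈⟨ RingProperties.-0#≈0# ring ⟩
    0#                     ≈⟨ E-constant c n ⟨
    E (constant c) n       ∎)
    (Λ-constant c n)

  Λ-^ : ∀ f s → Λ (f ^ˢ s) ≋ Λ f ^ˢ s
  Λ-^ f zero    = Λ-constant 1#
  Λ-^ f (suc s) = S.trans (Λ-⊛ f (f ^ˢ s)) (S.*-congˡ {Λ f} (Λ-^ f s))

  Λ-exp : ∀ a → Λ e^[ a t] ≋ [1+t]^ (- a)
  Λ-exp a = ode-unique (- a) (Λ e) ([1+t]^ (- a)) (λ n → begin
    E (Λ e) n                       ≈⟨ E-Λ e n ⟩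
    - Λ (D e) n                     ≈⟨ -‿cong (Λ-cong De n) ⟩
    - Λ (constant a ⊛ e) n          ≈⟨ -‿cong (trans (Λ-⊛ (constant a) e n) (S.*-congʳ {Λ e} (Λ-constant a) n)) ⟩
    - (constant a ⊛ Λ e) n          ≈⟨ -‿cong (constant-⊛ a (Λ e) n) ⟩
    - (a * Λ e n)                   ≈⟨ RingProperties.-‿distribˡ-* ring _ _ ⟩
    - a * Λ e n                     ≈⟨ constant-⊛ (- a) (Λ e) n ⟨
    (constant (- a) ⊛ Λ e) n        ∎)
    (E-[1+t]^ (- a)) refl
    where
    e = e^[ a t]
    De : D e ≋ constant a ⊛ e
    De n = begin
      N (suc n) * (a * a ^ n * 1/N! (suc n))    ≈⟨ solve 4 (λ n a p q → n :* (a :* p :* q) := a :* (p :* (n :* q))) refl _ a (a ^ n) _ ⟩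
      a * (a ^ n * (N (suc n) * 1/N! (suc n)))  ≈⟨ *-congˡ (*-congˡ (1/N!-suc n)) ⟩
      a * (a ^ n * 1/N! n)                      ≈⟨ constant-⊛ a e n ⟨
      (constant a ⊛ e) n                        ∎

  -- The Frobenius-Euler factor under the substitution.

  module FrobeniusEuler (lam u v : Carrier)
    (u-inverse : (1# - lam) * u ≈ 1#) (v-inverse : (lam - 1#) * v ≈ 1#) where

    [e^t-lam] : Ser
    [e^t-lam] = e^[ 1# t] ⊕ ⊖ constant lam

    1-lam/[e^t-lam] : Ser
    1-lam/[e^t-lam] = constant (1# - lam) ⊛ reciprocal [e^t-lam] u

    private
      c = lam * v
      P = [1+t]^ (- 1#)
      F = 1-lam/[e^t-lam]
      -- `Q` is 1/F; `c` is λ/(λ-1), while `u` = 1/(1-λ) comes from the definition of F.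
      Q = constant u ⊛ [e^t-lam]

      u≈1-c : u ≈ 1# - c
      u≈1-c = begin
        -- u = (1-λ) u + λ u; the extra summand, zero up to `≈`, makes this a polynomial identity
        -- with `1#` as the variable `o`.
        u                           ≈⟨ solve 3 (λ o l u → u := ((o :- l) :* u :+ l :* u) :+ u :* (con 1ℚ :- o)) refl 1# lam u ⟩
        ((1# - lam) * u + lam * u) + u * (ofℚ 1ℚ - 1#)
                                    ≈⟨ +-congˡ (trans (*-congˡ (trans (+-congʳ N-1) (-‿inverseʳ 1#))) (zeroʳ u)) ⟩
        ((1# - lam) * u + lam * u) + 0#
                                    ≈⟨ +-identityʳ _ ⟩
        (1# - lam) * u + lam * u    ≈⟨ +-cong u-inverse (*-congˡ u≈-v) ⟩
        1# + lam * - v              ≈⟨ +-congˡ (RingProperties.-‿distribʳ-* ring lam v) ⟨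
        1# - c                      ∎
        where
        u≈-v : u ≈ - v
        u≈-v = begin
          u                         ≈⟨ *-identityˡ u ⟨
          1# * u                    ≈⟨ *-congʳ v-inverse ⟨
          (lam - 1#) * v * u        ≈⟨ solve 4 (λ o l u v → (l :- o) :* v :* u := (o :- l) :* u :* (:- v)) refl 1# lam u v ⟩
          (1# - lam) * u * - v      ≈⟨ *-congʳ u-inverse ⟩
          1# * - v                  ≈⟨ *-identityˡ _ ⟩
          - v                       ∎

      F-inverse : Q ⊛ F ≋ 1ˢ
      F-inverse n = begin
        (constant u ⊛ g ⊛ (constant (1# - lam) ⊛ reciprocal g u)) n
          ≈⟨ interchange (constant u) g (constant (1# - lam)) (reciprocal g u) n ⟩
        (constant u ⊛ constant (1# - lam) ⊛ (g ⊛ reciprocal g u)) n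
          ≈⟨ S.*-congʳ {g ⊛ reciprocal g u} {constant u ⊛ constant (1# - lam)} {1ˢ} constants n ⟩
        (1ˢ ⊛ (g ⊛ reciprocal g u)) n
          ≈⟨ S.*-identityˡ (g ⊛ reciprocal g u) n ⟩
        (g ⊛ reciprocal g u) n
          ≈⟨ reciprocal-inverse g u ug₀≈1 n ⟩
        1ˢ n ∎
        where
        open CommutativeSemigroupProperties S.*-commutativeSemigroup using (interchange)
        g = [e^t-lam]
        u[1-lam]≈1 : u * (1# - lam) ≈ 1#
        u[1-lam]≈1 = trans (*-comm _ _) u-inverse
        constants : constant u ⊛ constant (1# - lam) ≋ 1ˢ
        constants zero    = trans (+-identityʳ _) u[1-lam]≈1
        constants (suc n) = trans (constant-⊛ u (constant (1# - lam)) (suc n)) (zeroʳ u)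
        ug₀≈1 : u * g 0 ≈ 1#
        ug₀≈1 = trans (*-congˡ (+-congʳ (trans (*-identityˡ _) N-1))) u[1-lam]≈1

      -- The left side is u ((1+t)^(-1) - λ). In degree 0 both sides are 1 because u inverts 1-λ. In
      -- degree n + 1 the constant λ drops out, and u P_{n+1} = P_{n+1} + c P_n follows from u = 1 -
      -- c and P_{n+1} = - P_n.
      ΛQ : Λ Q ≋ (1+ c t) ⊛ P
      ΛQ n = trans (Λ-⊛ (constant u) [e^t-lam] n) (trans (S.*-congʳ {Λ [e^t-lam]} (Λ-constant u) n)
        (trans (constant-⊛ u (Λ [e^t-lam]) n) (trans (*-congˡ (Λ-⊕ e^[ 1# t] (⊖ constant lam) n))
        (trans (*-congˡ (+-cong (Λ-exp 1# n) (trans (Λ-cong ⊖constant n) (Λ-constant (- lam) n)))) (coefficient n)))))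
        where
        ⊖constant : ⊖ constant lam ≋ constant (- lam)
        ⊖constant zero    = refl
        ⊖constant (suc n) = RingProperties.-0#≈0# ring
        coefficient : ∀ n → u * (P n + constant (- lam) n) ≈ ((1+ c t) ⊛ P) n
        coefficient zero = begin
          u * (P 0 - lam)      ≈⟨ *-congˡ (+-congʳ ([1+t]^-0 (- 1#))) ⟩
          u * (1# - lam)       ≈⟨ trans (*-comm _ _) u-inverse ⟩
          1#                   ≈⟨ trans (*-identityˡ _) ([1+t]^-0 (- 1#)) ⟨
          1# * P 0             ≈⟨ +-identityʳ _ ⟨
          1# * P 0 + 0#        ∎
        coefficient (suc n) = begin
          u * (P (suc n) + 0#)       ≈⟨ *-cong u≈1-c (trans (+-identityʳ _) ([1+t]^-1-suc n)) ⟩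
          (1# - c) * - P n           ≈⟨ solve 3 (λ o c p → (o :- c) :* (:- p) := o :* (:- p) :+ c :* p) refl 1# c (P n) ⟩
          1# * - P n + c * P n       ≈⟨ +-congʳ (trans (*-identityˡ _) (sym ([1+t]^-1-suc n))) ⟩
          P (suc n) + c * P n        ≈⟨ 1+ct-⊛-suc c P n ⟨
          ((1+ c t) ⊛ P) (suc n)     ∎

      ^ˢ-distrib : ∀ f g s → (f ⊛ g) ^ˢ s ≋ (f ^ˢ s) ⊛ (g ^ˢ s)
      ^ˢ-distrib = CommutativeExp.^-distrib-* S.commutativeSemiring

    [1+t]^-expansion : ∀ x s → [1+t]^ (- x) ≋
      ((1+ (lam * v) t) ^ˢ s) ⊛ [1+t]^ (- N s) ⊛ Λ ((1-lam/[e^t-lam] ^ˢ s) ⊛ e^[ x t])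
    [1+t]^-expansion x s n = begin
      ([1+t]^ (- x)) n                                   ≈⟨ Λ-exp x n ⟨
      -- A factor (Q F)^s = 1 is inserted: `Λ` makes Q^s explicit, while F^s joins e^(xu) as the
      -- generating function of the Frobenius-Euler polynomials.
      Λ e^[ x t] n                                       ≈⟨ Λ-cong (S.trans (S.*-congʳ {e^[ x t]} QF^s≋1) (S.*-identityˡ e^[ x t])) n ⟨
      Λ (((Q ⊛ F) ^ˢ s) ⊛ e^[ x t]) n                    ≈⟨ Λ-cong (S.trans (S.*-congʳ {e^[ x t]} (^ˢ-distrib Q F s)) (S.*-assoc (Q ^ˢ s) (F ^ˢ s) e^[ x t])) n ⟩
      Λ ((Q ^ˢ s) ⊛ h) n                                 ≈⟨ Λ-⊛ (Q ^ˢ s) h n ⟩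
      (Λ (Q ^ˢ s) ⊛ Λ h) n                               ≈⟨ S.*-congʳ {Λ h} (S.trans (Λ-^ Q s) (ExpS.^-congˡ s ΛQ)) n ⟩
      ((((1+ c t) ⊛ P) ^ˢ s) ⊛ Λ h) n                    ≈⟨ S.*-congʳ {Λ h} (^ˢ-distrib (1+ c t) P s) n ⟩
      (((1+ c t) ^ˢ s) ⊛ (P ^ˢ s) ⊛ Λ h) n               ≈⟨ S.*-congʳ {Λ h} (S.*-congˡ {(1+ c t) ^ˢ s} ([1+t]^-1-^ s)) n ⟩
      (((1+ c t) ^ˢ s) ⊛ [1+t]^ (- N s) ⊛ Λ h) n         ∎
      where
      module ExpS = Exp S.semiring
      h = (F ^ˢ s) ⊛ e^[ x t]
      1^s≋1 : ∀ s → 1ˢ ^ˢ s ≋ 1ˢ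
      1^s≋1 zero    = S.refl {1ˢ}
      1^s≋1 (suc s) = S.trans (S.*-identityˡ (1ˢ ^ˢ s)) (1^s≋1 s)
      QF^s≋1 : (Q ⊛ F) ^ˢ s ≋ 1ˢ
      QF^s≋1 = S.trans (ExpS.^-congˡ s F-inverse) (1^s≋1 s)

  -- `σ n m` models the coefficient of tⁿ in y^m for y = - log (1+t): since (1+t) y′ = -1, the image
  -- of y^(m+1) under (1+t) d/dt is -(m+1) y^m, which is `σ-rec` coefficient by coefficient.
  module _ (σ : ℕ → ℕ → Carrier) (σ₀₀≈1 : σ 0 0 ≈ 1#)
    (σ-order : ∀ {n m} → n < m → σ n m ≈ 0#)
    (σ-rec₀ : ∀ n → N (suc n) * σ (suc n) 0 + N n * σ n 0 ≈ 0#)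
    (σ-rec : ∀ n m → N (suc n) * σ (suc n) (suc m) + N n * σ n (suc m) ≈ - (N (suc m) * σ n m)) where

    -- The sum obeys the recursion of `Λ`. Under `E` its term m = 0 vanishes by `σ-rec₀`, and
    -- `σ-rec` turns the term m + 1 into -(m+1) f_{m+1} σ n m, a term of the sum for -`D f`. The sum
    -- at n may run to n + 1 as `σ n (suc n)` is zero.
    Λ-coefficients : ∀ f n → Λ f n ≈ ∑≤ n λ m → f m * σ n m
    Λ-coefficients f zero    = sym (trans (+-identityʳ _) (trans (*-congˡ σ₀₀≈1) (*-identityʳ _)))
    Λ-coefficients f (suc n) = E-step (Λ f) (L f) n (begin
      E (Λ f) n
        ≈⟨ E-Λ f n ⟩
      - Λ (D f) n
        ≈⟨ -‿cong (Λ-coefficients (D f) n) ⟩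
      - L (D f) n
        ≈⟨ RingProperties.-1*x≈-x ring _ ⟨
      - 1# * L (D f) n
        ≈⟨ *-distribˡ-∑≤ n (- 1#) (λ m → D f m * σ n m) ⟩
      ∑≤ n (λ m → - 1# * (D f m * σ n m))
        ≈⟨ ∑≤-cong n {f = λ m → - 1# * (D f m * σ n m)} {g = λ m → f (suc m) * τ (suc m)} (λ m → begin
             - 1# * (N (suc m) * f (suc m) * σ n m) ≈⟨ solve 4 (λ o n f s → (:- o) :* (n :* f :* s) := o :* (f :* (:- (n :* s)))) refl 1# _ _ _ ⟩
             1# * (f (suc m) * - (N (suc m) * σ n m)) ≈⟨ *-identityˡ _ ⟩
             f (suc m) * - (N (suc m) * σ n m) ≈⟨ *-congˡ (σ-rec n m) ⟨
             f (suc m) * τ (suc m) ∎) ⟩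
      ∑≤ n (λ m → f (suc m) * τ (suc m))
        ≈⟨ trans (+-congʳ (trans (*-congˡ (σ-rec₀ n)) (zeroʳ _))) (+-identityˡ _) ⟨
      ∑≤ (suc n) (λ m → f m * τ m)
        ≈⟨ ∑≤-cong (suc n) {f = λ m → f m * τ m} {g = λ m → N (suc n) * (f m * σ (suc n) m) + N n * (f m * σ n m)}
             (λ m → solve 5 (λ f a s b u → f :* (a :* s :+ b :* u) := a :* (f :* s) :+ b :* (f :* u)) refl (f m) _ _ _ _) ⟩
      ∑≤ (suc n) (λ m → N (suc n) * (f m * σ (suc n) m) + N n * (f m * σ n m))
        ≈⟨ ∑≤-distrib-+ (suc n) (λ m → N (suc n) * (f m * σ (suc n) m)) (λ m → N n * (f m * σ n m)) ⟩
      ∑≤ (suc n) (λ m → N (suc n) * (f m * σ (suc n) m)) + ∑≤ (suc n) (λ m → N n * (f m * σ n m))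
        ≈⟨ +-cong (*-distribˡ-∑≤ (suc n) (N (suc n)) λ m → f m * σ (suc n) m) (*-distribˡ-∑≤ (suc n) (N n) λ m → f m * σ n m) ⟨
      N (suc n) * L f (suc n) + N n * ∑≤ (suc n) (λ m → f m * σ n m)
        ≈⟨ +-congˡ (*-congˡ (∑≤-extend {f = λ m → f m * σ n m} (ℕₚ.n≤1+n n) λ m n<m _ → trans (*-congˡ (σ-order n<m)) (zeroʳ _))) ⟨
      E (L f) n ∎)
      (Λ-coefficients f n)
      where
      L : Ser → Ser
      L f n = ∑≤ n λ m → f m * σ n m
      τ : ℕ → Carrier
      τ m = N (suc n) * σ (suc n) m + N n * σ n m

-- Comparison of coefficients, with scalars in K and series over R.

module Expansion (K R : CommutativeRing 0ℓ 0ℓ)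
  (ofℚ : ℚ → CommutativeRing.Carrier K) (ofℚ-hom : IsRingHom ℚₚ.+-*-commutativeRing K ofℚ)
  (ι : CommutativeRing.Carrier K → CommutativeRing.Carrier R) (ι-hom : IsRingHom K R ι) where
  private
    module R where
      open CommutativeRing R public hiding (zero)
      open Sums R public
      open SumProperties R public
      open Exp semiring public using (_^_)
    module RS = Series R
  open CommutativeRing K hiding (zero)
  open RationalAlgebra K ofℚ ofℚ-hom
  open SpecialSeries K ofℚ using (falling)
  open Sums K using (∑≤)
  open SumProperties K
  open Exp semiring using (_^_)
  open RingHomProperties K R ι ι-hom

  ι∘ofℚ-hom : IsRingHom ℚₚ.+-*-commutativeRing R (ι ∘ ofℚ)
  ι∘ofℚ-hom = Composition.isRingHomomorphism R.trans ofℚ-hom ι-hom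

  open LogSubstitution R (ι ∘ ofℚ) ι∘ofℚ-hom using (Λ; Λ-coefficients; 1+_t; 1+ct-^; module FrobeniusEuler)
  open SpecialSeries R (ι ∘ ofℚ) using ([1+t]^_; e^[_t])

  sign : ℕ → Carrier
  sign m = (- 1#) ^ m

  module _ (S₁ : ℕ → ℕ → Carrier) (S₁₀₀ : S₁ 0 0 ≈ 1#) (S₁-order : ∀ {n m} → n < m → S₁ n m ≈ 0#)
    (S₁-rec₀ : ∀ n → S₁ (suc n) 0 ≈ - (N n * S₁ n 0))
    (S₁-rec : ∀ n m → S₁ (suc n) (suc m) ≈ S₁ n m - N n * S₁ n (suc m)) where
    private
      -- the coefficient of tⁿ in (- log (1+t))ᵐ
      σ : ℕ → ℕ → Carrier
      σ n m = sign m * N (m !) * (1/N! n * S₁ n m)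

      σ-order : ∀ {n m} → n < m → σ n m ≈ 0#
      σ-order n<m = trans (*-congˡ (trans (*-congˡ (S₁-order n<m)) (zeroʳ _))) (zeroʳ _)

      σ₀₀ : σ 0 0 ≈ 1#
      σ₀₀ = begin
        1# * N 1 * (1/N! 0 * S₁ 0 0) ≈⟨ *-cong (*-identityˡ _) (trans (*-congˡ S₁₀₀) (*-identityʳ _)) ⟩
        N 1 * 1/N! 0                 ≈⟨ *-comm _ _ ⟩
        1/N! 0 * N (0 !)             ≈⟨ 1/N!*N 0 ⟩
        1#                           ∎
        where open SetoidReasoning setoid

      -- One computation for both recurrences: x is S₁(n, m-1), or 0 when m = 0. The term n S₁(n,m)
      -- from the Stirling recurrence cancels against `N n * σ n m`.
      σ-rec′ : ∀ n m x → S₁ (suc n) m ≈ x - N n * S₁ n m →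
        N (suc n) * σ (suc n) m + N n * σ n m ≈ sign m * N (m !) * (1/N! n * x)
      σ-rec′ n m x eq = begin
        N (suc n) * (a * (1/N! (suc n) * S₁ (suc n) m)) + N n * (a * (1/N! n * y))
          ≈⟨ +-congʳ (solve 4 (λ n a f s → n :* (a :* (f :* s)) := a :* ((n :* f) :* s)) refl _ a _ _) ⟩
        a * ((N (suc n) * 1/N! (suc n)) * S₁ (suc n) m) + N n * (a * (1/N! n * y))
          ≈⟨ +-congʳ (*-congˡ (*-cong (1/N!-suc n) eq)) ⟩
        a * (1/N! n * (x - N n * y)) + N n * (a * (1/N! n * y))
          ≈⟨ solve 5 (λ a f x n y → a :* (f :* (x :- n :* y)) :+ n :* (a :* (f :* y)) := a :* (f :* x)) refl a _ x _ y ⟩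
        a * (1/N! n * x) ∎
        where
        open SetoidReasoning setoid
        a = sign m * N (m !)
        y = S₁ n m

      σ-rec₀ : ∀ n → N (suc n) * σ (suc n) 0 + N n * σ n 0 ≈ 0#
      σ-rec₀ n = trans (σ-rec′ n 0 0# (trans (S₁-rec₀ n) (sym (+-identityˡ _))))
        (trans (*-congˡ (zeroʳ _)) (zeroʳ _))

      σ-rec : ∀ n m → N (suc n) * σ (suc n) (suc m) + N n * σ n (suc m) ≈ - (N (suc m) * σ n m)
      σ-rec n m = begin
        N (suc n) * σ (suc n) (suc m) + N n * σ n (suc m)
          ≈⟨ σ-rec′ n (suc m) (S₁ n m) (S₁-rec n m) ⟩
        - 1# * sign m * N (suc m !) * (1/N! n * S₁ n m)
          ≈⟨ *-congʳ (*-congˡ (N-* (suc m) (m !))) ⟩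
        - 1# * sign m * (N (suc m) * N (m !)) * (1/N! n * S₁ n m)
          ≈⟨ solve 5 (λ o s k f x → (:- o) :* s :* (k :* f) :* x := o :* (:- (k :* (s :* f :* x)))) refl 1# _ _ _ _ ⟩
        1# * - (N (suc m) * σ n m)
          ≈⟨ *-identityˡ _ ⟩
        - (N (suc m) * σ n m) ∎
        where open SetoidReasoning setoid

      Λ-σ : ∀ f n → Λ f n R.≈ R.∑≤ n λ m → f m R.* ι (σ n m)
      Λ-σ = Λ-coefficients (λ n m → ι (σ n m)) (R.trans (ι-cong σ₀₀) ι-1)
        (λ n<m → R.trans (ι-cong (σ-order n<m)) ι-0)
        (λ n → R.trans (R.sym (homo (suc n) 0 n)) (R.trans (ι-cong (σ-rec₀ n)) ι-0))
        (λ n m → R.trans (R.sym (homo (suc n) (suc m) n)) (R.trans (ι-cong (σ-rec n m))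
          (R.trans (ι-neg _) (R.-‿cong (ι-* _ _)))))
        where
        homo : ∀ n m n′ → ι (N n * σ n m + N n′ * σ n′ m) R.≈
          ι (N n) R.* ι (σ n m) R.+ ι (N n′) R.* ι (σ n′ m)
        homo n m n′ = R.trans (ι-+ _ _) (R.+-cong (ι-* _ _) (ι-* _ _))

    module _ (lam u v : Carrier) (u-inverse : (1# - lam) * u ≈ 1#) (v-inverse : (lam - 1#) * v ≈ 1#) where
      private
        c = lam * v

        ι-inverse : ∀ {x y z} → (x - y) * z ≈ 1# → (ι x R.- ι y) R.* ι z R.≈ R.1#
        ι-inverse {x} {y} {z} eq = R.trans (R.*-congʳ (R.trans (R.+-congˡ (R.sym (ι-neg y))) (R.sym (ι-+ x (- y)))))
          (R.trans (R.sym (ι-* (x - y) z)) (R.trans (ι-cong eq) ι-1))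

      open FrobeniusEuler (ι lam) (ι u) (ι v)
        (R.trans (R.*-congʳ (R.+-congʳ (R.sym ι-1))) (ι-inverse u-inverse))
        (R.trans (R.*-congʳ (R.+-congˡ (R.-‿cong (R.sym ι-1)))) (ι-inverse v-inverse))
        public

      -- The factor of H_m in the theorem, with `e j` in the place of CP_j(s).
      coefficient : ℕ → ℕ → (ℕ → Carrier) → ℕ → Carrier
      coefficient n s e m = sign m *
        ∑≤ (n ∸ m) λ l → ∑≤ (s ⊓ l) λ i →
          N (n C l) * N (s C i) * falling (N l) i * c ^ i * S₁ (n ∸ l) m * e (l ∸ i)

      module _ (s : ℕ) (e : ℕ → Carrier) (n : ℕ) where
        private
          -- `V l` is the coefficient of t^l in (1+ct)^s Σ_j e_j t^j/j!. `B l m` pairs it with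
          -- t^(n-l) in (- log (1+t))^m; its 1/m! offsets the m! in H_m.
          v′ : ℕ → ℕ → Carrier
          v′ l i = N (s C i) * c ^ i * (1/N! (l ∸ i) * e (l ∸ i))

          V : ℕ → Carrier
          V l = ∑≤ l (v′ l)

          B : ℕ → ℕ → Carrier
          B l m = N (n !) * V l * σ (n ∸ l) m * 1/N! m

          -- The factorials balance: (n choose l) (l)_i (l-i)! (n-l)! = n!. To apply this without
          -- dividing, the products j! · 1/j! for j = l-i, n-l and m are inserted first.
          term : ∀ {i l} m → i ≤ l → l ≤ n →
            sign m * (N (n C l) * N (s C i) * falling (N l) i * c ^ i * S₁ (n ∸ l) m * e (l ∸ i)) ≈
            v′ l i * (N (n !) * σ (n ∸ l) m * 1/N! m)
          term {i} {l} m i≤l l≤n = begin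
            sign m * (N (n C l) * N (s C i) * falling (N l) i * c ^ i * S * e (l ∸ i))
              ≈⟨ solve 7 (λ g C C′ f p S e → g :* (C :* C′ :* f :* p :* S :* e) := C :* f :* (C′ :* p :* e :* (g :* S))) refl (sign m) (N (n C l)) (N (s C i)) (falling (N l) i) (c ^ i) S (e (l ∸ i)) ⟩
            N (n C l) * falling (N l) i * rest
              ≈⟨ trans (trans (sym (*-identityʳ _)) (sym (*-identityʳ _))) (sym (*-identityʳ _)) ⟩
            N (n C l) * falling (N l) i * rest * 1# * 1# * 1#
              ≈⟨ *-cong (*-cong (*-congˡ (1/N!*N (l ∸ i))) (1/N!*N (n ∸ l))) (1/N!*N m) ⟨
            N (n C l) * falling (N l) i * rest * (r * N ((l ∸ i) !)) * (q * N ((n ∸ l) !)) * (1/N! m * N (m !))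
              ≈⟨ solve 9 (λ C f z r a q b k k′ → C :* f :* z :* (r :* a) :* (q :* b) :* (k :* k′) := z :* r :* q :* k :* k′ :* (C :* (f :* a :* b))) refl (N (n C l)) (falling (N l) i) rest r (N ((l ∸ i) !)) q (N ((n ∸ l) !)) (1/N! m) (N (m !)) ⟩
            rest * r * q * 1/N! m * N (m !) * (N (n C l) * (falling (N l) i * N ((l ∸ i) !) * N ((n ∸ l) !)))
              ≈⟨ *-congˡ (trans (*-congˡ (*-congʳ (falling-factorial i≤l))) (nCk*k!*[n∸k]! l≤n)) ⟩
            rest * r * q * 1/N! m * N (m !) * N (n !)
              ≈⟨ solve 10 (λ g C′ p S e r q k k′ n → C′ :* p :* e :* (g :* S) :* r :* q :* k :* k′ :* n := C′ :* p :* (r :* e) :* (n :* (g :* k′ :* (q :* S)) :* k)) refl (sign m) (N (s C i)) (c ^ i) S (e (l ∸ i)) r q (1/N! m) (N (m !)) (N (n !)) ⟩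
            N (s C i) * c ^ i * (r * e (l ∸ i)) * (N (n !) * (sign m * N (m !) * (q * S)) * 1/N! m) ∎
            where
            open SetoidReasoning setoid
            S = S₁ (n ∸ l) m
            r = 1/N! (l ∸ i)
            q = 1/N! (n ∸ l)
            rest = N (s C i) * c ^ i * e (l ∸ i) * (sign m * S)

          -- Both ranges grow by zero terms: (s choose i) vanishes for i > s, so i may run to l, and
          -- σ(n-l, m) vanishes for l > n-m, so l may run to n.
          coefficient≈∑B : ∀ m → m ≤ n → coefficient n s e m ≈ ∑≤ n λ l → B l m
          coefficient≈∑B m m≤n = begin
            sign m * ∑≤ (n ∸ m) (λ l → ∑≤ (s ⊓ l) (a l))
              ≈⟨ *-distribˡ-∑≤ (n ∸ m) (sign m) (λ l → ∑≤ (s ⊓ l) (a l)) ⟩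
            ∑≤ (n ∸ m) (λ l → sign m * ∑≤ (s ⊓ l) (a l))
              ≈⟨ ∑≤-cong-≤ (n ∸ m) (λ l l≤n∸m → inner l (ℕₚ.≤-trans l≤n∸m (ℕₚ.m∸n≤m n m))) ⟩
            ∑≤ (n ∸ m) (λ l → B l m)
              ≈⟨ ∑≤-extend {f = λ l → B l m} (ℕₚ.m∸n≤m n m) (λ l n∸m<l l≤n →
                   trans (*-congʳ (trans (*-congˡ (σ-order (below l n∸m<l l≤n))) (zeroʳ _))) (zeroˡ _)) ⟩
            ∑≤ n (λ l → B l m) ∎
            where
            open SetoidReasoning setoid
            a : ℕ → ℕ → Carrier
            a l i = N (n C l) * N (s C i) * falling (N l) i * c ^ i * S₁ (n ∸ l) m * e (l ∸ i)
            z : ℕ → Carrier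
            z l = N (n !) * σ (n ∸ l) m * 1/N! m
            below : ∀ l → n ∸ m < l → l ≤ n → n ∸ l < m
            below l n∸m<l l≤n = ≡.subst (n ∸ l <_) (ℕₚ.m∸[m∸n]≡n m≤n) (ℕₚ.∸-monoʳ-< n∸m<l l≤n)
            vanish : ∀ l i → s ⊓ l < i → i ≤ l → a l i ≈ 0#
            vanish l i s⊓l<i i≤l = trans (solve 6 (λ C C′ f p S e → C :* C′ :* f :* p :* S :* e := C′ :* (C :* f :* p :* S :* e)) refl (N (n C l)) (N (s C i)) (falling (N l) i) (c ^ i) (S₁ (n ∸ l) m) (e (l ∸ i)))
              (trans (*-congʳ (trans (reflexive (≡.cong N (k>n⇒nCk≡0 s<i))) N-0)) (zeroˡ _))
              where
              s<i : s < i
              s<i with ℕₚ.≤-total s l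
              ... | inj₁ s≤l = ≡.subst (_< i) (ℕₚ.m≤n⇒m⊓n≡m s≤l) s⊓l<i
              ... | inj₂ l≤s = contradiction i≤l (ℕₚ.<⇒≱ (≡.subst (_< i) (ℕₚ.m≥n⇒m⊓n≡n l≤s) s⊓l<i))
            inner : ∀ l → l ≤ n → sign m * ∑≤ (s ⊓ l) (a l) ≈ B l m
            inner l l≤n = begin
              sign m * ∑≤ (s ⊓ l) (a l)
                ≈⟨ *-congˡ (∑≤-extend {f = a l} (ℕₚ.m⊓n≤n s l) (vanish l)) ⟩
              sign m * ∑≤ l (a l)
                ≈⟨ *-distribˡ-∑≤ l (sign m) (a l) ⟩
              ∑≤ l (λ i → sign m * a l i)
                ≈⟨ ∑≤-cong-≤ l (λ i i≤l → term m i≤l l≤n) ⟩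
              ∑≤ l (λ i → v′ l i * z l)
                ≈⟨ *-distribʳ-∑≤ l (z l) (v′ l) ⟨
              V l * z l
                ≈⟨ solve 4 (λ V n σ k → V :* (n :* σ :* k) := n :* V :* σ :* k) refl (V l) (N (n !)) (σ (n ∸ l) m) (1/N! m) ⟩
              B l m ∎

        module _ (x : R.Carrier) (G : RS.Ser)
          (e-generating : ∀ j → ι (1/N! j * e j) R.≈ (G RS.⊛ [1+t]^ (R.- ι (N s))) j) where
          private
            h = (1-lam/[e^t-lam] RS.^ˢ s) RS.⊛ e^[ x t]
            b = (1+ ι lam R.* ι v t) RS.^ˢ s
            p = [1+t]^ (R.- ι (N s))
            H : ℕ → R.Carrier
            H m = ι (N (m !)) R.* h m

          expansion : ι (N (n !)) R.* (G RS.⊛ [1+t]^ (R.- x)) n R.≈ R.∑≤ n λ m → ι (coefficient n s e m) R.* H m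
          expansion = begin
            ι (N (n !)) R.* (G RS.⊛ [1+t]^ (R.- x)) n
              ≈⟨ R.*-congˡ (SP.S.*-congˡ {G} ([1+t]^-expansion x s) n) ⟩
            ι (N (n !)) R.* (G RS.⊛ (b RS.⊛ p RS.⊛ Λ h)) n
              -- G takes up (1+t)^(-s), and by `e-generating` this product generates the numbers
              -- `e j`.
              ≈⟨ R.*-congˡ (rearrange n) ⟩
            ι (N (n !)) R.* (b RS.⊛ (G RS.⊛ p) RS.⊛ Λ h) n
              ≈⟨ R.*-distribˡ-∑≤ n (ι (N (n !))) (λ l → (b RS.⊛ (G RS.⊛ p)) l R.* Λ h (n ∸ l)) ⟩
            R.∑≤ n (λ l → ι (N (n !)) R.* ((b RS.⊛ (G RS.⊛ p)) l R.* Λ h (n ∸ l)))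
              -- Every row is padded with zeros from n-l to n, so that the range is rectangular and
              -- the two sums can be exchanged.
              ≈⟨ R.∑≤-cong n row ⟩
            R.∑≤ n (λ l → R.∑≤ n λ m → ι (B l m) R.* H m)
              ≈⟨ R.∑≤-comm n n (λ l m → ι (B l m) R.* H m) ⟩
            R.∑≤ n (λ m → R.∑≤ n λ l → ι (B l m) R.* H m)
              ≈⟨ R.∑≤-cong-≤ n column ⟩
            R.∑≤ n (λ m → ι (coefficient n s e m) R.* H m) ∎
            where
            open SetoidReasoning R.setoid
            module SP = SeriesProperties R
            rearrange : G RS.⊛ (b RS.⊛ p RS.⊛ Λ h) RS.≋ b RS.⊛ (G RS.⊛ p) RS.⊛ Λ h
            rearrange i = R.trans (R.sym (SP.S.*-assoc G (b RS.⊛ p) (Λ h) i))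
              (SP.S.*-congʳ {Λ h} (CommutativeSemigroupProperties.x∙yz≈y∙xz SP.S.*-commutativeSemigroup G b p) i)
            column : ∀ m → m ≤ n → (R.∑≤ n λ l → ι (B l m) R.* H m) R.≈ ι (coefficient n s e m) R.* H m
            column m m≤n = R.trans (R.sym (R.*-distribʳ-∑≤ n (H m) (λ l → ι (B l m))))
              (R.*-congʳ (R.trans (R.sym (ι-∑≤ n (λ l → B l m))) (ι-cong (sym (coefficient≈∑B m m≤n)))))
            ιV : ∀ l → (b RS.⊛ (G RS.⊛ p)) l R.≈ ι (V l)
            ιV l = R.trans (R.∑≤-cong l {f = λ i → b i R.* (G RS.⊛ p) (l ∸ i)} (λ i → R.trans
                (R.*-cong (R.trans (1+ct-^ (ι lam R.* ι v) s i) (R.*-congˡ (R.trans (R^-congˡ i (R.sym (ι-* lam v))) (R.sym (ι-^ c i)))))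
                  (R.sym (e-generating (l ∸ i))))
                (R.trans (R.*-congʳ (R.sym (ι-* _ _))) (R.sym (ι-* _ _)))))
              (R.sym (ι-∑≤ l (v′ l)))
              where open Exp R.semiring using () renaming (^-congˡ to R^-congˡ)
            entry : ∀ l m → ι (N (n !)) R.* (ι (V l) R.* (h m R.* ι (σ (n ∸ l) m))) R.≈ ι (B l m) R.* H m
            entry l m = begin
              ι N! R.* (ι (V l) R.* (h m R.* ι τ))
                -- The new factor 1 becomes 1/m! · m!: m! turns `h m` into `H m`, and 1/m! goes into
                -- `B l m`.
                ≈⟨ R.trans (R.sym (R.*-identityʳ _)) (R.*-congˡ (R.sym ι-1)) ⟩
              ι N! R.* (ι (V l) R.* (h m R.* ι τ)) R.* ι 1#
                ≈⟨ R.*-congˡ (R.trans (ι-cong (sym (1/N!*N m))) (ι-* _ _)) ⟩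
              ι N! R.* (ι (V l) R.* (h m R.* ι τ)) R.* (ι (1/N! m) R.* ι (N (m !)))
                ≈⟨ RA.solve 6 (λ n V h t k k′ → n RA.:* (V RA.:* (h RA.:* t)) RA.:* (k RA.:* k′) RA.:= n RA.:* V RA.:* t RA.:* k RA.:* (k′ RA.:* h)) R.refl (ι N!) (ι (V l)) (h m) (ι τ) (ι (1/N! m)) (ι (N (m !))) ⟩
              ι N! R.* ι (V l) R.* ι τ R.* ι (1/N! m) R.* H m
                ≈⟨ R.*-congʳ (R.trans (ι-* _ _) (R.*-congʳ (R.trans (ι-* _ _) (R.*-congʳ (ι-* _ _))))) ⟨
              ι (B l m) R.* H m ∎
              where
              module RA = RationalAlgebra R (ι ∘ ofℚ) ι∘ofℚ-hom
              N! = N (n !)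
              τ = σ (n ∸ l) m
            row : ∀ l → ι (N (n !)) R.* ((b RS.⊛ (G RS.⊛ p)) l R.* Λ h (n ∸ l)) R.≈ R.∑≤ n (λ m → ι (B l m) R.* H m)
            row l = begin
              ι (N (n !)) R.* ((b RS.⊛ (G RS.⊛ p)) l R.* Λ h (n ∸ l))
                ≈⟨ R.*-congˡ (R.*-cong (ιV l) (R.trans (Λ-σ h (n ∸ l)) (R.∑≤-extend {f = y} (ℕₚ.m∸n≤m n l)
                     λ m n∸l<m _ → R.trans (R.*-congˡ (R.trans (ι-cong (σ-order n∸l<m)) ι-0)) (R.zeroʳ _)))) ⟩
              ι (N (n !)) R.* (ι (V l) R.* R.∑≤ n y)
                ≈⟨ R.*-congˡ (R.*-distribˡ-∑≤ n (ι (V l)) y) ⟩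
              ι (N (n !)) R.* R.∑≤ n (λ m → ι (V l) R.* y m)
                ≈⟨ R.*-distribˡ-∑≤ n (ι (N (n !))) (λ m → ι (V l) R.* y m) ⟩
              R.∑≤ n (λ m → ι (N (n !)) R.* (ι (V l) R.* y m))
                ≈⟨ R.∑≤-cong n (entry l) ⟩
              R.∑≤ n (λ m → ι (B l m) R.* H m) ∎
              where
              y : ℕ → R.Carrier
              y m = h m R.* ι (σ (n ∸ l) m)

-- Evaluation and coefficients of polynomials.

module PolynomialProperties (K : CommutativeRing 0ℓ 0ℓ) where
  open CommutativeRing K hiding (zero)
  open Polynomials K
  open Series K using (_⊛_; constant; constant-⊛; ⊛-comm; ⊛-identityˡ)
  open SetoidReasoning setoid
  private
    module S = CommutativeRing (Series.commutativeRing K)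
    module KP = RingProperties ring
    module CS = CommutativeSemigroupProperties +-commutativeSemigroup

  module K[x] = CommutativeRing commutativeRing

  eval-zero : ∀ p a → (∀ n → coeff p n ≈ 0#) → eval p a ≈ 0#
  eval-zero []      a p≈0 = refl
  eval-zero (c ∷ p) a p≈0 = trans (+-cong (p≈0 0) (trans (*-congˡ (eval-zero p a (p≈0 ∘ suc))) (zeroʳ a))) (+-identityˡ 0#)

  eval-cong : ∀ p q a → (∀ n → coeff p n ≈ coeff q n) → eval p a ≈ eval q a
  eval-cong []      q       a p≈q = sym (eval-zero q a λ n → sym (p≈q n))
  eval-cong (c ∷ p) []      a p≈q = eval-zero (c ∷ p) a p≈q
  eval-cong (c ∷ p) (d ∷ q) a p≈q = +-cong (p≈q 0) (*-congˡ (eval-cong p q a (p≈q ∘ suc)))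

  eval-+ : ∀ p q a → eval (p +ₚ q) a ≈ eval p a + eval q a
  eval-+ []      q       a = sym (+-identityˡ _)
  eval-+ (c ∷ p) []      a = sym (+-identityʳ _)
  eval-+ (c ∷ p) (d ∷ q) a = begin
    (c + d) + a * eval (p +ₚ q) a             ≈⟨ +-congˡ (trans (*-congˡ (eval-+ p q a)) (distribˡ a _ _)) ⟩
    (c + d) + (a * eval p a + a * eval q a)   ≈⟨ CS.interchange c d _ _ ⟩
    (c + a * eval p a) + (d + a * eval q a)   ∎

  eval-• : ∀ b p a → eval (b • p) a ≈ b * eval p a
  eval-• b []      a = sym (zeroʳ b)
  eval-• b (c ∷ p) a = begin
    b * c + a * eval (b • p) a      ≈⟨ +-congˡ (*-congˡ (eval-• b p a)) ⟩
    b * c + a * (b * eval p a)      ≈⟨ +-congˡ (CommutativeSemigroupProperties.x∙yz≈y∙xz *-commutativeSemigroup a b _) ⟩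
    b * c + b * (a * eval p a)      ≈⟨ distribˡ b _ _ ⟨
    b * (c + a * eval p a)          ∎

  eval-neg : ∀ p a → eval (-ₚ p) a ≈ - eval p a
  eval-neg p a = KP.+-inverseˡ-unique _ _ (trans (sym (eval-+ (-ₚ p) p a))
    (eval-cong (-ₚ p +ₚ p) [] a (coeff≈ (K[x].-‿inverseˡ p))))

  eval-* : ∀ p q a → eval (p *ₚ q) a ≈ eval p a * eval q a
  eval-* []      q a = sym (zeroˡ _)
  eval-* (c ∷ p) q a = begin
    eval (c • q +ₚ (0# ∷ p *ₚ q)) a                ≈⟨ eval-+ (c • q) (0# ∷ p *ₚ q) a ⟩
    eval (c • q) a + (0# + a * eval (p *ₚ q) a)    ≈⟨ +-cong (eval-• c q a) (trans (+-identityˡ _) (*-congˡ (eval-* p q a))) ⟩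
    c * eval q a + a * (eval p a * eval q a)       ≈⟨ +-congˡ (*-assoc a _ _) ⟨
    c * eval q a + a * eval p a * eval q a         ≈⟨ distribʳ _ _ _ ⟨
    (c + a * eval p a) * eval q a                  ∎

  eval-const : ∀ c a → eval (const c) a ≈ c
  eval-const c a = trans (+-congˡ (zeroʳ a)) (+-identityʳ c)

  eval-X : ∀ a → eval X a ≈ a
  eval-X a = trans (+-identityˡ _) (trans (*-congˡ (eval-const 1# a)) (*-identityʳ a))

  eval-isRingHomomorphism : ∀ a → IsRingHom commutativeRing K (λ p → eval p a)
  eval-isRingHomomorphism a = record
    { isSemiringHomomorphism = record
      { isNearSemiringHomomorphism = record
        { +-isMonoidHomomorphism = record
          { isMagmaHomomorphism = record
            { isRelHomomorphism = record { cong = λ {p} {q} p≈q → eval-cong p q a (coeff≈ p≈q) }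
            ; homo = λ p q → eval-+ p q a
            }
          ; ε-homo = refl
          }
        ; *-homo = λ p q → eval-* p q a
        }
      ; 1#-homo = eval-const 1# a
      }
    ; -‿homo = λ p → eval-neg p a
    }

  const-cong : ∀ {c d} → c ≈ d → const c ≈ₚ const d
  const-cong c≈d = mk≈ₚ λ { zero → c≈d ; (suc n) → refl }

  const-isRingHomomorphism : IsRingHom K commutativeRing const
  const-isRingHomomorphism = record
    { isSemiringHomomorphism = record
      { isNearSemiringHomomorphism = record
        { +-isMonoidHomomorphism = record
          { isMagmaHomomorphism = record
            { isRelHomomorphism = record { cong = const-cong }
            ; homo = λ _ _ → K[x].refl
            }
          ; ε-homo = mk≈ₚ λ { zero → refl ; (suc n) → refl }
          }
        ; *-homo = λ c d → mk≈ₚ λ { zero → sym (+-identityʳ _) ; (suc n) → refl }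
        }
      ; 1#-homo = K[x].refl
      }
    ; -‿homo = λ _ → K[x].refl
    }

  const-* : ∀ c p → const c *ₚ p ≈ₚ c • p
  const-* c p = mk≈ₚ λ n → begin
    coeff (const c *ₚ p) n            ≈⟨ coeff-* (const c) p n ⟩
    (coeff (const c) ⊛ coeff p) n     ≈⟨ S.*-congʳ {coeff p} (coeff-const c) n ⟩
    (constant c ⊛ coeff p) n          ≈⟨ constant-⊛ c (coeff p) n ⟩
    c * coeff p n                     ≈⟨ coeff-• c p n ⟨
    coeff (c • p) n                   ∎

  -- For c = n, X - c is the last factor of the falling factorial (X)_{n+1}; this lemma and the next
  -- become the recurrence of the Stirling numbers.
  coeff-*[X-c]₀ : ∀ p c → coeff (p *ₚ (X +ₚ (-ₚ const c))) 0 ≈ - (c * coeff p 0)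
  coeff-*[X-c]₀ p c = begin
    coeff (p *ₚ q) 0                ≈⟨ trans (coeff-* p q 0) (⊛-comm (coeff p) (coeff q) 0) ⟩
    (0# - c) * coeff p 0 + 0#       ≈⟨ trans (+-identityʳ _) (*-congʳ (+-identityˡ _)) ⟩
    - c * coeff p 0                 ≈⟨ KP.-‿distribˡ-* c (coeff p 0) ⟨
    - (c * coeff p 0)               ∎
    where q = X +ₚ (-ₚ const c)

  coeff-*[X-c]₊ : ∀ p c n → coeff (p *ₚ (X +ₚ (-ₚ const c))) (suc n) ≈ coeff p n - c * coeff p (suc n)
  coeff-*[X-c]₊ p c n = begin
    coeff (p *ₚ q) (suc n)
      ≈⟨ trans (coeff-* p q (suc n)) (⊛-comm (coeff p) (coeff q) (suc n)) ⟩
    (0# - c) * coeff p (suc n) + ((coeff q ∘ suc) ⊛ coeff p) n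
      ≈⟨ +-cong (*-congʳ (+-identityˡ _)) (trans (S.*-congʳ {coeff p} (coeff-const 1#) n) (⊛-identityˡ (coeff p) n)) ⟩
    - c * coeff p (suc n) + coeff p n
      ≈⟨ trans (+-comm _ _) (+-congˡ (sym (KP.-‿distribˡ-* c _))) ⟩
    coeff p n - c * coeff p (suc n) ∎
    where q = X +ₚ (-ₚ const c)

-- The expansion for series with polynomial coefficients.

module PolynomialExpansion (K : CommutativeRing 0ℓ 0ℓ)
  (ofℚ : ℚ → CommutativeRing.Carrier K) (ofℚ-hom : IsRingHom ℚₚ.+-*-commutativeRing K ofℚ) where
  open CommutativeRing K hiding (zero)
  open Polynomials K using (Poly; const; X; eval; coeff; _•_; _≈ₚ_; -ₚ_)
  open PolynomialProperties K
  open RationalAlgebra K ofℚ ofℚ-hom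
  private
    K[x]-ring = Polynomials.commutativeRing K
    module Sum[x] = Sums K[x]-ring
  open SpecialSeries K[x]-ring (const ∘ ofℚ)
  open Series K[x]-ring
  open Expansion K K[x]-ring ofℚ ofℚ-hom const const-isRingHomomorphism

  module Evaluation (a : Carrier) where
    -- Embedding the value again gives an endomorphism of K[x], so that a series can be compared
    -- with its own image.
    ⟦_⟧ : Poly → Poly
    ⟦ p ⟧ = const (eval p a)

    ⟦⟧-isRingHomomorphism : IsRingHom K[x]-ring K[x]-ring ⟦_⟧
    ⟦⟧-isRingHomomorphism =
      Composition.isRingHomomorphism K[x].trans (eval-isRingHomomorphism a) const-isRingHomomorphism

    open FixedSeries K[x]-ring ⟦_⟧ ⟦⟧-isRingHomomorphism public
    open RingHomProperties K[x]-ring K[x]-ring ⟦_⟧ ⟦⟧-isRingHomomorphism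

    fixed-const : ∀ c → Fixed (const c)
    fixed-const c = const-cong (eval-const c a)

    fixed-• : ∀ c p → Fixed p → Fixed (c • p)
    fixed-• c p φp = K[x].trans (ι-cong (K[x].sym (const-* c p)))
      (K[x].trans (fixed-* {const c} {p} (fixed-const c) φp) (const-* c p))

    ⟦falling⟧ : ∀ p n → ⟦ falling p n ⟧ ≈ₚ falling ⟦ p ⟧ n
    ⟦falling⟧ p zero    = ι-1
    ⟦falling⟧ p (suc n) = K[x].trans (ι-* (falling p n) _) (K[x].*-cong {⟦ falling p n ⟧} {falling ⟦ p ⟧ n} (⟦falling⟧ p n)
      (K[x].trans (ι-+ p (-ₚ const (N n))) (K[x].+-congˡ {⟦ p ⟧}
        (K[x].trans (ι-neg (const (N n))) (K[x].-‿cong (fixed-const (N n)))))))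

    ⟦binomial⟧ : ∀ p n → ⟦ binomial p n ⟧ ≈ₚ binomial ⟦ p ⟧ n
    ⟦binomial⟧ p n = K[x].trans (ι-* (falling p n) (const (1/N! n)))
      (K[x].*-cong {⟦ falling p n ⟧} {falling ⟦ p ⟧ n} (⟦falling⟧ p n) (fixed-const (1/N! n)))

    binomial-cong : ∀ {p q} → p ≈ₚ q → ∀ n → binomial p n ≈ₚ binomial q n
    binomial-cong = LogSubstitution.[1+t]^-cong K[x]-ring (const ∘ ofℚ) ι∘ofℚ-hom

    fixed-binomial : ∀ {p} → Fixed p → ∀ n → Fixed (binomial p n)
    fixed-binomial {p} φp n = K[x].trans (⟦binomial⟧ p n) (binomial-cong φp n)

    -- Evaluation at a acts on the product factor by factor: it fixes G and sends (1+t)^(-X) to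
    -- (1+t)^(-a). For a = s this is the hypothesis `e-generating` of `expansion`.
    eval-generating : ∀ G → Fixedˢ G → ∀ j →
      const (1/N! j * eval (N (j !) • (G ⊛ [1+t]^ (-ₚ X)) j) a) ≈ₚ (G ⊛ [1+t]^ (-ₚ const a)) j
    eval-generating G φG j = K[x].trans (const-cong (begin
        1/N! j * eval (N (j !) • y) a    ≈⟨ *-congˡ (eval-• (N (j !)) y a) ⟩
        1/N! j * (N (j !) * eval y a)    ≈⟨ *-assoc _ _ _ ⟨
        1/N! j * N (j !) * eval y a      ≈⟨ *-congʳ (1/N!*N j) ⟩
        1# * eval y a                    ≈⟨ *-identityˡ _ ⟩
        eval y a                         ∎))
      (K[x].trans (φ-⊛ G ([1+t]^ (-ₚ X)) j)
        (⊛-cong φG (λ n → K[x].trans (⟦binomial⟧ (-ₚ X) n)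
          (binomial-cong (const-cong (trans (eval-neg X a) (-‿cong (eval-X a)))) n)) j))
      where
      open SetoidReasoning setoid
      y = (G ⊛ [1+t]^ (-ₚ X)) j

  stirling₁ : ℕ → ℕ → Carrier
  stirling₁ n m = coeff (falling X n) m

  stirling₁-rec₀ : ∀ n → stirling₁ (suc n) 0 ≈ - (N n * stirling₁ n 0)
  stirling₁-rec₀ n = coeff-*[X-c]₀ (falling X n) (N n)

  stirling₁-rec : ∀ n m → stirling₁ (suc n) (suc m) ≈ stirling₁ n m - N n * stirling₁ n (suc m)
  stirling₁-rec n m = coeff-*[X-c]₊ (falling X n) (N n) m

  stirling₁-order : ∀ {n m} → n < m → stirling₁ n m ≈ 0#
  stirling₁-order {zero}  {suc m} _         = refl
  stirling₁-order {suc n} {suc m} (s≤s n<m) = begin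
    stirling₁ (suc n) (suc m)                   ≈⟨ stirling₁-rec n m ⟩
    stirling₁ n m - N n * stirling₁ n (suc m)   ≈⟨ +-cong (stirling₁-order n<m) (-‿cong (trans (*-congˡ (stirling₁-order (ℕₚ.m<n⇒m<1+n n<m))) (zeroʳ _))) ⟩
    0# - 0#                                     ≈⟨ -‿inverseʳ 0# ⟩
    0#                                          ∎
    where open SetoidReasoning setoid

  module _ (lam u v : Carrier) (u-inverse : (1# - lam) * u ≈ 1#) (v-inverse : (lam - 1#) * v ≈ 1#)
    (s : ℕ) (G : Ser) (G-fixed : Evaluation.Fixedˢ (N s) G) where

    cauchy frobeniusEuler : ℕ → Poly
    cauchy n = N (n !) • (G ⊛ [1+t]^ (-ₚ X)) n
    frobeniusEuler m = N (m !) •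
      (((constant (const (1# - lam)) ⊛ reciprocal (e^[ const 1# t] ⊕ ⊖ constant (const lam)) (const u)) ^ˢ s)
        ⊛ e^[ X t]) m

    private
      e : ℕ → Carrier
      e j = eval (cauchy j) (N s)

    expansionCoefficient : ℕ → ℕ → Carrier
    expansionCoefficient n = coefficient stirling₁ refl stirling₁-order stirling₁-rec₀ stirling₁-rec
      lam u v u-inverse v-inverse n s e

    cauchy-expansion : ∀ n → cauchy n ≈ₚ Sum[x].∑≤ n λ m → expansionCoefficient n m • frobeniusEuler m
    cauchy-expansion n = K[x].trans (K[x].sym (const-* (N (n !)) ((G ⊛ [1+t]^ (-ₚ X)) n))) (K[x].trans
      (expansion stirling₁ refl stirling₁-order stirling₁-rec₀ stirling₁-rec
        lam u v u-inverse v-inverse s e n X G (Evaluation.eval-generating (N s) G G-fixed))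
      (Sum[x].∑≤-cong n {g = λ m → expansionCoefficient n m • frobeniusEuler m} λ m →
        K[x].trans (K[x].*-congˡ {const (expansionCoefficient n m)} (const-* (N (m !)) (h m)))
          (const-* (expansionCoefficient n m) (frobeniusEuler m))))
      where
      h : Ser
      h = ((constant (const (1# - lam)) ⊛ reciprocal (e^[ const 1# t] ⊕ ⊖ constant (const lam)) (const u)) ^ˢ s)
        ⊛ e^[ X t]

open import Defs

-- The complex numbers and the generating function of CP.

fromℚ-isRingHomomorphism : IsRingHom ℚₚ.+-*-commutativeRing ℂ-commutativeRing fromℚ
fromℚ-isRingHomomorphism = record
  { isSemiringHomomorphism = record
    { isNearSemiringHomomorphism = record
      { +-isMonoidHomomorphism = record
        { isMagmaHomomorphism = record
          { isRelHomomorphism = record { cong = λ { ≡.refl → ℂ-Ring.refl } }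
          ; homo = λ p q → pointwise λ _ → ≡.refl
          }
        ; ε-homo = ℂ-Ring.refl
        }
      ; *-homo = λ p q → pointwise λ _ → ≡.cong₂ _+_i
          (ℚS.solve 2 (λ p q → p ℚS.:* q ℚS.:= p ℚS.:* q ℚS.:- ℚS.con 0ℚ ℚS.:* ℚS.con 0ℚ) ≡.refl p q)
          (ℚS.solve 2 (λ p q → ℚS.con 0ℚ ℚS.:= p ℚS.:* ℚS.con 0ℚ ℚS.:+ ℚS.con 0ℚ ℚS.:* q) ≡.refl p q)
      }
    ; 1#-homo = ℂ-Ring.refl
    }
  ; -‿homo = λ p → pointwise λ _ → ≡.refl
  }
  where module ℚS = +-*-Solver

module GeneratingFunction where
  open SpecialSeries ℂ[x].commutativeRing (const ∘ fromℚ)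
  open Series ℂ[x].commutativeRing
  private
    module ℂ[x]-Ring = CommutativeRing ℂ[x].commutativeRing
    open CommutativeMonoidSum ℂ[x]-Ring.+-commutativeMonoid using (sum)

    w₊ : ℂ → ℕ → Poly
    w₊ lam j = fromℚ ½ • binomial (const lam) (suc j)

    -- The inner series w of peters is local to its definition and has no name here, so it
    -- is recovered by unification. That fails on products such as w ^ˢ suc j, which block on
    -- an unknown w; in petersShape the products are unfolded until w occurs only in w ^ˢ j.
    petersShape : ℂ → ℂ → Ser → Ser
    petersShape lam μ w = constant (const (2^- μ)) ⊛ λ n → b 0 ℂ[x]-Ring.* 1ˢ n ℂ[x]-Ring.+
      sum {n} λ i → b (suc (toℕ i)) ℂ[x]-Ring.*
        sum {n} λ j → w₊ lam (toℕ j) ℂ[x]-Ring.* (w ^ˢ toℕ i) (n ∸ suc (toℕ j))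
      where b = [1+t]^ (const (-ᶜ μ))

    PetersInner : ℂ → ℂ → Set
    PetersInner lam μ = Σ Ser λ w →
      (∀ n → peters lam μ n ≡ petersShape lam μ w n) ×
      peters lam μ ≡ constant (const (2^- μ)) ⊛ ([1+t]^ (const (-ᶜ μ)) ∘ˢ w) ×
      w 0 ≡ [] × (∀ j → w (suc j) ≡ w₊ lam j)
    -- The equation with `petersShape` determines the underscore; the other three then hold by
    -- computation and are the ones `fixed-peters` works with.
    petersInner : ∀ lam μ → PetersInner lam μ
    petersInner lam μ = _ , (λ n → ≡.refl) , ≡.refl , ≡.refl , λ j → ≡.refl

  CP-generating : ℤ → ℂ → ℂ → Ser
  CP-generating k lam μ = peters lam μ ⊛ (Lif k ∘ˢ log[1+t])

  module _ (a : ℂ) where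
    open PolynomialExpansion.Evaluation ℂ-commutativeRing fromℚ fromℚ-isRingHomomorphism a
    open RingMorphisms.IsRingHomomorphism ⟦⟧-isRingHomomorphism using (0#-homo)

    fixed-peters : ∀ lam μ → Fixedˢ (peters lam μ)
    fixed-peters lam μ = fixed (petersInner lam μ)
      where
      b = [1+t]^ (const (-ᶜ μ))
      fixed : PetersInner lam μ → Fixedˢ (peters lam μ)
      fixed (w , _ , peters≡ , w₀≡ , w₊≡) n = ≡.subst (λ f → Fixed (f n)) (≡.sym peters≡)
        (fixed-⊛ {constant (const (2^- μ))} {b ∘ˢ w} (fixed-constant (fixed-const (2^- μ)))
          (fixed-∘ˢ {b} {w} (fixed-binomial (fixed-const (-ᶜ μ))) fixed-w) n)
        where
        fixed-w : Fixedˢ w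
        fixed-w zero    = ≡.subst Fixed (≡.sym w₀≡) 0#-homo
        fixed-w (suc j) = ≡.subst Fixed (≡.sym (w₊≡ j))
          (fixed-• (fromℚ ½) (binomial (const lam) (suc j)) (fixed-binomial (fixed-const lam) (suc j)))

    fixed-Lif : ∀ k → Fixedˢ (Lif k)
    fixed-Lif (+ k)    n = fixed-const _
    fixed-Lif -[1+ k ] n = fixed-const _

    fixed-log[1+t] : Fixedˢ log[1+t]
    fixed-log[1+t] zero    = 0#-homo
    fixed-log[1+t] (suc n) = fixed-const _

    fixed-CP-generating : ∀ k lam μ → Fixedˢ (CP-generating k lam μ)
    fixed-CP-generating k lam μ = fixed-⊛ {peters lam μ} {Lif k ∘ˢ log[1+t]} (fixed-peters lam μ)
      (fixed-∘ˢ {Lif k} {log[1+t]} (fixed-Lif k) fixed-log[1+t])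

theorem11 : (k : ℤ) (μ : ℂ) (s : ℕ) (lam : ℂ) (lam≉1 : lam ≉ 1ℂ) (n : ℕ) →
    CP n k lam μ
    ≈ₚ
    ∑ₚ≤ n λ m →
    ((-ᶜ 1ℂ) ^ᶜ m *ᶜ
    ∑ᶜ≤ (n ∸ m) λ l → ∑ᶜ≤ (s ⊓ l) λ i →
    ofℕ (n C l) *ᶜ ofℕ (s C i) *ᶜ fallingᶜ (ofℕ l) i
    *ᶜ (lam *ᶜ (lam -ᶜ 1ℂ) ⁻¹[ x≉y⇒x-y≉0 lam≉1 ]) ^ᶜ i
    *ᶜ S₁ (n ∸ l) m
    *ᶜ eval (CP (l ∸ i) k lam μ) (ofℕ s))
    • H m s lam lam≉1
-- For this G, `cauchy`, `frobeniusEuler` and `stirling₁` unfold to `CP`, `H` and `S₁`, so the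
-- general expansion has the required form without rewriting.
theorem11 k μ s lam lam≉1 n = cauchy-expansion lam
  ((1ℂ -ᶜ lam) ⁻¹[ 1-lam≉0 ]) ((lam -ᶜ 1ℂ) ⁻¹[ lam-1≉0 ])
  (*-inverseʳ (1ℂ -ᶜ lam) 1-lam≉0) (*-inverseʳ (lam -ᶜ 1ℂ) lam-1≉0)
  s (GeneratingFunction.CP-generating k lam μ)
  (GeneratingFunction.fixed-CP-generating (ofℕ s) k lam μ) n
  where
  open PolynomialExpansion ℂ-commutativeRing fromℚ fromℚ-isRingHomomorphism
  -- Built exactly as inside `H`, so that the two inverses of 1-λ are the same by definition.
  1-lam≉0 = x≉y⇒x-y≉0 (lam≉1 ∘ ℂ-Ring.sym)
  lam-1≉0 = x≉y⇒x-y≉0 lam≉1
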